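{- Let $n\ge 34$ be an integer. Then the forcing spectrum of the generalized Petersen graph $P(n,2)$ is $$\left[\left\lceil \tfrac{n}{12}\right\rceil+1,\ \left\lceil \tfrac{n+3}{7}\right\rceil+\delta(n)\right]\cup\left[\left\lceil \tfrac{n+2}{6}\right\rceil,\ \left\lceil \tfrac{n}{4}\right\rceil\right],$$ where $\delta(n)=1$ if $n\equiv 3\pmod 7$ and $\delta(n)=0$ otherwise, and $[a,b]$ denotes the set of all integers $t$ with $a\le t\le b$.
   Context: For $n\ge 3$, $P(n,2)$ is the simple graph with vertex set $\{u_i,v_i:0\le i\le n-1\}$ and edge set $\{u_iu_{i+2},\,u_iv_i,\,v_iv_{i+1}:0\le i\le n-1\}$, subscripts modulo $n$. For a perfect matching $M$ of a graph $G$, a forcing set of $M$ is a subset $S\subseteq M$ that is contained in no perfect matching of $G$ other than $M$. The forcing number $f(G,M)$ is the minimum cardinality of a forcing set of $M$. The forcing spectrum of $G$ is the set $\{f(G,M): M \text{ a perfect matching of } G\}$. -}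

module Defs where

open import Data.Bool using (if_then_else_)
open import Data.Fin using (Fin; toℕ; remQuot; combine)
open import Data.Fin.Patterns using (0F; 1F; 2F)
open import Data.Fin.Properties using (combine-remQuot; toℕ-fromℕ<)
open import Data.Fin.Subset using (Subset; _∈_; _⊆_; ∣_∣)
open import Data.Nat using (ℕ; _+_; _*_; _∸_; _/_; _%_; _≤_; _<_; _≡ᵇ_; NonZero; >-nonZero; s≤s; z≤n)
open import Data.Nat.Divisibility using (divides; ∣⇒≤)
open import Data.Nat.DivMod using (_mod_; m≡m%n+[m/n]*n; m%n<n)
open import Data.Nat.Properties using (≤-trans; <⇒≱; m≤m+n; +-assoc; +-comm; +-cancelˡ-≡; *-distribʳ-+)
open import Data.Product using (∃-syntax; ∃!; _×_; _,_; proj₁; proj₂; uncurry)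
open import Data.Sum using (_⊎_; inj₁; inj₂)
open import Level using (0ℓ)
open import Relation.Binary.PropositionalEquality
open import Relation.Nullary using (¬_; contradiction)
open import Relation.Unary using (Pred)

SameEnds : {V : Set} → V × V → V × V → Set
SameEnds (a , b) (c , d) = (a ≡ c × b ≡ d) ⊎ (a ≡ d × b ≡ c)

-- The edges are numbered, so that a set of edges is a `Subset size`.  The order
-- of the two components of `ends e` carries no meaning.
record SimpleGraph : Set₁ where
  field
    V           : Set
    size        : ℕ
    ends        : Fin size → V × V
    loopless    : ∀ e → proj₁ (ends e) ≢ proj₂ (ends e)
    no-parallel : ∀ e e′ → SameEnds (ends e) (ends e′) → e ≡ e′

  EdgeSet : Set
  EdgeSet = Subset size

  Incident : V → Fin size → Set
  Incident x e = x ≡ proj₁ (ends e) ⊎ x ≡ proj₂ (ends e)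

  IsPerfectMatching : EdgeSet → Set
  IsPerfectMatching M = ∀ x → ∃! _≡_ λ e → e ∈ M × Incident x e

  IsForcingSet : EdgeSet → EdgeSet → Set
  IsForcingSet M S =
    S ⊆ M × (∀ M′ → IsPerfectMatching M′ → M′ ≢ M → ¬ (S ⊆ M′))

  -- k = f(G,M).
  IsForcingNumber : EdgeSet → ℕ → Set
  IsForcingNumber M k =
    (∃[ S ] IsForcingSet M S × ∣ S ∣ ≡ k) ×
    (∀ S → IsForcingSet M S → k ≤ ∣ S ∣)

forcingSpectrum : SimpleGraph → Pred ℕ 0ℓ
forcingSpectrum G k = ∃[ M ] IsPerfectMatching M × IsForcingNumber M k
  where open SimpleGraph G

data Vertex (n : ℕ) : Set where
  u v : Fin n → Vertex n

shift : ∀ {n} .{{_ : NonZero n}} → ℕ → Fin n → Fin n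
shift {n} k i = (toℕ i + k) mod n

petersenEnds : ∀ {n} .{{_ : NonZero n}} → Fin 3 × Fin n → Vertex n × Vertex n
petersenEnds (0F , i) = u i , u (shift 2 i)
petersenEnds (1F , i) = u i , v i
petersenEnds (2F , i) = v i , v (shift 1 i)

module _ {n : ℕ} .{{_ : NonZero n}} where

  private
    u-injective : ∀ {i j : Fin n} → u i ≡ u j → i ≡ j
    u-injective refl = refl

    v-injective : ∀ {i j : Fin n} → v i ≡ v j → i ≡ j
    v-injective refl = refl

    toℕ-shift : ∀ k (i : Fin n) →
                ∃[ q ] toℕ i + k ≡ toℕ (shift k i) + q * n
    toℕ-shift k i = (toℕ i + k) / n ,
      trans (m≡m%n+[m/n]*n (toℕ i + k) n)
            (cong (_+ (toℕ i + k) / n * n) (sym (toℕ-fromℕ< (m%n<n (toℕ i + k) n))))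

    no-wrap : ∀ a q k .{{_ : NonZero k}} → k < n → a + k ≢ a + q * n
    no-wrap a q k k<n eq =
      <⇒≱ k<n (∣⇒≤ (divides q (+-cancelˡ-≡ a k (q * n) eq)))

  shift-≢ : ∀ k .{{_ : NonZero k}} → k < n → (i : Fin n) → i ≢ shift k i
  shift-≢ k k<n i i≡ with toℕ-shift k i
  ... | q , eq = no-wrap (toℕ i) q k k<n
    (trans eq (cong (λ j → toℕ j + q * n) (sym i≡)))

  shift-asym : ∀ k .{{_ : NonZero (k + k)}} → k + k < n → (i j : Fin n) →
               i ≡ shift k j → shift k i ≢ j
  shift-asym k 2k<n i j i≡ ≡j with toℕ-shift k i | toℕ-shift k j
  ... | p , eqᵢ | q , eqⱼ = no-wrap (toℕ i) (p + q) (k + k) 2k<n (begin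
    toℕ i + (k + k)             ≡⟨ +-assoc (toℕ i) k k ⟨
    toℕ i + k + k               ≡⟨ cong (_+ k) eqᵢ ⟩
    toℕ (shift k i) + p * n + k ≡⟨ cong (λ x → toℕ x + p * n + k) ≡j ⟩
    toℕ j + p * n + k           ≡⟨ +-assoc (toℕ j) (p * n) k ⟩
    toℕ j + (p * n + k)         ≡⟨ cong (toℕ j +_) (+-comm (p * n) k) ⟩
    toℕ j + (k + p * n)         ≡⟨ +-assoc (toℕ j) k (p * n) ⟨
    toℕ j + k + p * n           ≡⟨ cong (_+ p * n) eqⱼ ⟩
    toℕ (shift k j) + q * n + p * n ≡⟨ cong (λ x → toℕ x + q * n + p * n) (sym i≡) ⟩
    toℕ i + q * n + p * n       ≡⟨ +-assoc (toℕ i) (q * n) (p * n) ⟩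
    toℕ i + (q * n + p * n)     ≡⟨ cong (toℕ i +_) (+-comm (q * n) (p * n)) ⟩
    toℕ i + (p * n + q * n)     ≡⟨ cong (toℕ i +_) (*-distribʳ-+ n p q) ⟨
    toℕ i + (p + q) * n         ∎)
    where open ≡-Reasoning

  petersen-loopless : 5 ≤ n → (e : Fin 3 × Fin n) →
    proj₁ (petersenEnds e) ≢ proj₂ (petersenEnds e)
  petersen-loopless 5≤n (0F , i) eq =
    shift-≢ 2 (≤-trans (m≤m+n 3 2) 5≤n) i (u-injective eq)
  petersen-loopless 5≤n (1F , i) ()
  petersen-loopless 5≤n (2F , i) eq =
    shift-≢ 1 (≤-trans (m≤m+n 2 3) 5≤n) i (v-injective eq)

  petersen-no-parallel : 5 ≤ n → (e e′ : Fin 3 × Fin n) →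
    SameEnds (petersenEnds e) (petersenEnds e′) → e ≡ e′
  petersen-no-parallel 5≤n (0F , i) (0F , j) (inj₁ (eq , _)) =
    cong (0F ,_) (u-injective eq)
  petersen-no-parallel 5≤n (0F , i) (0F , j) (inj₂ (p , q)) =
    contradiction (u-injective q) (shift-asym 2 5≤n i j (u-injective p))
  petersen-no-parallel 5≤n (0F , _) (1F , _) (inj₁ (_ , ()))
  petersen-no-parallel 5≤n (0F , _) (1F , _) (inj₂ (() , _))
  petersen-no-parallel 5≤n (0F , _) (2F , _) (inj₁ (() , _))
  petersen-no-parallel 5≤n (0F , _) (2F , _) (inj₂ (() , _))
  petersen-no-parallel 5≤n (1F , _) (0F , _) (inj₁ (_ , ()))
  petersen-no-parallel 5≤n (1F , _) (0F , _) (inj₂ (_ , ()))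
  petersen-no-parallel 5≤n (1F , i) (1F , j) (inj₁ (eq , _)) =
    cong (1F ,_) (u-injective eq)
  petersen-no-parallel 5≤n (1F , _) (1F , _) (inj₂ (() , _))
  petersen-no-parallel 5≤n (1F , _) (2F , _) (inj₁ (() , _))
  petersen-no-parallel 5≤n (1F , _) (2F , _) (inj₂ (() , _))
  petersen-no-parallel 5≤n (2F , _) (0F , _) (inj₁ (() , _))
  petersen-no-parallel 5≤n (2F , _) (0F , _) (inj₂ (() , _))
  petersen-no-parallel 5≤n (2F , _) (1F , _) (inj₁ (() , _))
  petersen-no-parallel 5≤n (2F , _) (1F , _) (inj₂ (_ , ()))
  petersen-no-parallel 5≤n (2F , i) (2F , j) (inj₁ (eq , _)) =
    cong (2F ,_) (v-injective eq)
  petersen-no-parallel 5≤n (2F , i) (2F , j) (inj₂ (p , q)) =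
    contradiction (v-injective q)
      (shift-asym 1 (≤-trans (m≤m+n 3 2) 5≤n) i j (v-injective p))

-- P(n,2).  The three families of edges are numbered by Fin (3 * n); this needs
-- n ≥ 5, because for n = 4 the edges u₀u₂ and u₂u₀ (and u₁u₃ and u₃u₁) coincide.
P[_,2] : (n : ℕ) → 5 ≤ n → SimpleGraph
P[ n ,2] 5≤n = record
  { V           = Vertex n
  ; size        = 3 * n
  ; ends        = λ e → petersenEnds (remQuot n e)
  ; loopless    = λ e → petersen-loopless 5≤n (remQuot n e)
  ; no-parallel = λ e e′ same → begin
      e                            ≡⟨ combine-remQuot {3} n e ⟨
      uncurry combine (remQuot n e) ≡⟨ cong (uncurry combine)
        (petersen-no-parallel 5≤n (remQuot n e) (remQuot n e′) same) ⟩
      uncurry combine (remQuot n e′) ≡⟨ combine-remQuot {3} n e′ ⟩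
      e′                           ∎
  }
  where
  open ≡-Reasoning
  instance
    n≢0 : NonZero n
    n≢0 = >-nonZero (≤-trans (s≤s z≤n) 5≤n)

⌈_/_⌉ : (m d : ℕ) .{{_ : NonZero d}} → ℕ
⌈ m / d ⌉ = (m + (d ∸ 1)) / d

δ : ℕ → ℕ
δ n = if n % 7 ≡ᵇ 3 then 1 else 0

[_,_] : ℕ → ℕ → Pred ℕ 0ℓ
[ a , b ] t = a ≤ t × t ≤ b

{-# OPTIONS --safe #-}
-- Read the columns uᵢuᵢ₊₂, uᵢvᵢ, vᵢvᵢ₊₁ from left to right and remember which of
-- uᵢ, uᵢ₊₁, vᵢ are already matched.  Perfect matchings become the closed paths of
-- length n in a graph with eight states, which splits into two components: in one
-- of them the closed paths are the cyclic tilings by tiles 𝟏 (a spoke) and 𝐪 (four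
-- columns), in the other those by 𝐓 (three columns) and 𝐐 (four columns).  The
-- two components yield the two intervals of the spectrum.
--
-- Upper bounds come from marking a tiling from left to right.  After a pin, a few
-- marks that exclude every other state, a path is known up to some column, and a
-- further mark extends this knowledge by at least four columns (by seven in the
-- second component).  For lower bounds, follow all paths through the marks read so
-- far: only finitely many tables of their end states arise, and a potential on
-- these tables bounds the number of marks in terms of the number of columns.
module Submission where

open import Defs
open import Data.Bool using (Bool; T; true; false; _∧_; _∨_; not; if_then_else_)
open import Data.Bool.ListAction using (all; any)
import Data.Bool.Properties as Bool
open import Data.Empty using (⊥; ⊥-elim)
open import Data.Fin using (Fin; zero; suc; toℕ; remQuot; combine)
open import Data.Fin.Patterns using (0F; 1F; 2F; 3F; 4F; 5F)
open import Data.Fin.Properties using (combine-remQuot; remQuot-combine; combine-injective; toℕ-injective; toℕ-fromℕ<; toℕ<n)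
open import Data.Fin.Subset using (Subset; _∈_; _⊆_; ∣_∣)
open import Data.List using (List; []; _∷_; _++_; map; length; concatMap; zip)
open import Data.List.Membership.Propositional renaming (_∈_ to _∈ˡ_)
import Data.List.Properties as List
open import Data.List.Relation.Binary.Pointwise using (Pointwise; []; _∷_; Pointwise-length)
open import Data.List.Relation.Unary.All using (All; []; _∷_)
open import Data.List.Relation.Unary.Any using (here; there)
open import Data.Nat using (ℕ; zero; suc; _+_; _*_; _∸_; _≤_; _<_; _≤ᵇ_; _≡ᵇ_; _/_; _%_; z≤n; s≤s; NonZero; >-nonZero)
open import Data.Nat.DivMod using (_mod_; m≡m%n+[m/n]*n; m%n<n; m%n%n≡m%n; m<n⇒m%n≡m; [m+n]%n≡m%n; [m+kn]%n≡m%n; %-distribˡ-+; m<n*o⇒m/o<n; m/n*n≤m; /-monoˡ-≤; m*n/n≡m)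
open import Data.Nat.Properties
open import Data.Nat.Solver using (module +-*-Solver)
open import Data.Product using (∃-syntax; ∃!; _×_; _,_; proj₁; proj₂)
open import Data.Sum using (_⊎_; inj₁; inj₂)
open import Data.Vec as Vec using (Vec; []; _∷_; lookup; tabulate; toList; fromList)
import Data.Vec.Properties as VecP
open import Function using (_∘_)
open import Function.Bundles using (_⇔_; mk⇔; module Equivalence)
open import Relation.Binary.PropositionalEquality hiding ([_])
open import Relation.Nullary using (Dec; yes; no; contradiction)
open import Relation.Nullary.Decidable using (⌊_⌋)
open import Relation.Unary using (_≐_; _∪_)

-- Columns, states and paths

-- A rival of the given matching may lie in either component and start in any state, so somewhere
-- the marks have to single out one of eight states. This is the task of the pin, which costs more
-- marks per column than the rest. Away from it marks only keep the state known, and the slopes 1/4,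
-- 1/6, 1/7 and 1/12 of the four ends are the extreme rates at which this is possible. The first
-- component never gets by with fewer than about n/6 marks, the second never needs more than about
-- n/7; hence the gap that may open between the intervals. The bounds valid for all tilings give
-- only the range. To attain every value in between, parts with different rates are mixed, and a
-- bound with a single rate is mostly too weak for the mixture. Such a family therefore has its own
-- automaton, which accepts that family and prices each part by the marks it ought to take. The
-- correction δ(n) belongs to a marking from left to right that wastes no column: a pin of three
-- columns followed by seven columns for each mark, so that n is 3 modulo 7.

record Col : Set where
  constructor ⟨_,_,_⟩
  field skip spoke next : Bool
open Col public

pattern cN  = ⟨ false , false , false ⟩
pattern cU  = ⟨ true  , false , false ⟩
pattern cS  = ⟨ false , true  , false ⟩
pattern cV  = ⟨ false , false , true  ⟩
pattern cUV = ⟨ true  , false , true  ⟩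

_≟ᶜ_ : (c d : Col) → Dec (c ≡ d)
⟨ x , s , y ⟩ ≟ᶜ ⟨ x′ , s′ , y′ ⟩ with x Bool.≟ x′ | s Bool.≟ s′ | y Bool.≟ y′
... | yes refl | yes refl | yes refl = yes refl
... | no ne | _ | _ = no λ { refl → ne refl }
... | yes _ | no ne | _ = no λ { refl → ne refl }
... | yes _ | yes _ | no ne = no λ { refl → ne refl }

infixr 7 _⇒_
_⇒_ : Bool → Bool → Bool
false ⇒ _ = true
true  ⇒ b = b

_⊑ᵇ_ : Col → Col → Bool
⟨ x , s , y ⟩ ⊑ᵇ ⟨ x′ , s′ , y′ ⟩ = (x ⇒ x′) ∧ (s ⇒ s′) ∧ (y ⇒ y′)

_⊑_ : Col → Col → Set
m ⊑ c = m ⊑ᵇ c ≡ true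

_⊑*_ : List Col → List Col → Set
_⊑*_ = Pointwise _⊑_

-- The state before column i records whether uᵢ, uᵢ₊₁ and vᵢ are matched to the
-- left; column i consists of the edges uᵢuᵢ₊₂, uᵢvᵢ and vᵢvᵢ₊₁.
data State : Set where
  a0 a1 a2 a3 b0 b1 b2 b3 : State

-- That uᵢ and vᵢ are matched once gives two conditions on column i. In their sum modulo 2 the spoke
-- cancels, so an edge preserves the parity of the number of true bits of the state. The states `a`
-- are the even ones and the states `b` the odd ones; this is why there are two components.
data Edge : State → Col → State → Set where
  a0a0 : Edge a0 cS a0
  a0a1 : Edge a0 cUV a1
  a1a2 : Edge a1 cU a2
  a2a3 : Edge a2 cV a3
  a3a0 : Edge a3 cN a0
  b0b1 : Edge b0 cU b1
  b1b3 : Edge b1 cS b3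
  b1b2 : Edge b1 cUV b2
  b2b3 : Edge b2 cN b3
  b3b0 : Edge b3 cV b0

infixr 5 _∷_ _++ᴾ_

data Path : State → List Col → State → Set where
  []  : ∀ {p} → Path p [] p
  _∷_ : ∀ {p q r c cs} → Edge p c q → Path q cs r → Path p (c ∷ cs) r

_++ᴾ_ : ∀ {p q r xs ys} → Path p xs q → Path q ys r → Path p (xs ++ ys) r
[]      ++ᴾ ρ = ρ
(e ∷ π) ++ᴾ ρ = e ∷ (π ++ᴾ ρ)

splitᴾ : ∀ {p r} xs {ys} → Path p (xs ++ ys) r → ∃[ q ] Path p xs q × Path q ys r
splitᴾ []       π       = _ , [] , π
splitᴾ (x ∷ xs) (e ∷ π) with splitᴾ xs π
... | q , π₁ , π₂ = q , e ∷ π₁ , π₂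

edge-det : ∀ {p c q q′} → Edge p c q → Edge p c q′ → q ≡ q′
edge-det a0a0 a0a0 = refl
edge-det a0a1 a0a1 = refl
edge-det a1a2 a1a2 = refl
edge-det a2a3 a2a3 = refl
edge-det a3a0 a3a0 = refl
edge-det b0b1 b0b1 = refl
edge-det b1b3 b1b3 = refl
edge-det b1b2 b1b2 = refl
edge-det b2b3 b2b3 = refl
edge-det b3b0 b3b0 = refl

path-det : ∀ {p cs q q′} → Path p cs q → Path p cs q′ → q ≡ q′
path-det []      []       = refl
path-det (e ∷ π) (e′ ∷ ρ) with refl ← edge-det e e′ = path-det π ρ

-- The vertex uᵢ is matched to the left by the skip of column i - 2, and uᵢ₊₁ and vᵢ by the skip and
-- the next edge of column i - 1. So two columns determine the state, whatever came before.
after : Col → Col → State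
after ⟨ true  , _ , _ ⟩ ⟨ true  , _ , true  ⟩ = b2
after ⟨ true  , _ , _ ⟩ ⟨ true  , _ , false ⟩ = a2
after ⟨ true  , _ , _ ⟩ ⟨ false , _ , true  ⟩ = a3
after ⟨ true  , _ , _ ⟩ ⟨ false , _ , false ⟩ = b3
after ⟨ false , _ , _ ⟩ ⟨ true  , _ , true  ⟩ = a1
after ⟨ false , _ , _ ⟩ ⟨ true  , _ , false ⟩ = b1
after ⟨ false , _ , _ ⟩ ⟨ false , _ , true  ⟩ = b0
after ⟨ false , _ , _ ⟩ ⟨ false , _ , false ⟩ = a0

edges-after : ∀ {p q r c d} → Edge p c q → Edge q d r → r ≡ after c d
edges-after a0a0 a0a0 = refl
edges-after a0a0 a0a1 = refl
edges-after a0a1 a1a2 = refl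
edges-after a1a2 a2a3 = refl
edges-after a2a3 a3a0 = refl
edges-after a3a0 a0a0 = refl
edges-after a3a0 a0a1 = refl
edges-after b0b1 b1b3 = refl
edges-after b0b1 b1b2 = refl
edges-after b1b3 b3b0 = refl
edges-after b1b2 b2b3 = refl
edges-after b2b3 b3b0 = refl
edges-after b3b0 b0b1 = refl

-- By `edges-after` the start is forgotten after two columns. Consequently a word of length at least
-- two closes up at no more than one state, and a rival that starts away from home can be compared
-- with the matching by its columns alone.
path-target : ∀ {p p′ q q′ cs} → 2 ≤ length cs → Path p cs q → Path p′ cs q′ → q ≡ q′
path-target (s≤s (s≤s z≤n)) (e ∷ f ∷ π) (e′ ∷ f′ ∷ ρ)
  with refl ← trans (edges-after e f) (sym (edges-after e′ f′)) = path-det π ρ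

-- A marked word pairs each column of a matching (second component) with the
-- part of it that belongs to the forcing set (first component).
Word : Set
Word = List (Col × Col)

marks contents : Word → List Col
marks    = map proj₁
contents = map proj₂

bit : Bool → ℕ
bit b = if b then 1 else 0

count : Col → ℕ
count ⟨ x , s , y ⟩ = bit x + (bit s + bit y)

weight* : List Col → ℕ
weight* []       = 0
weight* (m ∷ ms) = count m + weight* ms

weight : Word → ℕ
weight w = weight* (marks w)

weight*-++ : ∀ xs ys → weight* (xs ++ ys) ≡ weight* xs + weight* ys
weight*-++ []       ys = refl
weight*-++ (x ∷ xs) ys = trans (cong (count x +_) (weight*-++ xs ys)) (sym (+-assoc (count x) _ _))

weight-++ : ∀ x y → weight (x ++ y) ≡ weight x + weight y
weight-++ x y = trans (cong weight* (List.map-++ proj₁ x y)) (weight*-++ (marks x) (marks y))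

-- The rival may close up at any state q, so the marks must also exclude the matchings of the other
-- component.
Forces : List Col → List Col → Set
Forces ms cs = ms ⊑* cs × (∀ {q ds} → Path q ds q → ms ⊑* ds → ds ≡ cs)

Forcing : Word → Set
Forcing w = Forces (marks w) (contents w)

split⊑ : ∀ xs {ys cs} → (xs ++ ys) ⊑* cs →
         ∃[ cs₁ ] ∃[ cs₂ ] cs ≡ cs₁ ++ cs₂ × xs ⊑* cs₁ × ys ⊑* cs₂
split⊑ []       l       = [] , _ , refl , [] , l
split⊑ (x ∷ xs) (r ∷ l) with split⊑ xs l
... | cs₁ , cs₂ , refl , l₁ , l₂ = _ ∷ cs₁ , cs₂ , refl , r ∷ l₁ , l₂

_++⊑_ : ∀ {xs ys cs ds} → xs ⊑* cs → ys ⊑* ds → (xs ++ ys) ⊑* (cs ++ ds)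
[]      ++⊑ k = k
(r ∷ l) ++⊑ k = r ∷ (l ++⊑ k)

++-split-length : ∀ {A : Set} (xs xs′ : List A) {ys ys′} → length xs ≡ length xs′ →
                  xs ++ ys ≡ xs′ ++ ys′ → xs ≡ xs′ × ys ≡ ys′
++-split-length []       []         _ eq = refl , eq
++-split-length (x ∷ xs) (x′ ∷ xs′) l eq
  with ++-split-length xs xs′ (suc-injective l) (List.∷-injectiveʳ eq)
... | eq₁ , eq₂ = cong₂ _∷_ (List.∷-injectiveˡ eq) eq₁ , eq₂

marks-contents-length : ∀ w → length (marks w) ≡ length (contents w)
marks-contents-length w = trans (List.length-map proj₁ w) (sym (List.length-map proj₂ w))

-- A rival is a closed path, so it can be cut between its two parts and closed again in the other
-- order.
Forcing-rotate : ∀ x y → Forcing (x ++ y) → Forcing (y ++ x)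
Forcing-rotate x y (m , f) = m′ , f′
  where
  split-m : marks x ⊑* contents x × marks y ⊑* contents y
  split-m with split⊑ (marks x) (subst₂ _⊑*_ (List.map-++ proj₁ x y) (List.map-++ proj₂ x y) m)
  ... | cs₁ , cs₂ , eq , l₁ , l₂
    with ++-split-length (contents x) cs₁
           (trans (sym (marks-contents-length x)) (Pointwise-length l₁)) eq
  ... | refl , refl = l₁ , l₂
  m′ : marks (y ++ x) ⊑* contents (y ++ x)
  m′ = subst₂ _⊑*_ (sym (List.map-++ proj₁ y x)) (sym (List.map-++ proj₂ y x))
         (proj₂ split-m ++⊑ proj₁ split-m)
  f′ : ∀ {q cs} → Path q cs q → marks (y ++ x) ⊑* cs → cs ≡ contents (y ++ x)
  f′ {q} {cs} π l with split⊑ (marks y) (subst (_⊑* cs) (List.map-++ proj₁ y x) l)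
  ... | cs₁ , cs₂ , refl , l₁ , l₂ with splitᴾ cs₁ π
  ... | r , π₁ , π₂
    with ++-split-length cs₂ (contents x)
           (trans (sym (Pointwise-length l₂)) (marks-contents-length x))
           (trans (f (π₂ ++ᴾ π₁) (subst (_⊑* _) (sym (List.map-++ proj₁ x y)) (l₂ ++⊑ l₁)))
                  (List.map-++ proj₂ x y))
  ... | refl , refl = sym (List.map-++ proj₂ y x)

-- Following all paths that agree with the marks

data Row : Set where
  row : (A0 A1 A2 A3 B0 B1 B2 B3 : Bool) → Row

infix 8 _∋_
_∋_ : Row → State → Bool
row x0 _ _ _ _ _ _ _ ∋ a0 = x0
row _ x1 _ _ _ _ _ _ ∋ a1 = x1
row _ _ x2 _ _ _ _ _ ∋ a2 = x2
row _ _ _ x3 _ _ _ _ ∋ a3 = x3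
row _ _ _ _ y0 _ _ _ ∋ b0 = y0
row _ _ _ _ _ y1 _ _ ∋ b1 = y1
row _ _ _ _ _ _ y2 _ ∋ b2 = y2
row _ _ _ _ _ _ _ y3 ∋ b3 = y3

∅ ∁a0 ∁b0 : Row
∅          = row false false false false false false false false
∁a0 = row false true true true true true true true
∁b0 = row true true true true false true true true

_∪ʳ_ : Row → Row → Row
row x0 x1 x2 x3 x4 x5 x6 x7 ∪ʳ row y0 y1 y2 y3 y4 y5 y6 y7 =
  row (x0 ∨ y0) (x1 ∨ y1) (x2 ∨ y2) (x3 ∨ y3) (x4 ∨ y4) (x5 ∨ y5) (x6 ∨ y6) (x7 ∨ y7)

∪ʳ-∋ : ∀ X Y q → (X ∪ʳ Y) ∋ q ≡ X ∋ q ∨ Y ∋ q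
∪ʳ-∋ (row _ _ _ _ _ _ _ _) (row _ _ _ _ _ _ _ _) a0 = refl
∪ʳ-∋ (row _ _ _ _ _ _ _ _) (row _ _ _ _ _ _ _ _) a1 = refl
∪ʳ-∋ (row _ _ _ _ _ _ _ _) (row _ _ _ _ _ _ _ _) a2 = refl
∪ʳ-∋ (row _ _ _ _ _ _ _ _) (row _ _ _ _ _ _ _ _) a3 = refl
∪ʳ-∋ (row _ _ _ _ _ _ _ _) (row _ _ _ _ _ _ _ _) b0 = refl
∪ʳ-∋ (row _ _ _ _ _ _ _ _) (row _ _ _ _ _ _ _ _) b1 = refl
∪ʳ-∋ (row _ _ _ _ _ _ _ _) (row _ _ _ _ _ _ _ _) b2 = refl
∪ʳ-∋ (row _ _ _ _ _ _ _ _) (row _ _ _ _ _ _ _ _) b3 = refl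

∨-introˡ : ∀ {x y} → x ≡ true → x ∨ y ≡ true
∨-introˡ refl = refl

∨-introʳ : ∀ {x y} → y ≡ true → x ∨ y ≡ true
∨-introʳ {x} refl = Bool.∨-zeroʳ x

∨-elim : ∀ {x y} → x ∨ y ≡ true → x ≡ true ⊎ y ≡ true
∨-elim {true}  _ = inj₁ refl
∨-elim {false} e = inj₂ e

∧-intro : ∀ {x y} → x ≡ true → y ≡ true → x ∧ y ≡ true
∧-intro refl refl = refl

∧-elim : ∀ {x y} → x ∧ y ≡ true → x ≡ true × y ≡ true
∧-elim {true} e = refl , e

_⊆ᵇ_ : Row → Row → Bool
X ⊆ᵇ Y = at a0 ∧ at a1 ∧ at a2 ∧ at a3 ∧ at b0 ∧ at b1 ∧ at b2 ∧ at b3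
  where
  at : State → Bool
  at q = X ∋ q ⇒ Y ∋ q

⇒-elim : ∀ {x y} → x ⇒ y ≡ true → x ≡ true → y ≡ true
⇒-elim {true} e _ = e

⊆ᵇ-sound : ∀ X Y → X ⊆ᵇ Y ≡ true → ∀ q → X ∋ q ≡ true → Y ∋ q ≡ true
⊆ᵇ-sound X Y e q = ⇒-elim (at q)
  where
  i0 = ∧-elim {X ∋ a0 ⇒ Y ∋ a0} e
  i1 = ∧-elim {X ∋ a1 ⇒ Y ∋ a1} (proj₂ i0)
  i2 = ∧-elim {X ∋ a2 ⇒ Y ∋ a2} (proj₂ i1)
  i3 = ∧-elim {X ∋ a3 ⇒ Y ∋ a3} (proj₂ i2)
  i4 = ∧-elim {X ∋ b0 ⇒ Y ∋ b0} (proj₂ i3)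
  i5 = ∧-elim {X ∋ b1 ⇒ Y ∋ b1} (proj₂ i4)
  i6 = ∧-elim {X ∋ b2 ⇒ Y ∋ b2} (proj₂ i5)
  at : ∀ q → X ∋ q ⇒ Y ∋ q ≡ true
  at a0 = proj₁ i0
  at a1 = proj₁ i1
  at a2 = proj₁ i2
  at a3 = proj₁ i3
  at b0 = proj₁ i4
  at b1 = proj₁ i5
  at b2 = proj₁ i6
  at b3 = proj₂ i6

step : Col → Row → Row
step m X = row
  (X ∋ a0 ∧ m ⊑ᵇ cS ∨ X ∋ a3 ∧ m ⊑ᵇ cN) (X ∋ a0 ∧ m ⊑ᵇ cUV) (X ∋ a1 ∧ m ⊑ᵇ cU) (X ∋ a2 ∧ m ⊑ᵇ cV)
  (X ∋ b3 ∧ m ⊑ᵇ cV) (X ∋ b0 ∧ m ⊑ᵇ cU) (X ∋ b1 ∧ m ⊑ᵇ cUV) (X ∋ b1 ∧ m ⊑ᵇ cS ∨ X ∋ b2 ∧ m ⊑ᵇ cN)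

step-complete : ∀ {p c q} X m → Edge p c q → X ∋ p ≡ true → m ⊑ c → step m X ∋ q ≡ true
step-complete X m a0a0 x l = ∨-introˡ (∧-intro x l)
step-complete X m a0a1 x l = ∧-intro x l
step-complete X m a1a2 x l = ∧-intro x l
step-complete X m a2a3 x l = ∧-intro x l
step-complete X m a3a0 x l = ∨-introʳ {X ∋ a0 ∧ m ⊑ᵇ cS} (∧-intro x l)
step-complete X m b0b1 x l = ∧-intro x l
step-complete X m b1b3 x l = ∨-introˡ (∧-intro x l)
step-complete X m b1b2 x l = ∧-intro x l
step-complete X m b2b3 x l = ∨-introʳ {X ∋ b1 ∧ m ⊑ᵇ cS} (∧-intro x l)
step-complete X m b3b0 x l = ∧-intro x l

step-sound : ∀ X m q → step m X ∋ q ≡ true → ∃[ p ] ∃[ c ] X ∋ p ≡ true × Edge p c q × m ⊑ c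
step-sound X m q e = by q e
  where
  from : ∀ {p c q} → Edge p c q → X ∋ p ∧ m ⊑ᵇ c ≡ true →
         ∃[ p ] ∃[ c ] X ∋ p ≡ true × Edge p c q × m ⊑ c
  from {p} d e = _ , _ , proj₁ (∧-elim {X ∋ p} e) , d , proj₂ (∧-elim {X ∋ p} e)
  by : ∀ q → step m X ∋ q ≡ true → ∃[ p ] ∃[ c ] X ∋ p ≡ true × Edge p c q × m ⊑ c
  by a0 e with ∨-elim {X ∋ a0 ∧ m ⊑ᵇ cS} e
  ... | inj₁ e = from a0a0 e
  ... | inj₂ e = from a3a0 e
  by a1 e = from a0a1 e
  by a2 e = from a1a2 e
  by a3 e = from a2a3 e
  by b0 e = from b3b0 e
  by b1 e = from b0b1 e
  by b2 e = from b1b2 e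
  by b3 e with ∨-elim {X ∋ b1 ∧ m ⊑ᵇ cS} e
  ... | inj₁ e = from b1b3 e
  ... | inj₂ e = from b2b3 e

-- Only `a0` and `b1` have a second outgoing edge; from all other states no path can leave the given
-- one.
divert : ∀ {p c q} → Edge p c q → Col → Row
divert a0a0 m = row false (m ⊑ᵇ cUV) false false false false false false
divert a0a1 m = row (m ⊑ᵇ cS) false false false false false false false
divert b1b3 m = row false false false false false false (m ⊑ᵇ cUV) false
divert b1b2 m = row false false false false false false false (m ⊑ᵇ cS)
divert _    m = ∅

divert-complete : ∀ {p c q c′ q′} (e : Edge p c q) m → Edge p c′ q′ → c′ ≢ c → m ⊑ c′ →
                  divert e m ∋ q′ ≡ true
divert-complete a0a0 m a0a0 ne l = contradiction refl ne
divert-complete a0a0 m a0a1 ne l = l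
divert-complete a0a1 m a0a0 ne l = l
divert-complete a0a1 m a0a1 ne l = contradiction refl ne
divert-complete a1a2 m a1a2 ne l = contradiction refl ne
divert-complete a2a3 m a2a3 ne l = contradiction refl ne
divert-complete a3a0 m a3a0 ne l = contradiction refl ne
divert-complete b0b1 m b0b1 ne l = contradiction refl ne
divert-complete b1b3 m b1b3 ne l = contradiction refl ne
divert-complete b1b3 m b1b2 ne l = l
divert-complete b1b2 m b1b3 ne l = l
divert-complete b1b2 m b1b2 ne l = contradiction refl ne
divert-complete b2b3 m b2b3 ne l = contradiction refl ne
divert-complete b3b0 m b3b0 ne l = contradiction refl ne

∅-empty : ∀ q {A : Set} → ∅ ∋ q ≡ true → A
∅-empty a0 ()
∅-empty a1 ()
∅-empty a2 ()
∅-empty a3 ()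
∅-empty b0 ()
∅-empty b1 ()
∅-empty b2 ()
∅-empty b3 ()

divert-sound : ∀ {p c q} (e : Edge p c q) m q′ → divert e m ∋ q′ ≡ true →
               ∃[ c′ ] Edge p c′ q′ × c′ ≢ c × m ⊑ c′
divert-sound a0a0 m a1 l = cUV , a0a1 , (λ ()) , l
divert-sound a0a1 m a0 l = cS , a0a0 , (λ ()) , l
divert-sound b1b3 m b2 l = cUV , b1b2 , (λ ()) , l
divert-sound b1b2 m b3 l = cS , b1b3 , (λ ()) , l
divert-sound a1a2 m q l = ∅-empty q l
divert-sound a2a3 m q l = ∅-empty q l
divert-sound a3a0 m q l = ∅-empty q l
divert-sound b0b1 m q l = ∅-empty q l
divert-sound b2b3 m q l = ∅-empty q l
divert-sound b3b0 m q l = ∅-empty q l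

run : List Col → Row → Row
run []       X = X
run (m ∷ ms) X = run ms (step m X)

-- deviate π ms X collects the ends of the paths that start in X, or start with π
-- and differ from it.
deviate : ∀ {p cs q} → Path p cs q → List Col → Row → Row
deviate (e ∷ π) (m ∷ ms) X = deviate π ms (step m X ∪ʳ divert e m)
deviate _       _        X = X

run-sound : ∀ ms X q → run ms X ∋ q ≡ true →
            ∃[ p ] ∃[ cs ] X ∋ p ≡ true × Path p cs q × ms ⊑* cs
run-sound []       X q e = q , [] , e , [] , []
run-sound (m ∷ ms) X q e with run-sound ms (step m X) q e
... | p , cs , x , π , l with step-sound X m p x
... | p′ , c , x′ , d , k = p′ , c ∷ cs , x′ , d ∷ π , k ∷ l

-- The two directions serve different ends. Soundness is for lower bounds, where a collected state
-- must come from a genuine rival. Completeness, below, is for upper bounds, where nothing collected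
-- must mean that no rival exists.
deviate-sound : ∀ {p cs r} (π : Path p cs r) ms X q → ms ⊑* cs →
  deviate π ms X ∋ q ≡ true →
  (∃[ p′ ] ∃[ ds ] X ∋ p′ ≡ true × Path p′ ds q × ms ⊑* ds) ⊎
  (∃[ ds ] Path p ds q × ms ⊑* ds × ds ≢ cs)
deviate-sound []      []       X q [] e = inj₁ (q , [] , e , [] , [])
deviate-sound (d ∷ π) (m ∷ ms) X q (k ∷ l) e
  with deviate-sound π ms (step m X ∪ʳ divert d m) q l e
... | inj₂ (ds , ρ , l′ , ne) = inj₂ (_ , d ∷ ρ , k ∷ l′ , ne ∘ List.∷-injectiveʳ)
... | inj₁ (p′ , ds , x , ρ , l′)
  with ∨-elim (trans (sym (∪ʳ-∋ (step m X) (divert d m) p′)) x)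
... | inj₁ y = let p″ , c , z , f , k′ = step-sound X m p′ y in
               inj₁ (p″ , c ∷ ds , z , f ∷ ρ , k′ ∷ l′)
... | inj₂ y = let c , f , ne , k′ = divert-sound d m p′ y in
               inj₂ (c ∷ ds , f ∷ ρ , k′ ∷ l′ , ne ∘ List.∷-injectiveˡ)

deviate-start : ∀ {p cs r p′ ds q} (π : Path p cs r) ms X → length ds ≡ length cs →
  X ∋ p′ ≡ true → Path p′ ds q → ms ⊑* ds → deviate π ms X ∋ q ≡ true
deviate-start []      []       X eq x []      []      = x
deviate-start (d ∷ π) (m ∷ ms) X eq x (f ∷ ρ) (k ∷ l) =
  deviate-start π ms _ (suc-injective eq)
    (trans (∪ʳ-∋ (step m X) (divert d m) _) (∨-introˡ (step-complete X m f x k))) ρ l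

deviate-complete : ∀ {p cs r ds q} (π : Path p cs r) ms X → length ds ≡ length cs →
  Path p ds q → ms ⊑* ds → ds ≢ cs → deviate π ms X ∋ q ≡ true
deviate-complete []      []       X eq []      []      ne = contradiction refl ne
deviate-complete (_∷_ {c = c} d π) (m ∷ ms) X eq (_∷_ {q = q′} {c = c′} f ρ) (k ∷ l) ne with c′ ≟ᶜ c
... | yes refl with refl ← edge-det d f =
  deviate-complete π ms _ (suc-injective eq) ρ l (ne ∘ cong (c ∷_))
... | no c′≢c = deviate-start π ms _ (suc-injective eq)
  (trans (∪ʳ-∋ (step m X) (divert d m) _)
         (∨-introʳ {step m X ∋ q′} (divert-complete d m f c′≢c k))) ρ l

-- Linear arithmetic

infixl 6 _⊕_
infixl 7 _⊛_
data Expr (n : ℕ) : Set where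
  con : ℕ → Expr n
  var : Fin n → Expr n
  _⊕_ : Expr n → Expr n → Expr n
  _⊛_ : ℕ → Expr n → Expr n

⟦_⟧ : ∀ {n} → Expr n → Vec ℕ n → ℕ
⟦ con k ⟧ ρ = k
⟦ var i ⟧ ρ = lookup ρ i
⟦ e ⊕ f ⟧ ρ = ⟦ e ⟧ ρ + ⟦ f ⟧ ρ
⟦ k ⊛ e ⟧ ρ = k * ⟦ e ⟧ ρ

Affine : ℕ → Set
Affine n = ℕ × Vec ℕ n

dot : ∀ {n} → Vec ℕ n → Vec ℕ n → ℕ
dot []       []      = 0
dot (k ∷ ks) (x ∷ ρ) = k * x + dot ks ρ

⟪_⟫ : ∀ {n} → Affine n → Vec ℕ n → ℕ
⟪ k , ks ⟫ ρ = k + dot ks ρ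

affine : ∀ {n} → Expr n → Affine n
affine (con k) = k , Vec.replicate _ 0
affine (var i) = 0 , Vec.updateAt (Vec.replicate _ 0) i suc
affine (e ⊕ f) = proj₁ (affine e) + proj₁ (affine f) , Vec.zipWith _+_ (proj₂ (affine e)) (proj₂ (affine f))
affine (k ⊛ e) = k * proj₁ (affine e) , Vec.map (k *_) (proj₂ (affine e))

dot-0 : ∀ {n} (ρ : Vec ℕ n) → dot (Vec.replicate n 0) ρ ≡ 0
dot-0 []      = refl
dot-0 (x ∷ ρ) = dot-0 ρ

dot-var : ∀ {n} (i : Fin n) ρ → dot (Vec.updateAt (Vec.replicate n 0) i suc) ρ ≡ lookup ρ i
dot-var Fin.zero    (x ∷ ρ) = trans (cong (x + 0 +_) (dot-0 ρ)) (trans (+-identityʳ _) (+-identityʳ x))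
dot-var (Fin.suc i) (x ∷ ρ) = dot-var i ρ

dot-+ : ∀ {n} (as bs ρ : Vec ℕ n) → dot (Vec.zipWith _+_ as bs) ρ ≡ dot as ρ + dot bs ρ
dot-+ []       []       []      = refl
dot-+ (a ∷ as) (b ∷ bs) (x ∷ ρ) = trans (cong ((a + b) * x +_) (dot-+ as bs ρ))
  (+-*-Solver.solve 5 (λ a b x s t → (a :+ b) :* x :+ (s :+ t) := (a :* x :+ s) :+ (b :* x :+ t))
    refl a b x (dot as ρ) (dot bs ρ))
  where open +-*-Solver

dot-* : ∀ {n} k (as ρ : Vec ℕ n) → dot (Vec.map (k *_) as) ρ ≡ k * dot as ρ
dot-* k []       []      = sym (*-zeroʳ k)
dot-* k (a ∷ as) (x ∷ ρ) = trans (cong (k * a * x +_) (dot-* k as ρ))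
  (+-*-Solver.solve 4 (λ k a x s → k :* a :* x :+ k :* s := k :* (a :* x :+ s)) refl k a x (dot as ρ))
  where open +-*-Solver

affine-correct : ∀ {n} (e : Expr n) ρ → ⟪ affine e ⟫ ρ ≡ ⟦ e ⟧ ρ
affine-correct (con k) ρ = trans (cong (k +_) (dot-0 ρ)) (+-identityʳ k)
affine-correct (var i) ρ = dot-var i ρ
affine-correct (e ⊕ f) ρ = trans (cong (_ +_) (dot-+ (proj₂ (affine e)) (proj₂ (affine f)) ρ))
  (trans (+-*-Solver.solve 4 (λ a b s t → (a :+ b) :+ (s :+ t) := (a :+ s) :+ (b :+ t)) refl
            (proj₁ (affine e)) (proj₁ (affine f)) (dot (proj₂ (affine e)) ρ) (dot (proj₂ (affine f)) ρ))
         (cong₂ _+_ (affine-correct e ρ) (affine-correct f ρ)))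
  where open +-*-Solver
affine-correct (k ⊛ e) ρ = trans (cong (k * proj₁ (affine e) +_) (dot-* k (proj₂ (affine e)) ρ))
  (trans (sym (*-distribˡ-+ k (proj₁ (affine e)) _)) (cong (k *_) (affine-correct e ρ)))

below : ∀ {n} → Vec ℕ n → Vec ℕ n → Bool
below []       []       = true
below (a ∷ as) (b ∷ bs) = (a ≤ᵇ b) ∧ below as bs

≤ᵇ-sound : ∀ {m n} → (m ≤ᵇ n) ≡ true → m ≤ n
≤ᵇ-sound {m} {n} e = ≤ᵇ⇒≤ m n (subst T (sym e) _)

dot-mono : ∀ {n} (as bs ρ : Vec ℕ n) → below as bs ≡ true → dot as ρ ≤ dot bs ρ
dot-mono []       []       []      _ = z≤n
dot-mono (a ∷ as) (b ∷ bs) (x ∷ ρ) e with ∧-elim {a ≤ᵇ b} e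
... | e₁ , e₂ = +-mono-≤ (*-monoˡ-≤ x (≤ᵇ-sound {a} {b} e₁)) (dot-mono as bs ρ e₂)

-- Comparing coefficient by coefficient is sound because the variables range over natural numbers.
_≤ᴬ_ : ∀ {n} → Affine n → Affine n → Bool
(k , ks) ≤ᴬ (l , ls) = (k ≤ᵇ l) ∧ below ks ls

≤ᴬ-sound : ∀ {n} (A B : Affine n) ρ → A ≤ᴬ B ≡ true → ⟪ A ⟫ ρ ≤ ⟪ B ⟫ ρ
≤ᴬ-sound (k , ks) (l , ls) ρ e with ∧-elim {k ≤ᵇ l} e
... | e₁ , e₂ = +-mono-≤ (≤ᵇ-sound {k} {l} e₁) (dot-mono ks ls ρ e₂)

Hyps : ℕ → Set
Hyps n = List (ℕ × Expr n × Expr n)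

lhs rhs : ∀ {n} → Hyps n → Expr n
lhs []                 = con 0
lhs ((k , l , _) ∷ hs) = k ⊛ l ⊕ lhs hs
rhs []                 = con 0
rhs ((k , _ , r) ∷ hs) = k ⊛ r ⊕ rhs hs

Holds : ∀ {n} → Vec ℕ n → Hyps n → Set
Holds ρ = All (λ (_ , l , r) → ⟦ l ⟧ ρ ≤ ⟦ r ⟧ ρ)

hyps-sum : ∀ {n} (ρ : Vec ℕ n) hs → Holds ρ hs → ⟦ lhs hs ⟧ ρ ≤ ⟦ rhs hs ⟧ ρ
hyps-sum ρ []                 []       = z≤n
hyps-sum ρ ((k , l , r) ∷ hs) (h ∷ p) = +-mono-≤ (*-monoʳ-≤ k h) (hyps-sum ρ hs p)

-- Farkas: c times the negated goal plus the weighted hypotheses is absurd.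
farkas : ∀ {n} (ρ : Vec ℕ n) c L R hs →
         affine (con 1 ⊕ (c ⊛ L ⊕ rhs hs)) ≤ᴬ affine (c ⊛ (con 1 ⊕ R) ⊕ lhs hs) ≡ true →
         Holds ρ hs → ⟦ L ⟧ ρ ≤ ⟦ R ⟧ ρ
farkas ρ c L R hs e p with ⟦ L ⟧ ρ ≤? ⟦ R ⟧ ρ
... | yes le = le
... | no ≰ = contradiction (begin-strict
    ⟦ c ⊛ L ⊕ rhs hs ⟧ ρ                     <⟨ n<1+n _ ⟩
    ⟦ con 1 ⊕ (c ⊛ L ⊕ rhs hs) ⟧ ρ           ≡⟨ affine-correct (con 1 ⊕ (c ⊛ L ⊕ rhs hs)) ρ ⟨
    ⟪ affine (con 1 ⊕ (c ⊛ L ⊕ rhs hs)) ⟫ ρ  ≤⟨ ≤ᴬ-sound (affine (con 1 ⊕ (c ⊛ L ⊕ rhs hs))) (affine (c ⊛ (con 1 ⊕ R) ⊕ lhs hs)) ρ e ⟩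
    ⟪ affine (c ⊛ (con 1 ⊕ R) ⊕ lhs hs) ⟫ ρ  ≡⟨ affine-correct (c ⊛ (con 1 ⊕ R) ⊕ lhs hs) ρ ⟩
    ⟦ c ⊛ (con 1 ⊕ R) ⊕ lhs hs ⟧ ρ           ≤⟨ +-mono-≤ (*-monoʳ-≤ c (≰⇒> ≰)) (hyps-sum ρ hs p) ⟩
    ⟦ c ⊛ L ⊕ rhs hs ⟧ ρ                     ∎) (<-irrefl refl)
  where open ≤-Reasoning

linear-≡ : ∀ {n} (ρ : Vec ℕ n) A B L R → affine (L ⊕ A) ≡ affine (R ⊕ B) →
           ⟦ A ⟧ ρ ≡ ⟦ B ⟧ ρ → ⟦ L ⟧ ρ ≡ ⟦ R ⟧ ρ
linear-≡ ρ A B L R e eq = +-cancelʳ-≡ (⟦ A ⟧ ρ) (⟦ L ⟧ ρ) (⟦ R ⟧ ρ) (begin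
  ⟦ L ⊕ A ⟧ ρ          ≡⟨ affine-correct (L ⊕ A) ρ ⟨
  ⟪ affine (L ⊕ A) ⟫ ρ ≡⟨ cong (λ A → ⟪ A ⟫ ρ) e ⟩
  ⟪ affine (R ⊕ B) ⟫ ρ ≡⟨ affine-correct (R ⊕ B) ρ ⟩
  ⟦ R ⟧ ρ + ⟦ B ⟧ ρ    ≡⟨ cong (⟦ R ⟧ ρ +_) eq ⟨
  ⟦ R ⟧ ρ + ⟦ A ⟧ ρ    ∎)
  where open ≡-Reasoning

-- Lower bounds from certificates

data Tile : State → Set where
  𝟏 𝐪 : Tile a0
  𝐓 𝐐 : Tile b0

cols : ∀ {s} → Tile s → List Col
cols 𝟏  = cS ∷ []
cols 𝐪  = cUV ∷ cU ∷ cV ∷ cN ∷ []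
cols 𝐓   = cU ∷ cS ∷ cV ∷ []
cols 𝐐 = cU ∷ cUV ∷ cN ∷ cV ∷ []

tile-path : ∀ {s} (t : Tile s) → Path s (cols t) s
tile-path 𝟏  = a0a0 ∷ []
tile-path 𝐪  = a0a1 ∷ a1a2 ∷ a2a3 ∷ a3a0 ∷ []
tile-path 𝐓   = b0b1 ∷ b1b3 ∷ b3b0 ∷ []
tile-path 𝐐 = b0b1 ∷ b1b2 ∷ b2b3 ∷ b3b0 ∷ []

tiling : ∀ {s} → List (Tile s) → List Col
tiling = concatMap cols

tiling-path : ∀ {s} (ts : List (Tile s)) → Path s (tiling ts) s
tiling-path []       = []
tiling-path (t ∷ ts) = tile-path t ++ᴾ tiling-path ts

_≟ˢ_ : (p q : State) → Dec (p ≡ q)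
a0 ≟ˢ a0 = yes refl
a1 ≟ˢ a1 = yes refl
a2 ≟ˢ a2 = yes refl
a3 ≟ˢ a3 = yes refl
b0 ≟ˢ b0 = yes refl
b1 ≟ˢ b1 = yes refl
b2 ≟ˢ b2 = yes refl
b3 ≟ˢ b3 = yes refl
a0 ≟ˢ a1 = no λ ()
a0 ≟ˢ a2 = no λ ()
a0 ≟ˢ a3 = no λ ()
a0 ≟ˢ b0 = no λ ()
a0 ≟ˢ b1 = no λ ()
a0 ≟ˢ b2 = no λ ()
a0 ≟ˢ b3 = no λ ()
a1 ≟ˢ a0 = no λ ()
a1 ≟ˢ a2 = no λ ()
a1 ≟ˢ a3 = no λ ()
a1 ≟ˢ b0 = no λ ()
a1 ≟ˢ b1 = no λ ()
a1 ≟ˢ b2 = no λ ()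
a1 ≟ˢ b3 = no λ ()
a2 ≟ˢ a0 = no λ ()
a2 ≟ˢ a1 = no λ ()
a2 ≟ˢ a3 = no λ ()
a2 ≟ˢ b0 = no λ ()
a2 ≟ˢ b1 = no λ ()
a2 ≟ˢ b2 = no λ ()
a2 ≟ˢ b3 = no λ ()
a3 ≟ˢ a0 = no λ ()
a3 ≟ˢ a1 = no λ ()
a3 ≟ˢ a2 = no λ ()
a3 ≟ˢ b0 = no λ ()
a3 ≟ˢ b1 = no λ ()
a3 ≟ˢ b2 = no λ ()
a3 ≟ˢ b3 = no λ ()
b0 ≟ˢ a0 = no λ ()
b0 ≟ˢ a1 = no λ ()
b0 ≟ˢ a2 = no λ ()
b0 ≟ˢ a3 = no λ ()
b0 ≟ˢ b1 = no λ ()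
b0 ≟ˢ b2 = no λ ()
b0 ≟ˢ b3 = no λ ()
b1 ≟ˢ a0 = no λ ()
b1 ≟ˢ a1 = no λ ()
b1 ≟ˢ a2 = no λ ()
b1 ≟ˢ a3 = no λ ()
b1 ≟ˢ b0 = no λ ()
b1 ≟ˢ b2 = no λ ()
b1 ≟ˢ b3 = no λ ()
b2 ≟ˢ a0 = no λ ()
b2 ≟ˢ a1 = no λ ()
b2 ≟ˢ a2 = no λ ()
b2 ≟ˢ a3 = no λ ()
b2 ≟ˢ b0 = no λ ()
b2 ≟ˢ b1 = no λ ()
b2 ≟ˢ b3 = no λ ()
b3 ≟ˢ a0 = no λ ()
b3 ≟ˢ a1 = no λ ()
b3 ≟ˢ a2 = no λ ()
b3 ≟ˢ a3 = no λ ()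
b3 ≟ˢ b0 = no λ ()
b3 ≟ˢ b1 = no λ ()
b3 ≟ˢ b2 = no λ ()

-- The i-th row collects the ends of the paths from state i that agree with the
-- marks read so far; the row of the home state leaves out the matching itself.
data Table : Set where
  table : (r0 r1 r2 r3 r4 r5 r6 r7 : Row) → Table

infix 9 _at_
_at_ : Table → State → Row
table r _ _ _ _ _ _ _ at a0 = r
table _ r _ _ _ _ _ _ at a1 = r
table _ _ r _ _ _ _ _ at a2 = r
table _ _ _ r _ _ _ _ at a3 = r
table _ _ _ _ r _ _ _ at b0 = r
table _ _ _ _ _ r _ _ at b1 = r
table _ _ _ _ _ _ r _ at b2 = r
table _ _ _ _ _ _ _ r at b3 = r

tabulateᵀ : (State → Row) → Table
tabulateᵀ f = table (f a0) (f a1) (f a2) (f a3) (f b0) (f b1) (f b2) (f b3)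

tabulateᵀ-at : ∀ f q → tabulateᵀ f at q ≡ f q
tabulateᵀ-at f a0 = refl
tabulateᵀ-at f a1 = refl
tabulateᵀ-at f a2 = refl
tabulateᵀ-at f a3 = refl
tabulateᵀ-at f b0 = refl
tabulateᵀ-at f b1 = refl
tabulateᵀ-at f b2 = refl
tabulateᵀ-at f b3 = refl

everyᵇ : (State → Bool) → Bool
everyᵇ P = P a0 ∧ P a1 ∧ P a2 ∧ P a3 ∧ P b0 ∧ P b1 ∧ P b2 ∧ P b3

everyᵇ-sound : ∀ P → everyᵇ P ≡ true → ∀ q → P q ≡ true
everyᵇ-sound P e = at′
  where
  i0 = ∧-elim {P a0} e
  i1 = ∧-elim {P a1} (proj₂ i0)
  i2 = ∧-elim {P a2} (proj₂ i1)
  i3 = ∧-elim {P a3} (proj₂ i2)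
  i4 = ∧-elim {P b0} (proj₂ i3)
  i5 = ∧-elim {P b1} (proj₂ i4)
  i6 = ∧-elim {P b2} (proj₂ i5)
  at′ : ∀ q → P q ≡ true
  at′ a0 = proj₁ i0
  at′ a1 = proj₁ i1
  at′ a2 = proj₁ i2
  at′ a3 = proj₁ i3
  at′ b0 = proj₁ i4
  at′ b1 = proj₁ i5
  at′ b2 = proj₁ i6
  at′ b3 = proj₂ i6

_⊆ᵀ_ : Table → Table → Bool
R ⊆ᵀ S = everyᵇ λ p → (R at p) ⊆ᵇ (S at p)

-- Four bits per row, starting with a₀; a path never leaves its class.
decode : ℕ → Table
decode k = table (A k) (A (k / 16)) (A (k / 256)) (A (k / 4096))
                 (B (k / 65536)) (B (k / 1048576)) (B (k / 16777216)) (B (k / 268435456))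
  where
  odd : ℕ → Bool
  odd k = 1 ≤ᵇ k % 2
  A B : ℕ → Row
  A k = row (odd k) (odd (k / 2)) (odd (k / 4)) (odd (k / 8)) false false false false
  B k = row false false false false (odd k) (odd (k / 2)) (odd (k / 4)) (odd (k / 8))

module _ {s : State} where

  advance-row : Tile s → List Col → ∀ {p} → Dec (p ≡ s) → Row → Row
  advance-row t ms (yes _) = deviate (tile-path t) ms
  advance-row t ms (no _)  = run ms

  advance : (t : Tile s) → List Col → Table → Table
  advance t ms R = tabulateᵀ λ p → advance-row t ms (p ≟ˢ s) (R at p)

  -- Only one direction is asked for: the table may miss paths. This is what permits replacing a
  -- table by a smaller one, and so a finite list of entries.
  Realised : Table → Word → Set
  Realised R x = ∀ p q → R at p ∋ q ≡ true →
    ∃[ cs ] Path p cs q × marks x ⊑* cs × (p ≡ s → cs ≢ contents x)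

  advance-realised : ∀ t R x y → contents y ≡ cols t → marks y ⊑* contents y →
    Path s (contents x) s → marks x ⊑* contents x →
    Realised R x → Realised (advance t (marks y) R) (x ++ y)
  advance-realised t R x y ey ly π lx r p q e = by (p ≟ˢ s) e′
    where
    e′ = trans (cong (_∋ q) (sym (tabulateᵀ-at (λ p → advance-row t (marks y) (p ≟ˢ s) (R at p)) p))) e
    glue : ∀ {cs ds} → marks x ⊑* cs → marks y ⊑* ds → marks (x ++ y) ⊑* (cs ++ ds)
    glue l k = subst (_⊑* _) (sym (List.map-++ proj₁ x y)) (l ++⊑ k)
    same-length : ∀ {cs} → marks x ⊑* cs → length cs ≡ length (contents x)
    same-length l = trans (sym (Pointwise-length l)) (marks-contents-length x)
    differ : ∀ {cs ds} → marks x ⊑* cs → cs ≢ contents x ⊎ ds ≢ contents y →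
             cs ++ ds ≢ contents (x ++ y)
    differ {cs} l ne eq with ++-split-length cs (contents x) (same-length l)
                               (trans eq (List.map-++ proj₂ x y))
    differ l (inj₁ ne) eq | eq₁ , _ = ne eq₁
    differ l (inj₂ ne) eq | _ , eq₂ = ne eq₂
    by : (d : Dec (p ≡ s)) → advance-row t (marks y) d (R at p) ∋ q ≡ true →
          ∃[ cs ] Path p cs q × marks (x ++ y) ⊑* cs × (p ≡ s → cs ≢ contents (x ++ y))
    by (no p≢s) e with run-sound (marks y) (R at p) q e
    ... | p′ , ds , z , ρ , k with r p p′ z
    ... | cs , σ , l , _ = cs ++ ds , σ ++ᴾ ρ , glue l k , λ p≡s → contradiction p≡s p≢s
    by (yes refl) e with deviate-sound (tile-path t) (marks y) (R at p) q (subst (marks y ⊑*_) ey ly) e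
    ... | inj₁ (p′ , ds , z , ρ , k) with r p p′ z
    ... | cs , σ , l , ne = cs ++ ds , σ ++ᴾ ρ , glue l k , λ _ → differ l (inj₁ (ne refl))
    by (yes refl) e | inj₂ (ds , ρ , k , ne) =
      contents x ++ ds , π ++ᴾ ρ , glue lx k , λ _ → differ lx (inj₂ λ eq → ne (trans eq ey))

module _ {A : Set} where

  all-∈ : ∀ (P : A → Bool) {xs x} → all P xs ≡ true → x ∈ˡ xs → P x ≡ true
  all-∈ P {x ∷ xs} e (here refl) = proj₁ (∧-elim {P x} e)
  all-∈ P {x ∷ xs} e (there i)   = all-∈ P (proj₂ (∧-elim {P x} e)) i

  any-∈ : ∀ (P : A → Bool) xs → any P xs ≡ true → ∃[ x ] x ∈ˡ xs × P x ≡ true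
  any-∈ P (x ∷ xs) e with ∨-elim {P x} e
  ... | inj₁ p = x , here refl , p
  ... | inj₂ e with any-∈ P xs e
  ... | y , i , p = y , there i , p

forallᵇ : (Bool → Bool) → Bool
forallᵇ P = P false ∧ P true

forallᵇ-sound : ∀ P → forallᵇ P ≡ true → ∀ b → P b ≡ true
forallᵇ-sound P e false = proj₁ (∧-elim {P false} e)
forallᵇ-sound P e true  = proj₂ (∧-elim {P false} e)

marking : List Col → (List Col → Bool) → Bool
marking []       P = P []
marking (c ∷ cs) P = forallᵇ λ x → forallᵇ λ s → forallᵇ λ y →
  ⟨ x , s , y ⟩ ⊑ᵇ c ⇒ marking cs (P ∘ (⟨ x , s , y ⟩ ∷_))

marking-sound : ∀ cs P → marking cs P ≡ true → ∀ {ms} → ms ⊑* cs → P ms ≡ true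
marking-sound []       P e []      = e
marking-sound (c ∷ cs) P e {⟨ x , s , y ⟩ ∷ ms} (k ∷ l) =
  marking-sound cs (P ∘ (⟨ x , s , y ⟩ ∷_)) (⇒-elim (forallᵇ-sound (Q x s)
    (forallᵇ-sound (λ s → forallᵇ (Q x s))
      (forallᵇ-sound (λ x → forallᵇ λ s → forallᵇ (Q x s)) e x) s) y) k) l
  where
  Q : Bool → Bool → Bool → Bool
  Q x s y = ⟨ x , s , y ⟩ ⊑ᵇ c ⇒ marking cs (P ∘ (⟨ x , s , y ⟩ ∷_))

nth : {A : Set} → List (List A) → ℕ → List A
nth []         _       = []
nth (xs ∷ _)   zero    = xs
nth (_  ∷ xss) (suc i) = nth xss i

singleton : State → Row
singleton p = row (is a0) (is a1) (is a2) (is a3) (is b0) (is b1) (is b2) (is b3)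
  where
  is : State → Bool
  is q = ⌊ p ≟ˢ q ⌋

singleton-sound : ∀ p q → singleton p ∋ q ≡ true → p ≡ q
singleton-sound p q e = by (p ≟ˢ q) (trans (sym (is q)) e)
  where
  is : ∀ q → singleton p ∋ q ≡ ⌊ p ≟ˢ q ⌋
  is a0 = refl
  is a1 = refl
  is a2 = refl
  is a3 = refl
  is b0 = refl
  is b1 = refl
  is b2 = refl
  is b3 = refl
  by : (d : Dec (p ≡ q)) → ⌊ d ⌋ ≡ true → p ≡ q
  by (yes eq) _ = eq

start-row : ∀ {p s : State} → Dec (p ≡ s) → Row
start-row     (yes _) = ∅
start-row {p} (no _)  = singleton p

-- A weighted automaton: node i lists its moves as (tile , weight , target).
Pattern : State → Set
Pattern s = List (List (Tile s × ℕ × ℕ))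

data Run {s} (P : Pattern s) : ℕ → List (Tile s) → ℕ → ℕ → Set where
  []  : ∀ {i} → Run P i [] 0 i
  _∷_ : ∀ {i j k t w ts W} → (t , w , j) ∈ˡ nth P i → Run P j ts W k → Run P i (t ∷ ts) (w + W) k

Entries : Set
Entries = List (List (ℕ × Table))

-- A potential on the marked tilings accepted by the automaton: whenever a marked
-- prefix of weight W leads to node i and leaves open no deviation that closes up
-- at home, the i-th list has an entry (φ , R) such that R underestimates the table
-- of the prefix and W + φ ≤ offset + scale · (number of marks).  Forcing words end
-- at a table without a fixed point, and there φ ≥ gain.
record Bound (s : State) : Set where
  field
    moves : Pattern s
    finals   : ℕ → Bool
    scale    : ℕ
    offset   : ℕ
    gain     : ℕ
    entries  : List (List (ℕ × ℕ))

module Check {s : State} (B : Bound s) where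
  open Bound B

  table-entries : Entries
  table-entries = map (map λ (φ , k) → φ , decode k) entries

  settled : Table → Bool
  settled R = R at s ∋ s

  diagonal : Table → Bool
  diagonal R = not (everyᵇ λ p → not (R at p ∋ p))

  move-ok : Entries → ℕ × Table → Tile s × ℕ × ℕ → Bool
  move-ok es (φ , R) (t , w , j) = marking (cols t) λ ms →
    ok (advance t ms R) (φ + scale * weight* ms)
    where
    ok : Table → ℕ → Bool
    ok R′ b = settled R′ ∨ any (λ (φ′ , R″) → (φ′ + w ≤ᵇ b) ∧ R″ ⊆ᵀ R′) (nth es j)

  moves-ok : Entries → List (List (ℕ × Table)) → Pattern s → Bool
  moves-ok es (e ∷ es′) (ms ∷ P) = all (λ x → all (move-ok es x) ms) e ∧ moves-ok es es′ P
  moves-ok es _         _        = true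

  final-ok : ℕ × Table → Bool
  final-ok (φ , R) = diagonal R ∨ (gain ≤ᵇ φ)

  start : Table
  start = tabulateᵀ λ p → start-row (p ≟ˢ s)

  finals-ok : ℕ → Entries → Bool
  finals-ok i []       = true
  finals-ok i (e ∷ es) = (finals i ⇒ all final-ok e) ∧ finals-ok (suc i) es

  check : Entries → Bool
  check es = any (λ (φ , R) → (φ ≤ᵇ offset) ∧ R ⊆ᵀ start) (nth es 0) ∧
             finals-ok 0 es ∧ moves-ok es es moves

contents-split : ∀ xs {ys} w → contents w ≡ xs ++ ys →
  ∃[ x ] ∃[ y ] w ≡ x ++ y × contents x ≡ xs × contents y ≡ ys
contents-split []       w             eq = [] , w , refl , refl , eq
contents-split (c ∷ xs) ((m , d) ∷ w) eq with contents-split xs w (List.∷-injectiveʳ eq)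
... | x , y , refl , refl , refl = (m , d) ∷ x , y , refl , cong (_∷ _) (List.∷-injectiveˡ eq) , refl

marks-split : ∀ x y → marks (x ++ y) ⊑* contents (x ++ y) →
              marks x ⊑* contents x × marks y ⊑* contents y
marks-split []      y l       = [] , l
marks-split (_ ∷ x) y (k ∷ l) with marks-split x y l
... | l₁ , l₂ = k ∷ l₁ , l₂

diagonal-witness : ∀ R → not (everyᵇ λ p → not (R at p ∋ p)) ≡ true → ∃[ p ] R at p ∋ p ≡ true
diagonal-witness R e with R at a0 ∋ a0 in q0 | R at a1 ∋ a1 in q1 | R at a2 ∋ a2 in q2 | R at a3 ∋ a3 in q3
                        | R at b0 ∋ b0 in q4 | R at b1 ∋ b1 in q5 | R at b2 ∋ b2 in q6 | R at b3 ∋ b3 in q7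
... | true  | _ | _ | _ | _ | _ | _ | _ = a0 , q0
... | false | true  | _ | _ | _ | _ | _ | _ = a1 , q1
... | false | false | true  | _ | _ | _ | _ | _ = a2 , q2
... | false | false | false | true  | _ | _ | _ | _ = a3 , q3
... | false | false | false | false | true  | _ | _ | _ = b0 , q4
... | false | false | false | false | false | true  | _ | _ = b1 , q5
... | false | false | false | false | false | false | true  | _ = b2 , q6
... | false | false | false | false | false | false | false | true  = b3 , q7

module Soundness {s : State} (B : Bound s) where
  open Bound B
  open Check B

  realised-⊆ : ∀ {R S x} → R ⊆ᵀ S ≡ true → Realised {s} S x → Realised {s} R x
  realised-⊆ {R} {S} e r p q m =
    r p q (⊆ᵇ-sound (R at p) (S at p) (everyᵇ-sound (λ p → (R at p) ⊆ᵇ (S at p)) e p) q m)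

  start-realised : Realised {s} start []
  start-realised p q e =
    by (p ≟ˢ s) (trans (sym (cong (_∋ q) (tabulateᵀ-at (λ p → start-row (p ≟ˢ s)) p))) e)
    where
    by : (d : Dec (p ≡ s)) → start-row d ∋ q ≡ true →
         ∃[ cs ] Path p cs q × [] ⊑* cs × (p ≡ s → cs ≢ [])
    by (yes _)  e = ∅-empty q e
    by (no p≢s) e with refl ← singleton-sound p q e = [] , [] , [] , λ p≡s → contradiction p≡s p≢s

  finals-sound : ∀ i es {j x} → finals-ok i es ≡ true → finals (i + j) ≡ true → x ∈ˡ nth es j →
                 final-ok x ≡ true
  finals-sound i (e ∷ es) {zero}  {x} ok f m =
    all-∈ final-ok (⇒-elim (proj₁ (∧-elim {finals i ⇒ all final-ok e} ok)) (trans (cong finals (sym (+-identityʳ i))) f)) m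
  finals-sound i (e ∷ es) {suc j} {x} ok f m =
    finals-sound (suc i) es (proj₂ (∧-elim {finals i ⇒ all final-ok e} ok))
      (trans (cong finals (sym (+-suc i j))) f) m

  moves-sound : ∀ es es′ P {i x mv} → moves-ok es es′ P ≡ true → x ∈ˡ nth es′ i → mv ∈ˡ nth P i →
                move-ok es x mv ≡ true
  moves-sound es (e ∷ es′) (ms ∷ P) {zero} {x} ok m n =
    all-∈ (move-ok es x)
      (all-∈ (λ x → all (move-ok es x) ms) (proj₁ (∧-elim {all (λ x → all (move-ok es x) ms) e} ok)) m) n
  moves-sound es (e ∷ es′) (ms ∷ P) {suc i} {x} ok m n =
    moves-sound es es′ P (proj₂ (∧-elim {all (λ x → all (move-ok es x) ms) e} ok)) m n
  moves-sound es [] P {zero} ok () n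
  moves-sound es [] P {suc i} ok () n
  moves-sound es (e ∷ es′) [] {zero} ok m ()
  moves-sound es (e ∷ es′) [] {suc i} ok m ()

  module _ (es : Entries) (fin : finals-ok 0 es ≡ true) (mov : moves-ok es es moves ≡ true) where

    bound-from : ∀ {i ts W j} → Run moves i ts W j → finals j ≡ true →
      ∀ φ R x y → (φ , R) ∈ˡ nth es i → Realised {s} R x → Path s (contents x) s →
      contents y ≡ tiling ts → Forcing (x ++ y) → 2 ≤ length (contents (x ++ y)) →
      W + gain ≤ φ + scale * weight y
    bound-from {i} [] f φ R x [] m r π eq F two with ∨-elim {diagonal R} (finals-sound 0 es fin f m)
    ... | inj₂ g = ≤-trans (≤ᵇ-sound g) (m≤m+n φ _)
    ... | inj₁ d with diagonal-witness R d
    ... | p , e with r p p e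
    ... | cs , ρ , l , ne with subst Forcing (List.++-identityʳ x) F
    ... | _ , uniq with uniq ρ l
    -- Uniqueness has identified the rival with the matching column by column. By `path-target` both
    -- end in the same state, so p is home, and there the columns of the rival were required to
    -- differ.
    ... | refl = contradiction refl (ne (path-target (subst (λ z → 2 ≤ length (contents z)) (List.++-identityʳ x) two) ρ π))
    bound-from {i} (_∷_ {j = k} {t = t} {w = w} {ts = ts} {W = W} mv run′) f φ R x y m r π eq F two
      with contents-split (cols t) y eq
    ... | y₁ , y₂ , refl , eq₁ , eq₂ = conclude (∨-elim {settled R′} ok)
      where
      R′ = advance t (marks y₁) R
      cells = marks-split x (y₁ ++ y₂) (proj₁ F)
      l₁ : marks y₁ ⊑* contents y₁
      l₁ = proj₁ (marks-split y₁ y₂ (proj₂ cells))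
      l₂ : marks y₂ ⊑* contents y₂
      l₂ = proj₂ (marks-split y₁ y₂ (proj₂ cells))
      F′ : Forcing ((x ++ y₁) ++ y₂)
      F′ = subst Forcing (sym (List.++-assoc x y₁ y₂)) F
      fits : ℕ × Table → Bool
      fits (φ′ , R″) = (φ′ + w ≤ᵇ φ + scale * weight y₁) ∧ R″ ⊆ᵀ R′
      ok : settled R′ ∨ any fits (nth es k) ≡ true
      ok = marking-sound (cols t) _ (moves-sound es es moves {x = φ , R} mov m mv)
             (subst (marks y₁ ⊑*_) eq₁ l₁)
      r′ : Realised R′ (x ++ y₁)
      r′ = advance-realised t R x y₁ eq₁ l₁ π (proj₁ cells) r
      π₁ : Path s (contents (x ++ y₁)) s
      π₁ = subst (λ cs → Path s cs s) (sym (List.map-++ proj₂ x y₁))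
             (π ++ᴾ subst (λ cs → Path s cs s) (sym eq₁) (tile-path t))
      conclude : settled R′ ≡ true ⊎ any fits (nth es k) ≡ true →
                 w + W + gain ≤ φ + scale * weight (y₁ ++ y₂)
      -- The rival has already returned home, so the tiles still to be read complete it to a second
      -- closed path with the same marks.
      conclude (inj₁ e) with r′ s s e
      ... | cs , ρ , l , ne = contradiction
        (List.++-cancelʳ (contents y₂) cs (contents (x ++ y₁))
          (trans (proj₂ F′ (ρ ++ᴾ subst (λ cs → Path s cs s) (sym eq₂) (tiling-path ts))
                   (subst (_⊑* _) (sym (List.map-++ proj₁ (x ++ y₁) y₂)) (l ++⊑ l₂)))
                 (List.map-++ proj₂ (x ++ y₁) y₂))) (ne refl)
      conclude (inj₂ e) with any-∈ fits (nth es k) e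
      ... | (φ′ , R″) , m′ , e′ with ∧-elim {φ′ + w ≤ᵇ φ + scale * weight y₁} e′
      ... | le , sub = begin
        w + W + gain                                  ≡⟨ +-assoc w W gain ⟩
        w + (W + gain)                                ≤⟨ +-monoʳ-≤ w (bound-from run′ f φ′ R″ (x ++ y₁) y₂ m′
                                                           (realised-⊆ {R″} {R′} {x ++ y₁} sub r′) π₁ eq₂ F′
                                                           (subst (λ z → 2 ≤ length (contents z)) (sym (List.++-assoc x y₁ y₂)) two)) ⟩
        w + (φ′ + scale * weight y₂)                    ≡⟨ +-assoc w φ′ _ ⟨
        w + φ′ + scale * weight y₂                      ≡⟨ cong (_+ scale * weight y₂) (+-comm w φ′) ⟩
        φ′ + w + scale * weight y₂                      ≤⟨ +-monoˡ-≤ (scale * weight y₂) (≤ᵇ-sound {φ′ + w} {φ + scale * weight y₁} le) ⟩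
        φ + scale * weight y₁ + scale * weight y₂         ≡⟨ +-assoc φ _ _ ⟩
        φ + (scale * weight y₁ + scale * weight y₂)       ≡⟨ cong (φ +_) (*-distribˡ-+ scale (weight y₁) (weight y₂)) ⟨
        φ + scale * (weight y₁ + weight y₂)               ≡⟨ cong (λ z → φ + scale * z) (weight-++ y₁ y₂) ⟨
        φ + scale * weight (y₁ ++ y₂)                   ∎
        where open ≤-Reasoning

  bound : check table-entries ≡ true → ∀ {ts W j} → Run moves 0 ts W j → finals j ≡ true →
          ∀ y → contents y ≡ tiling ts → Forcing y → 2 ≤ length (contents y) →
          W + gain ≤ offset + scale * weight y
  bound ok ρ f y eq F two
    with ∧-elim {any (λ (φ , R) → (φ ≤ᵇ offset) ∧ R ⊆ᵀ start) (nth table-entries 0)} ok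
  ... | st , ok′ with ∧-elim {finals-ok 0 table-entries} ok′ | any-∈ _ (nth table-entries 0) st
  ... | fin , mov | (φ , R) , m , e with ∧-elim {φ ≤ᵇ offset} e
  ... | le , sub = ≤-trans
    (bound-from table-entries fin mov ρ f φ R [] y m (realised-⊆ {R} {start} {[]} sub start-realised) [] eq F two)
    (+-monoˡ-≤ (scale * weight y) (≤ᵇ-sound {φ} {offset} le))

-- Forcing sets built tile by tile

-- `X` and `Y` bound the states in which rivals can be before and after `w`. With `∅` the path read
-- so far is known completely; with the complement of home it is only known that no rival is at
-- home.
record Drives (s : State) (X : Row) (w : Word) (Y : Row) : Set where
  field
    home  : Path s (contents w) s
    legal : marks w ⊑* contents w
    stray : ∀ {p cs q} → X ∋ p ≡ true → Path p cs q → marks w ⊑* cs → Y ∋ q ≡ true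
    leave : ∀ {cs q} → Path s cs q → marks w ⊑* cs → cs ≢ contents w → Y ∋ q ≡ true
open Drives

legalᵇ : Word → Bool
legalᵇ []            = true
legalᵇ ((m , c) ∷ w) = m ⊑ᵇ c ∧ legalᵇ w

legalᵇ-sound : ∀ w → legalᵇ w ≡ true → marks w ⊑* contents w
legalᵇ-sound []            _ = []
legalᵇ-sound ((m , c) ∷ w) e = proj₁ (∧-elim {m ⊑ᵇ c} e) ∷ legalᵇ-sound w (proj₂ (∧-elim {m ⊑ᵇ c} e))

agrees-length : ∀ w {cs} → marks w ⊑* cs → length cs ≡ length (contents w)
agrees-length w l = trans (sym (Pointwise-length l)) (marks-contents-length w)

drives : ∀ {s X Y} w (π : Path s (contents w) s) → legalᵇ w ≡ true →
         deviate π (marks w) X ⊆ᵇ Y ≡ true → Drives s X w Y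
drives {X = X} {Y} w π le sub = record
  { home  = π
  ; legal = legalᵇ-sound w le
  ; stray = λ x ρ l → into _ (deviate-start π (marks w) X (agrees-length w l) x ρ l)
  ; leave = λ ρ l ne → into _ (deviate-complete π (marks w) X (agrees-length w l) ρ l ne)
  }
  where into = ⊆ᵇ-sound (deviate π (marks w) X) Y sub

drives-++ : ∀ {s X Y Z x y} → Drives s X x Y → Drives s Y y Z → Drives s X (x ++ y) Z
drives-++ {s} {X} {Y} {Z} {x} {y} d e = record
  { home  = subst (λ cs → Path s cs s) (sym (List.map-++ proj₂ x y)) (home d ++ᴾ home e)
  ; legal = subst₂ _⊑*_ (sym (List.map-++ proj₁ x y)) (sym (List.map-++ proj₂ x y)) (legal d ++⊑ legal e)
  ; stray = stray′
  ; leave = leave′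
  }
  where
  cut : ∀ {cs} → marks (x ++ y) ⊑* cs → ∃[ cs₁ ] ∃[ cs₂ ] cs ≡ cs₁ ++ cs₂ × marks x ⊑* cs₁ × marks y ⊑* cs₂
  cut l = split⊑ (marks x) (subst (_⊑* _) (List.map-++ proj₁ x y) l)
  stray′ : ∀ {p cs q} → X ∋ p ≡ true → Path p cs q → marks (x ++ y) ⊑* cs → Z ∋ q ≡ true
  stray′ m π l with cut l
  ... | cs₁ , cs₂ , refl , l₁ , l₂ with splitᴾ cs₁ π
  ... | r , π₁ , π₂ = stray e (stray d m π₁ l₁) π₂ l₂
  leave′ : ∀ {cs q} → Path s cs q → marks (x ++ y) ⊑* cs → cs ≢ contents (x ++ y) → Z ∋ q ≡ true
  leave′ π l ne with cut l
  ... | cs₁ , cs₂ , refl , l₁ , l₂ with splitᴾ cs₁ π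
  ... | r , π₁ , π₂ with List.≡-dec _≟ᶜ_ cs₁ (contents x)
  ... | no cs₁≢ = stray e (leave d π₁ l₁ cs₁≢) π₂ l₂
  ... | yes refl with refl ← path-det (home d) π₁ =
    leave e π₂ l₂ λ eq → ne (trans (cong (contents x ++_) eq) (sym (List.map-++ proj₂ x y)))

drives-⊆ : ∀ {s X w Y} Z → (Y ⊆ᵇ Z) ≡ true → Drives s X w Y → Drives s X w Z
drives-⊆ {Y = Y} Z sub d = record
  { home = home d ; legal = legal d
  ; stray = λ x ρ l → into _ (stray d x ρ l)
  ; leave = λ ρ l ne → into _ (leave d ρ l ne) }
  where into = ⊆ᵇ-sound Y Z sub

-- The pin `c` stops every closed path that does not start at home and every departure within `c`. A
-- path that starts at home and departs in `w` ends in `O`, away from home, and does not close.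
pins-forcing : ∀ {s O c w} → (∀ p → p ≢ s → O ∋ p ≡ true) → O ∋ s ≡ false →
               Drives s O c ∅ → Drives s ∅ w O → Forcing (c ++ w)
pins-forcing {s} {O} {c} {w} others s∉O d e =
  subst₂ _⊑*_ (sym (List.map-++ proj₁ c w)) (sym (List.map-++ proj₂ c w)) (legal d ++⊑ legal e) , unique
  where
  unique : ∀ {q cs} → Path q cs q → marks (c ++ w) ⊑* cs → cs ≡ contents (c ++ w)
  unique {q} π l with split⊑ (marks c) (subst (_⊑* _) (List.map-++ proj₁ c w) l)
  ... | cs₁ , cs₂ , refl , l₁ , l₂ with splitᴾ cs₁ π
  ... | r , π₁ , π₂ with q ≟ˢ s
  ... | no q≢s = ∅-empty r (stray d (others q q≢s) π₁ l₁)
  ... | yes refl with List.≡-dec _≟ᶜ_ cs₁ (contents c)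
  ... | no ne = ∅-empty r (leave d π₁ l₁ ne)
  ... | yes refl with refl ← path-det (home d) π₁ with List.≡-dec _≟ᶜ_ cs₂ (contents w)
  ... | yes refl = sym (List.map-++ proj₂ c w)
  ... | no ne = contradiction (trans (sym (leave e π₂ l₂ ne)) s∉O) λ ()

others-a0 : ∀ p → p ≢ a0 → ∁a0 ∋ p ≡ true
others-a0 a0 ne = contradiction refl ne
others-a0 a1 _ = refl
others-a0 a2 _ = refl
others-a0 a3 _ = refl
others-a0 b0 _ = refl
others-a0 b1 _ = refl
others-a0 b2 _ = refl
others-a0 b3 _ = refl

others-b0 : ∀ p → p ≢ b0 → ∁b0 ∋ p ≡ true
others-b0 a0 _ = refl
others-b0 a1 _ = refl
others-b0 a2 _ = refl
others-b0 a3 _ = refl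
others-b0 b0 ne = contradiction refl ne
others-b0 b1 _ = refl
others-b0 b2 _ = refl
others-b0 b3 _ = refl

record Covers {s} (X Y : Row) (ts : List (Tile s)) (m : ℕ) : Set where
  constructor covers
  field
    word   : Word
    spells : contents word ≡ tiling ts
    cost   : weight word ≡ m
    driven : Drives s X word Y

_++ᶜ_ : ∀ {s X Y Z} {xs ys : List (Tile s)} {k m} →
        Covers X Y xs k → Covers Y Z ys m → Covers X Z (xs ++ ys) (k + m)
_++ᶜ_ {xs = xs} {ys} (covers x ex kx dx) (covers y ey ky dy) = covers (x ++ y)
  (trans (List.map-++ proj₂ x y) (trans (cong₂ _++_ ex ey) (sym (List.concatMap-++ cols xs ys))))
  (trans (weight-++ x y) (cong₂ _+_ kx ky)) (drives-++ dx dy)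

weaken : ∀ {s X Y} {ts : List (Tile s)} {m} Z → (Y ⊆ᵇ Z) ≡ true → Covers X Y ts m → Covers X Z ts m
weaken Z sub (covers w e k d) = covers w e k (drives-⊆ Z sub d)

nil : ∀ {s X} → Covers {s} X X [] 0
nil = covers [] refl refl (record
  { home = [] ; legal = [] ; stray = λ { x [] [] → x } ; leave = λ { [] [] ne → contradiction refl ne } })

cover : ∀ {s X Y} (ts : List (Tile s)) (ms : List Col) → let w = zip ms (tiling ts) in
        (e : contents w ≡ tiling ts) → legalᵇ w ≡ true →
        deviate (subst (λ cs → Path s cs s) (sym e) (tiling-path ts)) (marks w) X ⊆ᵇ Y ≡ true →
        Covers X Y ts (weight w)
cover {s} ts ms e le sub =
  covers _ e refl (drives (zip ms (tiling ts)) (subst (λ cs → Path s cs s) (sym e) (tiling-path ts)) le sub)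

infixr 8 _^^_
_^^_ : {A : Set} → List A → ℕ → List A
xs ^^ zero  = []
xs ^^ suc k = xs ++ xs ^^ k

covers-^^ : ∀ {s X} {ts : List (Tile s)} {m} → Covers X X ts m → ∀ k → Covers X X (ts ^^ k) (k * m)
covers-^^ c zero    = nil
covers-^^ c (suc k) = c ++ᶜ covers-^^ c k

pinned : ∀ {s O} {c w : List (Tile s)} {k m} → (∀ p → p ≢ s → O ∋ p ≡ true) → O ∋ s ≡ false →
         Covers O ∅ c k → Covers ∅ O w m →
         ∃[ x ] contents x ≡ tiling (c ++ w) × Forcing x × weight x ≡ k + m
pinned {c = c} {w} others s∉O (covers x ex kx dx) (covers y ey ky dy) =
  x ++ y ,
  trans (List.map-++ proj₂ x y) (trans (cong₂ _++_ ex ey) (sym (List.concatMap-++ cols c w))) ,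
  pins-forcing others s∉O dx dy ,
  trans (weight-++ x y) (cong₂ _+_ kx ky)

-- Marks on the tiles 𝐓 and 𝐐, read from the left and from the right

𝐓° 𝐓-s 𝐓-us 𝐐° 𝐐-u₂ 𝐐-v₂ 𝐐-u₁ 𝐐-all : List Col
𝐓°      = cN ∷ cN ∷ cN ∷ []
𝐓-s     = cN ∷ cS ∷ cN ∷ []
𝐓-us    = cU ∷ cS ∷ cN ∷ []
𝐐°    = cN ∷ cN ∷ cN ∷ cN ∷ []
𝐐-u₁  = cU ∷ cN ∷ cN ∷ cN ∷ []
𝐐-u₂  = cN ∷ cU ∷ cN ∷ cN ∷ []
𝐐-v₂  = cN ∷ cV ∷ cN ∷ cN ∷ []
𝐐-all = cU ∷ cUV ∷ cN ∷ cN ∷ []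

QT TQ QQ TT TTT : List (Tile b0)
QT = 𝐐 ∷ 𝐓 ∷ []
TQ = 𝐓 ∷ 𝐐 ∷ []
QQ = 𝐐 ∷ 𝐐 ∷ []
TT = 𝐓 ∷ 𝐓 ∷ []
TTT = 𝐓 ∷ 𝐓 ∷ 𝐓 ∷ []

QT-left : Covers ∅ ∅ QT 1
QT-left = cover QT (𝐐° ++ 𝐓-s) refl refl refl

QQ-left : Covers ∅ ∅ QQ 1
QQ-left = cover QQ (𝐐° ++ 𝐐-u₂) refl refl refl

TQ-left : Covers ∅ ∅ TQ 1
TQ-left = cover TQ (𝐓° ++ 𝐐-v₂) refl refl refl

TT-left : Covers ∅ ∅ TT 1
TT-left = cover TT (𝐓° ++ 𝐓-s) refl refl refl

TTT-left : Covers ∅ ∅ TTT 1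
TTT-left = cover TTT (𝐓° ++ 𝐓° ++ 𝐓-s) refl refl refl

-- From `∁b0` to `∁b0` means that a path which is at home at the end was at home at the start and
-- followed the matching. So these marks determine the tiles when read from right to left.
QT-right : Covers ∁b0 ∁b0 QT 1
QT-right = cover QT (𝐐-v₂ ++ 𝐓°) refl refl refl

TQ-right : Covers ∁b0 ∁b0 TQ 1
TQ-right = cover TQ (𝐓-s ++ 𝐐°) refl refl refl

QQ-right : Covers ∁b0 ∁b0 QQ 1
QQ-right = cover QQ (𝐐-u₁ ++ 𝐐°) refl refl refl

T-pin : Covers ∁b0 ∅ (𝐓 ∷ []) 2
T-pin = cover (𝐓 ∷ []) 𝐓-us refl refl refl

Q-pin : Covers ∁b0 ∅ (𝐐 ∷ []) 3
Q-pin = cover (𝐐 ∷ []) 𝐐-all refl refl refl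

span : ∀ {s} → List (Tile s) → ℕ
span ts = length (tiling ts)

span-++ : ∀ {s} (xs ys : List (Tile s)) → span (xs ++ ys) ≡ span xs + span ys
span-++ xs ys = trans (cong length (List.concatMap-++ cols xs ys)) (List.length-++ (tiling xs))

span-^^ : ∀ {s} (xs : List (Tile s)) k → span (xs ^^ k) ≡ k * span xs
span-^^ xs zero    = refl
span-^^ xs (suc k) = trans (span-++ xs (xs ^^ k)) (cong (span xs +_) (span-^^ xs k))

-- Read from the left, a mark settles at least seven columns on average.  When it
-- is exactly seven, ts can also be read from the right, up to two tiles 𝐓 that need
-- no mark; this saves the mark of two further tiles 𝐐 in front of ts.
Free : List (Tile b0) → ℕ → Set
Free ts m = Covers ∁b0 ∁b0 ts m ⊎
  (∃[ xs ] ∃[ ys ] ∃[ k ] ∃[ l ] ts ≡ xs ++ TT ++ ys × span xs ≡ 7 * k × span ys ≡ 1 + 7 * l ×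
     Covers ∅ ∅ xs k × Covers ∁b0 ∁b0 ys l)

-- The pin 𝐓 takes two marks on three columns. With m further marks and n = 3 + span, the bound 2 +
-- m ≤ ⌈(n + 3) / 7⌉ amounts to 2 + 7m ≤ span, which is `loose`. In the case `tight` two columns are
-- missing, but n is 3 modulo 7 and δ supplies one more mark. A surplus of exactly one column would
-- fit neither case; `Free` is carried along to avoid it.
data Outcome (ts : List (Tile b0)) : Set where
  tight : ∀ m → span ts ≡ 7 * m → Covers ∅ ∅ ts m → Free ts m → Outcome ts
  loose : ∀ m → 2 + 7 * m ≤ span ts → Covers ∅ ∁b0 ts m → Outcome ts

relabel : ∀ {s X Y} {ts us : List (Tile s)} {m k} → ts ≡ us → m ≡ k → Covers X Y ts m → Covers X Y us k
relabel refl refl c = c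

-- A prefix with exactly seven columns per mark preserves the kind of outcome. In the second form of
-- `Free` it joins `xs`, so only the first form calls for its reading from the right.
extend : ∀ {p a} → span p ≡ 7 * a → Covers ∅ ∅ p a →
         (∀ {ts m} → span ts ≡ 7 * m → Covers ∁b0 ∁b0 ts m → Free (p ++ ts) (a + m)) →
         ∀ {ts} → Outcome ts → Outcome (p ++ ts)
extend {p} {a} sp l r {ts} (loose m le c) = loose (a + m)
  (farkas (span (p ++ ts) ∷ span p ∷ span ts ∷ a ∷ m ∷ []) 1 (con 2 ⊕ 7 ⊛ (var 3F ⊕ var 4F)) (var 0F)
    ((1 , var 1F ⊕ var 2F , var 0F) ∷ (1 , 7 ⊛ var 3F , var 1F) ∷ (1 , con 2 ⊕ 7 ⊛ var 4F , var 2F) ∷ []) refl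
    (≤-reflexive (sym (span-++ p ts)) ∷ ≤-reflexive (sym sp) ∷ le ∷ []))
  (l ++ᶜ c)
extend {p} {a} sp l r {ts} (tight m w c f) = tight (a + m)
  (trans (span-++ p ts) (trans (cong₂ _+_ sp w) (sym (*-distribˡ-+ 7 a m)))) (l ++ᶜ c) (free f)
  where
  free : Free ts m → Free (p ++ ts) (a + m)
  free (inj₁ d) = r w d
  free (inj₂ (xs , ys , k , j , refl , wx , wy , cx , cy)) = inj₂
    (p ++ xs , ys , a + k , j , sym (List.++-assoc p xs (TT ++ ys)) ,
     trans (span-++ p xs) (trans (cong₂ _+_ sp wx) (sym (*-distribˡ-+ 7 a k))) , wy , l ++ᶜ cx , cy)

add-QQ : ∀ {ts} → Outcome ts → Outcome (𝐐 ∷ 𝐐 ∷ ts)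
add-QQ {ts} (loose m le c) = loose (suc m)
  (farkas (span ts ∷ m ∷ []) 1 (con 2 ⊕ 7 ⊛ (con 1 ⊕ var 1F)) (con 8 ⊕ var 0F)
    ((1 , con 2 ⊕ 7 ⊛ var 1F , var 0F) ∷ []) refl (le ∷ []))
  (QQ-left ++ᶜ c)
-- With the mark of `QQ-left` there would be 8 + 7m columns for m + 1 marks, one column short of
-- `loose`. Since `ts` can be read from the right, both tiles 𝐐 stay unmarked.
add-QQ {ts} (tight m w c (inj₁ d)) = loose m
  (farkas (span ts ∷ m ∷ []) 1 (con 2 ⊕ 7 ⊛ var 1F) (con 8 ⊕ var 0F)
    ((1 , 7 ⊛ var 1F , var 0F) ∷ []) refl (≤-reflexive (sym w) ∷ []))
  (cover QQ (𝐐° ++ 𝐐°) refl refl refl ++ᶜ d)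
-- Here m = k + l + 1. Reading `xs` from the left and `ys` from the right takes only k + l marks, so
-- the mark of 𝐐𝐐 is affordable.
add-QQ (tight m w c (inj₂ (xs , ys , k , l , refl , wx , wy , cx , cy))) = loose (1 + (k + (0 + l)))
  (farkas (span (xs ++ TT ++ ys) ∷ span xs ∷ span ys ∷ k ∷ l ∷ []) 1
    (con 2 ⊕ 7 ⊛ (con 1 ⊕ (var 3F ⊕ (con 0 ⊕ var 4F)))) (con 8 ⊕ var 0F)
    ((1 , var 1F ⊕ (con 6 ⊕ var 2F) , var 0F) ∷ (1 , 7 ⊛ var 3F , var 1F) ∷ (1 , con 1 ⊕ 7 ⊛ var 4F , var 2F) ∷ []) refl
    (≤-reflexive (sym (span-++ xs (TT ++ ys))) ∷ ≤-reflexive (sym wx) ∷ ≤-reflexive (sym wy) ∷ []))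
  (QQ-left ++ᶜ (cx ++ᶜ (cover TT (𝐓° ++ 𝐓°) refl refl refl ++ᶜ cy)))

-- Two spare columns in the prefix suffice for the whole, because a tail of either kind has at least
-- seven columns per mark.
to-loose : ∀ {p a} → 2 + 7 * a ≤ span p → Covers ∅ ∅ p a → ∀ {ts} → Outcome ts → Outcome (p ++ ts)
to-loose {p} {a} le l {ts} o = loose (a + cost o)
  (farkas (span (p ++ ts) ∷ span p ∷ span ts ∷ a ∷ cost o ∷ []) 1 (con 2 ⊕ 7 ⊛ (var 3F ⊕ var 4F)) (var 0F)
    ((1 , var 1F ⊕ var 2F , var 0F) ∷ (1 , con 2 ⊕ 7 ⊛ var 3F , var 1F) ∷ (1 , 7 ⊛ var 4F , var 2F) ∷ []) refl
    (≤-reflexive (sym (span-++ p ts)) ∷ le ∷ width o ∷ []))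
  (l ++ᶜ plain o)
  where
  cost : ∀ {ts} → Outcome ts → ℕ
  cost (tight m _ _ _) = m
  cost (loose m _ _) = m
  width : ∀ {ts} (o : Outcome ts) → 7 * cost o ≤ span ts
  width (tight _ w _ _) = ≤-reflexive (sym w)
  width (loose m le _) = ≤-trans (m≤n+m _ 2) le
  plain : ∀ {ts} (o : Outcome ts) → Covers ∅ ∁b0 ts (cost o)
  plain (tight _ _ c _) = weaken ∁b0 refl c
  plain (loose m _ c) = c

TTQ : List (Tile b0)
TTQ = 𝐓 ∷ 𝐓 ∷ 𝐐 ∷ []

-- The mark of TTQ leaves the choice between 𝐓𝐓𝐐 and 𝐐𝐐, which is a shift by two
-- columns.  It is resolved only by a later mark.
shift₂ : Row
shift₂ = row false false false false false false true true

TTQ-shift : Covers ∅ shift₂ TTQ 1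
TTQ-shift = cover TTQ (𝐓° ++ 𝐓° ++ 𝐐-v₂) refl refl refl

TQ-shift : Covers shift₂ shift₂ TQ 1
TQ-shift = cover TQ (𝐓° ++ 𝐐-v₂) refl refl refl

shifted : ∀ j → Covers ∅ shift₂ (TTQ ++ TQ ^^ j) (suc j)
shifted j = relabel refl (cong suc (*-identityʳ j)) (TTQ-shift ++ᶜ covers-^^ TQ-shift j)

span-shifted : ∀ j → span (TTQ ++ TQ ^^ j) ≡ 10 + 7 * j
span-shifted j = cong (10 +_) (trans (span-^^ TQ j) (*-comm j 7))

shifted-end : ∀ j ts → Covers shift₂ ∁b0 ts 0 → Outcome ((TTQ ++ TQ ^^ j) ++ ts)
shifted-end j ts c = loose (suc j + 0)
  (farkas (span ((TTQ ++ TQ ^^ j) ++ ts) ∷ span (TTQ ++ TQ ^^ j) ∷ span ts ∷ j ∷ []) 1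
    (con 2 ⊕ 7 ⊛ (con 1 ⊕ var 3F ⊕ con 0)) (var 0F)
    ((1 , var 1F ⊕ var 2F , var 0F) ∷ (1 , con 10 ⊕ 7 ⊛ var 3F , var 1F) ∷ []) refl
    (≤-reflexive (sym (span-++ (TTQ ++ TQ ^^ j) ts)) ∷ ≤-reflexive (sym (span-shifted j)) ∷ []))
  (shifted j ++ᶜ c)

-- Resolving the shift takes one more mark. This gives 16 + 7j columns for j + 2 marks, just the two
-- spare columns required.
shifted-TT : ∀ j {ts} → Outcome ts → Outcome ((TTQ ++ TQ ^^ j) ++ 𝐓 ∷ 𝐓 ∷ ts)
shifted-TT j {ts} o = subst Outcome (List.++-assoc (TTQ ++ TQ ^^ j) TT ts)
  (to-loose {(TTQ ++ TQ ^^ j) ++ TT}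
    (farkas (span ((TTQ ++ TQ ^^ j) ++ TT) ∷ span (TTQ ++ TQ ^^ j) ∷ j ∷ []) 1
      (con 2 ⊕ 7 ⊛ (con 1 ⊕ var 2F ⊕ con 1)) (var 0F)
      ((1 , var 1F ⊕ con 6 , var 0F) ∷ (1 , con 10 ⊕ 7 ⊛ var 2F , var 1F) ∷ []) refl
      (≤-reflexive (sym (span-++ (TTQ ++ TQ ^^ j) TT)) ∷ ≤-reflexive (sym (span-shifted j)) ∷ []))
    (shifted j ++ᶜ cover TT (𝐓° ++ 𝐓-s) refl refl refl) o)

-- The shift is abandoned and the tiles are regrouped as 𝐓𝐓, then j times 𝐐𝐓, then 𝐐𝐐: 14 + 7j
-- columns for j + 2 marks, without a spare column. This is the origin of the second form of `Free`;
-- here `xs` is empty and `ys` begins with 𝐐.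
shifted-Q : ∀ j {ts} → Outcome ts → Outcome ((TTQ ++ TQ ^^ j) ++ 𝐐 ∷ ts)
shifted-Q j {ts} o = subst Outcome (sym reassoc) (extend {TT ++ QT ^^ j ++ QQ} {1 + (j + 1)} wide
    (TT-left ++ᶜ (relabel refl (*-identityʳ j) (covers-^^ QT-left j) ++ᶜ QQ-left))
    (λ {us} {m} w c → inj₂ ([] , (QT ^^ j ++ QQ) ++ us , 0 , j + 1 + m , refl , refl ,
      trans (span-++ (QT ^^ j ++ QQ) us) (trans (cong₂ _+_ width′ w) (sym (cong suc (*-distribˡ-+ 7 (j + 1) m)))) , nil ,
      (relabel refl (*-identityʳ j) (covers-^^ QT-right j) ++ᶜ QQ-right) ++ᶜ c)) o)
  where
  reassoc : (TTQ ++ TQ ^^ j) ++ 𝐐 ∷ ts ≡ (TT ++ QT ^^ j ++ QQ) ++ ts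
  reassoc = cong (λ z → 𝐓 ∷ 𝐓 ∷ z) (trans (swap-QT j) (sym (List.++-assoc (QT ^^ j) QQ ts)))
    where
    swap-QT : ∀ j {ts} → 𝐐 ∷ TQ ^^ j ++ ts ≡ QT ^^ j ++ 𝐐 ∷ ts
    swap-QT zero    = refl
    swap-QT (suc j) = cong (λ z → 𝐐 ∷ 𝐓 ∷ z) (swap-QT j)
  width′ : span (QT ^^ j ++ QQ) ≡ 1 + 7 * (j + 1)
  width′ = trans (span-++ (QT ^^ j) QQ) (trans (cong (_+ 8) (trans (span-^^ QT j) (*-comm j 7)))
             (trans (+-suc (7 * j) 7) (cong suc (sym (*-distribˡ-+ 7 j 1)))))
  wide : span (TT ++ QT ^^ j ++ QQ) ≡ 7 * (1 + (j + 1))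
  wide = trans (cong (6 +_) width′) (sym (*-suc 7 (j + 1)))

-- Every prefix is settled on its own except 𝐓𝐓𝐐, whose marking depends on what ends the run of 𝐓𝐐
-- after it. The index j of `parse′` is the length of that run.
parse  : ∀ ts → Outcome ts
parse′ : ∀ j ts → Outcome ((TTQ ++ TQ ^^ j) ++ ts)

parse []                = tight 0 refl nil (inj₁ nil)
parse (𝐐 ∷ [])         = loose 0 (s≤s (s≤s z≤n)) (cover (𝐐 ∷ []) 𝐐° refl refl refl)
parse (𝐐 ∷ 𝐓 ∷ ts)     = extend {QT} refl QT-left (λ _ c → inj₁ (QT-right ++ᶜ c)) (parse ts)
parse (𝐐 ∷ 𝐐 ∷ ts)     = add-QQ (parse ts)
parse (𝐓 ∷ [])         = loose 0 (s≤s (s≤s z≤n)) (cover (𝐓 ∷ []) 𝐓° refl refl refl)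
parse (𝐓 ∷ 𝐐 ∷ ts)     = extend {TQ} refl TQ-left (λ _ c → inj₁ (TQ-right ++ᶜ c)) (parse ts)
parse (𝐓 ∷ 𝐓 ∷ [])     = loose 0 (s≤s (s≤s z≤n)) (cover TT (𝐓° ++ 𝐓°) refl refl refl)
parse (𝐓 ∷ 𝐓 ∷ 𝐓 ∷ ts) = to-loose {TTT} ≤-refl TTT-left (parse ts)
parse (𝐓 ∷ 𝐓 ∷ 𝐐 ∷ ts) = parse′ 0 ts

parse′ j []           = shifted-end j [] (weaken ∁b0 refl nil)
parse′ j (𝐓 ∷ [])     = shifted-end j (𝐓 ∷ []) (cover (𝐓 ∷ []) 𝐓° refl refl refl)
parse′ j (𝐓 ∷ 𝐐 ∷ ts) = subst Outcome (cong (λ z → 𝐓 ∷ 𝐓 ∷ 𝐐 ∷ z) (slide j)) (parse′ (suc j) ts)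
  where
  slide : ∀ j → TQ ^^ suc j ++ ts ≡ TQ ^^ j ++ 𝐓 ∷ 𝐐 ∷ ts
  slide zero    = refl
  slide (suc j) = cong (λ z → 𝐓 ∷ 𝐐 ∷ z) (slide j)
parse′ j (𝐓 ∷ 𝐓 ∷ ts) = shifted-TT j (parse ts)
parse′ j (𝐐 ∷ ts)     = shifted-Q j (parse ts)

Forceable : ∀ {s} → List (Tile s) → (ℕ → Set) → Set
Forceable ts P = ∃[ w ] contents w ≡ tiling ts × Forcing w × P (weight w)

rotate : ∀ {s} (xs ys : List (Tile s)) {P} → Forceable (xs ++ ys) P → Forceable (ys ++ xs) P
rotate xs ys {P} (w , e , F , p) with contents-split (tiling xs) w (trans e (List.concatMap-++ cols xs ys))
... | x , y , refl , ex , ey = y ++ x ,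
  trans (List.map-++ proj₂ y x) (trans (cong₂ _++_ ey ex) (sym (List.concatMap-++ cols ys xs))) ,
  Forcing-rotate x y F ,
  subst P (trans (weight-++ x y) (trans (+-comm (weight x) (weight y)) (sym (weight-++ y x)))) p

-- Ceilings and the correction δ

ceiling-least : ∀ {m} d {s} → m ≤ suc d * s → ⌈ m / suc d ⌉ ≤ s
ceiling-least {m} d {s} le = m<1+n⇒m≤n (m<n*o⇒m/o<n (begin-strict
  m + d               ≤⟨ +-monoˡ-≤ d le ⟩
  suc d * s + d       <⟨ +-monoʳ-< (suc d * s) (n<1+n d) ⟩
  suc d * s + suc d   ≡⟨ +-comm (suc d * s) (suc d) ⟩
  suc d + suc d * s   ≡⟨ *-suc (suc d) s ⟨
  suc d * suc s       ≡⟨ *-comm (suc d) (suc s) ⟩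
  suc s * suc d       ∎))
  where open ≤-Reasoning

ceiling-greatest : ∀ m d {s} → suc d * s ≤ m + d → s ≤ ⌈ m / suc d ⌉
ceiling-greatest m d {s} le = begin
  s                      ≡⟨ m*n/n≡m s (suc d) ⟨
  s * suc d / suc d      ≤⟨ /-monoˡ-≤ (suc d) (≤-trans (≤-reflexive (*-comm s (suc d))) le) ⟩
  (m + d) / suc d        ∎
  where open ≤-Reasoning

ceiling-upper : ∀ m d → suc d * ⌈ m / suc d ⌉ ≤ m + d
ceiling-upper m d = ≤-trans (≤-reflexive (*-comm (suc d) _)) (m/n*n≤m (m + d) (suc d))

ceiling-lower : ∀ m d {s} → ⌈ m / suc d ⌉ ≤ s → m ≤ suc d * s
ceiling-lower m d {s} le with m ≤? suc d * s
... | yes p = p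
... | no ¬p = contradiction (≤-trans (ceiling-greatest m d {suc s} (begin
  suc d * suc s      ≡⟨ *-suc (suc d) s ⟩
  suc d + suc d * s  ≡⟨ cong suc (+-comm d (suc d * s)) ⟩
  suc (suc d * s) + d ≤⟨ +-monoˡ-≤ d (≰⇒> ¬p) ⟩
  m + d              ∎)) le) 1+n≰n
  where open ≤-Reasoning

δ-3+7k : ∀ k → δ (3 + 7 * k) ≡ 1
δ-3+7k k = cong (λ r → if r ≡ᵇ 3 then 1 else 0)
  (trans (cong (λ x → (3 + x) % 7) (*-comm 7 k)) ([m+kn]%n≡m%n 3 k 7))

not-≤ : ∀ {m n} {A : Set} → (m ≤ᵇ n) ≡ false → m ≤ n → A
not-≤ {m} {n} e le = ⊥-elim (subst T e (≤⇒≤ᵇ le))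

-- Upper bound for the tilings by 𝐓 and 𝐐

upper-T : ∀ ts → Forceable (𝐓 ∷ ts) (_≤ ⌈ (span (𝐓 ∷ ts) + 3) / 7 ⌉ + δ (span (𝐓 ∷ ts)))
upper-T ts with parse ts
... | tight m w c _ with pinned others-b0 refl T-pin (weaken ∁b0 refl c)
...   | x , e , F , k = x , e , F , subst (λ n → weight x ≤ ⌈ (n + 3) / 7 ⌉ + δ n) (cong (3 +_) (sym w))
          (≤-trans (≤-reflexive k) (≤-trans (≤-reflexive (+-comm 1 (1 + m)))
            (+-mono-≤ (ceiling-greatest (3 + 7 * m + 3) 6 {suc m} (farkas (m ∷ []) 1 (7 ⊛ (con 1 ⊕ var 0F)) ((con 3 ⊕ 7 ⊛ var 0F) ⊕ con 3 ⊕ con 6) [] refl []))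
                      (≤-reflexive (sym (δ-3+7k m))))))
upper-T ts | loose m le c with pinned others-b0 refl T-pin c
... | x , e , F , k = x , e , F , ≤-trans (≤-reflexive k) (≤-trans (ceiling-greatest (3 + span ts + 3) 6 {2 + m}
        (farkas (span ts ∷ m ∷ []) 1 (7 ⊛ (con 2 ⊕ var 1F)) ((con 3 ⊕ var 0F) ⊕ con 3 ⊕ con 6)
          ((1 , con 2 ⊕ 7 ⊛ var 1F , var 0F) ∷ []) refl (le ∷ []))) (m≤m+n _ (δ (3 + span ts))))

quads : ∀ k → ∃[ m ] 2 * m ≤ k × Covers ∅ ∁b0 ((𝐐 ∷ []) ^^ suc k) m
quads 0 = 0 , z≤n , cover (𝐐 ∷ []) 𝐐° refl refl refl
quads 1 = 0 , z≤n , cover QQ (𝐐° ++ 𝐐°) refl refl refl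
quads (suc (suc k)) with quads k
... | m , le , c = suc m , ≤-trans (≤-reflexive (*-suc 2 m)) (s≤s (s≤s le)) , QQ-left ++ᶜ c

-- Without a 𝐓 the pin costs three marks instead of two. On the other hand a mark now serves eight
-- columns rather than seven, and from nine tiles on this makes up for it.
upper-Q : ∀ k → 7 ≤ k → Forceable ((𝐐 ∷ []) ^^ (2 + k)) (_≤ ⌈ (4 * (2 + k) + 3) / 7 ⌉)
upper-Q k le with quads k
... | m , le′ , c with pinned others-b0 refl Q-pin c
... | x , e , F , eq = x , e , F , ≤-trans (≤-reflexive eq) (ceiling-greatest (4 * (2 + k) + 3) 6 {3 + m} fits)
  where
  fits : 7 * (3 + m) ≤ 4 * (2 + k) + 3 + 6
  fits with m≤n⇒m<n∨m≡n le
  ... | inj₁ lt = farkas (k ∷ m ∷ []) 2 (7 ⊛ (con 3 ⊕ var 1F)) (4 ⊛ (con 2 ⊕ var 0F) ⊕ con 3 ⊕ con 6)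
                    ((7 , 2 ⊛ var 1F , var 0F) ∷ (1 , con 8 , var 0F) ∷ []) refl (le′ ∷ lt ∷ [])
  -- For nine tiles the linear estimate fails by one half; rounding 2m ≤ 7 to m ≤ 3 repairs it.
  ... | inj₂ refl = farkas (m ∷ []) 1 (7 ⊛ (con 3 ⊕ var 0F)) (con 45) ((7 , var 0F , con 3) ∷ []) refl
                      (farkas (m ∷ []) 2 (var 0F) (con 3) ((1 , 2 ⊛ var 0F , con 7) ∷ []) refl (le′ ∷ []) ∷ [])

find-tri : ∀ ts → (∃[ xs ] ∃[ ys ] ts ≡ xs ++ 𝐓 ∷ ys) ⊎ ts ≡ (𝐐 ∷ []) ^^ length ts
find-tri []       = inj₂ refl
find-tri (𝐓 ∷ ts) = inj₁ ([] , ts , refl)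
find-tri (𝐐 ∷ ts) with find-tri ts
... | inj₁ (xs , ys , refl) = inj₁ (𝐐 ∷ xs , ys , refl)
... | inj₂ eq = inj₂ (cong (𝐐 ∷_) eq)

span-swap : ∀ {s} (xs ys : List (Tile s)) → span (xs ++ ys) ≡ span (ys ++ xs)
span-swap xs ys = trans (span-++ xs ys) (trans (+-comm (span xs) (span ys)) (sym (span-++ ys xs)))

upper-b0 : ∀ ts → 34 ≤ span ts → Forceable ts (_≤ ⌈ (span ts + 3) / 7 ⌉ + δ (span ts))
upper-b0 ts le with find-tri ts
... | inj₁ (xs , ys , refl) = subst (λ n → Forceable (xs ++ 𝐓 ∷ ys) (_≤ ⌈ (n + 3) / 7 ⌉ + δ n)) (span-swap (𝐓 ∷ ys) xs)
                                (rotate (𝐓 ∷ ys) xs {_≤ ⌈ (span (𝐓 ∷ ys ++ xs) + 3) / 7 ⌉ + δ (span (𝐓 ∷ ys ++ xs))} (upper-T (ys ++ xs)))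
... | inj₂ eq with length ts
... | 0 with refl ← eq = not-≤ refl le
... | 1 with refl ← eq = not-≤ refl le
... | suc (suc k) with refl ← eq =
  let wide = trans (span-^^ (𝐐 ∷ []) (2 + k)) (*-comm (2 + k) 4)
      x , e , F , p = upper-Q k (farkas (span ((𝐐 ∷ []) ^^ (2 + k)) ∷ k ∷ []) 4 (con 7) (var 1F)
                        ((1 , con 34 , var 0F) ∷ (1 , var 0F , 4 ⊛ (con 2 ⊕ var 1F)) ∷ []) refl
                        (le ∷ ≤-reflexive wide ∷ []))
  in x , e , F , ≤-trans (≤-trans p (≤-reflexive (cong (λ n → ⌈ (n + 3) / 7 ⌉) (sym wide))))
                         (m≤m+n _ (δ (span ((𝐐 ∷ []) ^^ (2 + k)))))

-- Upper bound for the tilings by 𝟏 and 𝐪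

𝟏° 𝟏-s 𝐪-u₁ 𝐪-u₂ 𝐪-v₁ 𝐪-v₃ : List Col
𝟏°   = cN ∷ []
𝟏-s  = cS ∷ []
𝐪-u₁ = cU ∷ cN ∷ cN ∷ cN ∷ []
𝐪-u₂ = cN ∷ cU ∷ cN ∷ cN ∷ []
𝐪-v₁ = cV ∷ cN ∷ cN ∷ cN ∷ []
𝐪-v₃ = cN ∷ cN ∷ cV ∷ cN ∷ []

Economic : List (Tile a0) → Set
Economic ts = ∃[ m ] 4 * m ≤ span ts × Covers ∅ ∁a0 ts m

spend : ∀ p a → 4 * a ≤ span p → Covers ∅ ∅ p a → ∀ {ts} → Economic ts → Economic (p ++ ts)
spend p a le c {ts} (m , le′ , d) = a + m ,
  ≤-trans (≤-reflexive (*-distribˡ-+ 4 a m)) (≤-trans (+-mono-≤ le le′) (≤-reflexive (sym (span-++ p ts)))) ,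
  c ++ᶜ d

-- After two or three unmarked 𝟏, a single mark in the next 𝐪 also fits a 𝐪 at another position:
-- `𝐪-u₂` one that starts a column later, `𝐪-v₃` one that starts two columns later. Which of the two
-- marks is taken depends on the tiles that follow; hence the look-ahead.
economic : ∀ ts → Economic ts
economic []                     = 0 , z≤n , weaken ∁a0 refl nil
economic (𝐪 ∷ ts)               = spend (𝐪 ∷ []) 1 (≤ᵇ-sound refl) (cover _ 𝐪-u₁ refl refl refl) (economic ts)
economic (𝟏 ∷ [])               = 0 , z≤n , cover _ 𝟏° refl refl refl
economic (𝟏 ∷ 𝐪 ∷ ts)           = spend (𝟏 ∷ 𝐪 ∷ []) 1 (≤ᵇ-sound refl) (cover _ (𝟏° ++ 𝐪-v₁) refl refl refl) (economic ts)
economic (𝟏 ∷ 𝟏 ∷ [])           = 0 , z≤n , cover _ (𝟏° ++ 𝟏°) refl refl refl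
economic (𝟏 ∷ 𝟏 ∷ 𝐪 ∷ [])       = 1 , ≤ᵇ-sound refl , cover _ (𝟏° ++ 𝟏° ++ 𝐪-u₂) refl refl refl
economic (𝟏 ∷ 𝟏 ∷ 𝐪 ∷ 𝐪 ∷ ts)   = spend (𝟏 ∷ 𝟏 ∷ 𝐪 ∷ 𝐪 ∷ []) 2 (≤ᵇ-sound refl)
  (cover _ (𝟏° ++ 𝟏° ++ 𝐪-u₂ ++ 𝐪-u₁) refl refl refl) (economic ts)
economic (𝟏 ∷ 𝟏 ∷ 𝐪 ∷ 𝟏 ∷ [])   = 1 , ≤ᵇ-sound refl , cover _ (𝟏° ++ 𝟏° ++ 𝐪-v₃ ++ 𝟏°) refl refl refl
economic (𝟏 ∷ 𝟏 ∷ 𝐪 ∷ 𝟏 ∷ 𝟏 ∷ ts) = spend (𝟏 ∷ 𝟏 ∷ 𝐪 ∷ 𝟏 ∷ 𝟏 ∷ []) 2 (≤ᵇ-sound refl)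
  (cover _ (𝟏° ++ 𝟏° ++ 𝐪-v₃ ++ 𝟏° ++ 𝟏-s) refl refl refl) (economic ts)
economic (𝟏 ∷ 𝟏 ∷ 𝐪 ∷ 𝟏 ∷ 𝐪 ∷ ts) = spend (𝟏 ∷ 𝟏 ∷ 𝐪 ∷ 𝟏 ∷ 𝐪 ∷ []) 2 (≤ᵇ-sound refl)
  (cover _ (𝟏° ++ 𝟏° ++ 𝐪-v₃ ++ 𝟏° ++ 𝐪-v₁) refl refl refl) (economic ts)
economic (𝟏 ∷ 𝟏 ∷ 𝟏 ∷ [])       = 0 , z≤n , cover _ (𝟏° ++ 𝟏° ++ 𝟏°) refl refl refl
economic (𝟏 ∷ 𝟏 ∷ 𝟏 ∷ 𝟏 ∷ ts)   = spend (𝟏 ∷ 𝟏 ∷ 𝟏 ∷ 𝟏 ∷ []) 1 (≤ᵇ-sound refl)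
  (cover _ (𝟏° ++ 𝟏° ++ 𝟏° ++ 𝟏-s) refl refl refl) (economic ts)
economic (𝟏 ∷ 𝟏 ∷ 𝟏 ∷ 𝐪 ∷ [])   = 1 , ≤ᵇ-sound refl , cover _ (𝟏° ++ 𝟏° ++ 𝟏° ++ 𝐪-u₂) refl refl refl
economic (𝟏 ∷ 𝟏 ∷ 𝟏 ∷ 𝐪 ∷ 𝟏 ∷ ts) = spend (𝟏 ∷ 𝟏 ∷ 𝟏 ∷ 𝐪 ∷ 𝟏 ∷ []) 2 (≤ᵇ-sound refl)
  (cover _ (𝟏° ++ 𝟏° ++ 𝟏° ++ 𝐪-v₃ ++ 𝟏-s) refl refl refl) (economic ts)
economic (𝟏 ∷ 𝟏 ∷ 𝟏 ∷ 𝐪 ∷ 𝐪 ∷ ts) = spend (𝟏 ∷ 𝟏 ∷ 𝟏 ∷ 𝐪 ∷ 𝐪 ∷ []) 2 (≤ᵇ-sound refl)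
  (cover _ (𝟏° ++ 𝟏° ++ 𝟏° ++ 𝐪-u₂ ++ 𝐪-u₁) refl refl refl) (economic ts)

-- For k marks, 4k ≤ n + 3 is the same as k ≤ ⌈n / 4⌉. As `economic` keeps the tail within four
-- columns per mark, the pin may use up the whole allowance of 3.
upper-pin : ∀ p {k} → Covers ∁a0 ∅ p k → 4 * k ≤ span p + 3 → ∀ ts → Forceable (p ++ ts) (λ k → 4 * k ≤ span (p ++ ts) + 3)
upper-pin p {k} c le ts with economic ts
... | m , le′ , d with pinned others-a0 refl c d
... | x , e , F , eq = x , e , F , farkas (weight x ∷ k ∷ m ∷ span p ∷ span ts ∷ span (p ++ ts) ∷ []) 1
      (4 ⊛ var 0F) (var 5F ⊕ con 3)
      ((4 , var 0F , var 1F ⊕ var 2F) ∷ (1 , 4 ⊛ var 1F , var 3F ⊕ con 3) ∷ (1 , 4 ⊛ var 2F , var 4F) ∷ (1 , var 3F ⊕ var 4F , var 5F) ∷ []) refl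
      (≤-reflexive eq ∷ le ∷ le′ ∷ ≤-reflexive (sym (span-++ p ts)) ∷ [])

find-mono : ∀ ts → (∃[ xs ] ∃[ ys ] ts ≡ xs ++ 𝟏 ∷ ys) ⊎ ts ≡ (𝐪 ∷ []) ^^ length ts
find-mono []       = inj₂ refl
find-mono (𝟏 ∷ ts) = inj₁ ([] , ts , refl)
find-mono (𝐪 ∷ ts) with find-mono ts
... | inj₁ (xs , ys , refl) = inj₁ (𝐪 ∷ xs , ys , refl)
... | inj₂ eq = inj₂ (cong (𝐪 ∷_) eq)

find-quad : ∀ ts → (∃[ i ] ∃[ ys ] 𝟏 ∷ ts ≡ (𝟏 ∷ []) ^^ i ++ 𝟏 ∷ 𝐪 ∷ ys) ⊎ ts ≡ (𝟏 ∷ []) ^^ length ts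
find-quad []       = inj₂ refl
find-quad (𝐪 ∷ ts) = inj₁ (0 , ts , refl)
find-quad (𝟏 ∷ ts) with find-quad ts
... | inj₁ (i , ys , eq) = inj₁ (suc i , ys , cong (𝟏 ∷_) eq)
... | inj₂ eq = inj₂ (cong (𝟏 ∷_) eq)

Frugal : List (Tile a0) → Set
Frugal ts = Forceable ts (λ k → 4 * k ≤ span ts + 3)

frugal-rotate : ∀ xs ys → Frugal (xs ++ ys) → Frugal (ys ++ xs)
frugal-rotate xs ys f = subst (λ n → Forceable (ys ++ xs) (λ k → 4 * k ≤ n + 3)) (span-swap xs ys)
  (rotate xs ys {λ k → 4 * k ≤ span (xs ++ ys) + 3} f)

-- The pins 𝟏𝐪 and 𝟏𝟏𝟏𝟏𝟏 both take two marks on five columns, and 4 · 2 = 5 + 3. One of them is at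
-- hand: cyclically, either some 𝟏 is followed by 𝐪 or all tiles are 𝟏.
upper-mono : ∀ ts → 34 ≤ span (𝟏 ∷ ts) → Frugal (𝟏 ∷ ts)
upper-mono ts le with find-quad ts
... | inj₁ (i , ys , eq) = subst Frugal (sym eq) (frugal-rotate (𝟏 ∷ 𝐪 ∷ ys) ((𝟏 ∷ []) ^^ i)
  (upper-pin (𝟏 ∷ 𝐪 ∷ []) (cover _ (𝟏-s ++ 𝐪-u₁) refl refl refl) (≤ᵇ-sound refl) (ys ++ (𝟏 ∷ []) ^^ i)))
... | inj₂ eq with length ts
... | 0 with refl ← eq = not-≤ refl le
... | 1 with refl ← eq = not-≤ refl le
... | 2 with refl ← eq = not-≤ refl le
... | 3 with refl ← eq = not-≤ refl le
... | suc (suc (suc (suc k))) with refl ← eq =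
  upper-pin (𝟏 ∷ 𝟏 ∷ 𝟏 ∷ 𝟏 ∷ 𝟏 ∷ []) (cover _ (𝟏-s ++ 𝟏° ++ 𝟏° ++ 𝟏° ++ 𝟏-s) refl refl refl) (≤ᵇ-sound refl) ((𝟏 ∷ []) ^^ k)

upper-a0 : ∀ ts → 34 ≤ span ts → Frugal ts
upper-a0 ts le with find-mono ts
... | inj₁ (xs , ys , refl) = frugal-rotate (𝟏 ∷ ys) xs (upper-mono (ys ++ xs)
        (≤-trans le (≤-reflexive (span-swap xs (𝟏 ∷ ys)))))
... | inj₂ eq with length ts
... | 0 with refl ← eq = not-≤ refl le
... | 1 with refl ← eq = not-≤ refl le
... | 2 with refl ← eq = not-≤ refl le
... | 3 with refl ← eq = not-≤ refl le
... | suc (suc (suc (suc k))) with refl ← eq =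
  upper-pin (𝐪 ∷ 𝐪 ∷ 𝐪 ∷ 𝐪 ∷ []) (cover _ (𝐪-v₃ ++ 𝐪-u₁ ++ 𝐪-u₂ ++ 𝐪-v₁) refl refl refl) (≤ᵇ-sound refl) ((𝐪 ∷ []) ^^ k)

-- Certificates

-- Found by the Bellman-Ford algorithm on tables, discarding an entry when another
-- one has a smaller table and no larger potential.

cert-a₀ : Bound a0
cert-a₀ = record
  { moves =
      ((𝟏 , 1 , 1) ∷ (𝐪 , 4 , 3) ∷ []) ∷
      ((𝟏 , 1 , 2) ∷ (𝐪 , 4 , 3) ∷ []) ∷
      ((𝟏 , 1 , 3) ∷ (𝐪 , 4 , 3) ∷ []) ∷
      ((𝟏 , 1 , 3) ∷ (𝐪 , 4 , 3) ∷ []) ∷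
      []
  ; finals = λ i → (i ≡ᵇ 3)
  ; scale = 6 ; offset = 3 ; gain = 5
  ; entries =
      ((3 , 2216789024) ∷ []) ∷
      ((2 , 415373378) ∷ (8 , 8388608) ∷ []) ∷
      ((1 , 563884422) ∷ (7 , 528384) ∷ (7 , 1048578) ∷ (13 , 0) ∷ []) ∷
      ((0 , 232652798) ∷ (0 , 3258544926) ∷ (1 , 53739518) ∷ (1 , 231993598) ∷ (1 , 232635322) ∷ (1 , 232648958) ∷
       (1 , 250509174) ∷ (1 , 483244986) ∷ (1 , 2965110782) ∷ (1 , 3490578430) ∷ (1 , 3721461518) ∷ (2 , 65534) ∷
       (2 , 3866878) ∷ (2 , 14483710) ∷ (2 , 14548750) ∷ (2 , 53687090) ∷ (2 , 53735678) ∷ (2 , 54391038) ∷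
       (2 , 161052534) ∷ (2 , 161061272) ∷ (2 , 178935124) ∷ (2 , 196869902) ∷ (2 , 214743994) ∷ (2 , 231796990) ∷
       (2 , 232566970) ∷ (2 , 250179830) ∷ (2 , 250507382) ∷ (2 , 858849038) ∷ (2 , 2183812436) ∷ (2 , 2417596824) ∷
       (2 , 3239951290) ∷ (2 , 3436297098) ∷ (2 , 3490560954) ∷ (2 , 3490574350) ∷ (2 , 3492810510) ∷ (2 , 3503296270) ∷
       (2 , 3504174966) ∷ (2 , 3721444106) ∷ (2 , 3759044470) ∷ (2 , 4007687942) ∷ (3 , 30582) ∷ (3 , 48058) ∷
       (3 , 61694) ∷ (3 , 65294) ∷ (3 , 852222) ∷ (3 , 3342590) ∷ (3 , 10289398) ∷ (3 , 13435066) ∷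
       (3 , 14483470) ∷ (3 , 14531338) ∷ (3 , 15597686) ∷ (3 , 15628038) ∷ (3 , 17930648) ∷ (3 , 26843528) ∷
       (3 , 35804500) ∷ (3 , 53686322) ∷ (3 , 54276338) ∷ (3 , 160534680) ∷ (3 , 161026320) ∷ (3 , 161050742) ∷
       (3 , 161378550) ∷ (3 , 178409556) ∷ (3 , 214709042) ∷ (3 , 214741178) ∷ (3 , 231780538) ∷ (3 , 231796750) ∷
       (3 , 232617734) ∷ (3 , 249589878) ∷ (3 , 299678602) ∷ (3 , 581457220) ∷ (3 , 680154452) ∷ (3 , 805516082) ∷
       (3 , 805564430) ∷ (3 , 808455950) ∷ (3 , 818941710) ∷ (3 , 858796802) ∷ (3 , 2416548248) ∷ (3 , 2576381702) ∷
       (3 , 2576390408) ∷ (3 , 2685031764) ∷ (3 , 2862634244) ∷ (3 , 3148935182) ∷ (3 , 3239884938) ∷ (3 , 3435182858) ∷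
       (3 , 3489664782) ∷ (3 , 3490557962) ∷ (3 , 3502246666) ∷ (3 , 3759042566) ∷ (3 , 3767537414) ∷ (3 , 3772778246) ∷
       (3 , 3773707058) ∷ (4 , 254) ∷ (4 , 3854) ∷ (4 , 13106) ∷ (4 , 21844) ∷ (4 , 28790) ∷
       (4 , 30470) ∷ (4 , 39320) ∷ (4 , 45242) ∷ (4 , 47882) ∷ (4 , 61454) ∷ (4 , 852154) ∷
       (4 , 917622) ∷ (4 , 1638552) ∷ (4 , 2752596) ∷ (4 , 3342350) ∷ (4 , 3342386) ∷ (4 , 3355394) ∷
       (4 , 10027126) ∷ (4 , 10066184) ∷ (4 , 11162884) ∷ (4 , 13369530) ∷ (4 , 13500530) ∷ (4 , 14483466) ∷
       (4 , 15597574) ∷ (4 , 17928344) ∷ (4 , 35787024) ∷ (4 , 35803220) ∷ (4 , 53489714) ∷ (4 , 160469144) ∷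
       (4 , 160567408) ∷ (4 , 161026064) ∷ (4 , 178278484) ∷ (4 , 214118642) ∷ (4 , 214708274) ∷ (4 , 231780362) ∷
       (4 , 249589766) ∷ (4 , 250491650) ∷ (4 , 281839626) ∷ (4 , 286300424) ∷ (4 , 428906504) ∷ (4 , 482457738) ∷
       (4 , 572544260) ∷ (4 , 679629892) ∷ (4 , 805515266) ∷ (4 , 808452866) ∷ (4 , 808653072) ∷ (4 , 817893122) ∷
       (4 , 2292340036) ∷ (4 , 2416513296) ∷ (4 , 2416537606) ∷ (4 , 2416545800) ∷ (4 , 2416969992) ∷ (4 , 2425358086) ∷
       (4 , 2430603014) ∷ (4 , 2576355584) ∷ (4 , 2685030404) ∷ (4 , 2686452996) ∷ (4 , 2953510926) ∷ (4 , 3222056970) ∷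
       (4 , 3233811210) ∷ (4 , 3435148034) ∷ (4 , 3489660942) ∷ (4 , 3489663754) ∷ (4 , 3721424902) ∷ (4 , 3758098182) ∷
       (5 , 14) ∷ (5 , 118) ∷ (5 , 186) ∷ (5 , 1798) ∷ (5 , 2826) ∷ (5 , 4368) ∷
       (5 , 12338) ∷ (5 , 13058) ∷ (5 , 20564) ∷ (5 , 21764) ∷ (5 , 28678) ∷ (5 , 37016) ∷
       (5 , 39176) ∷ (5 , 45066) ∷ (5 , 196658) ∷ (5 , 589976) ∷ (5 , 655444) ∷ (5 , 1114264) ∷
       (5 , 2228308) ∷ (5 , 2293808) ∷ (5 , 3342338) ∷ (5 , 10027014) ∷ (5 , 10027016) ∷ (5 , 10027024) ∷
       (5 , 10031360) ∷ (5 , 11141124) ∷ (5 , 13369354) ∷ (5 , 13369394) ∷ (5 , 35786768) ∷ (5 , 36245616) ∷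
       (5 , 53489666) ∷ (5 , 53678336) ∷ (5 , 160436240) ∷ (5 , 160469000) ∷ (5 , 178278404) ∷ (5 , 268537864) ∷
       (5 , 269486344) ∷ (5 , 537022468) ∷ (5 , 538969348) ∷ (5 , 572526848) ∷ (5 , 805307138) ∷ (5 , 2149729284) ∷
       (5 , 2183681092) ∷ (5 , 2415921416) ∷ (5 , 2416017416) ∷ (5 , 2416513024) ∷ (5 , 2418018048) ∷ (5 , 2425356544) ∷
       (5 , 2684355844) ∷ (5 , 3222024194) ∷ (5 , 3222374410) ∷ (5 , 3224375042) ∷ (5 , 3233809154) ∷ (5 , 3489660938) ∷
       (5 , 3490512902) ∷ (5 , 3758096390) ∷ (5 , 4007669762) ∷ (6 , 6) ∷ (6 , 10) ∷ (6 , 50) ∷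
       (6 , 84) ∷ (6 , 152) ∷ (6 , 770) ∷ (6 , 1284) ∷ (6 , 2312) ∷ (6 , 4112) ∷
       (6 , 4352) ∷ (6 , 12290) ∷ (6 , 20484) ∷ (6 , 36872) ∷ (6 , 589840) ∷ (6 , 1114120) ∷
       (6 , 2228228) ∷ (6 , 2228240) ∷ (6 , 10027008) ∷ (6 , 13369346) ∷ (6 , 160436224) ∷ (6 , 537006080) ∷
       (6 , 538968320) ∷ (6 , 545801220) ∷ (6 , 546309888) ∷ (6 , 805306370) ∷ (6 , 858787840) ∷ (6 , 2415919112) ∷
       (6 , 2415919360) ∷ (6 , 2684354564) ∷ (6 , 3759013890) ∷ (7 , 2) ∷ (7 , 4) ∷ (7 , 8) ∷
       (7 , 16) ∷ (7 , 256) ∷ (7 , 4096) ∷ (7 , 2228224) ∷ (7 , 805502976) ∷ (7 , 2415919104) ∷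
       (8 , 0) ∷ []) ∷
      [] }

cert-a₀-ok : Check.check cert-a₀ (Check.table-entries cert-a₀) ≡ true
cert-a₀-ok = refl

cert-b₀ : Bound b0
cert-b₀ = record
  { moves =
      ((𝐓 , 3 , 1) ∷ (𝐐 , 4 , 2) ∷ []) ∷
      ((𝐓 , 3 , 2) ∷ (𝐐 , 4 , 2) ∷ []) ∷
      ((𝐓 , 3 , 2) ∷ (𝐐 , 4 , 2) ∷ []) ∷
      []
  ; finals = λ i → (i ≡ᵇ 2)
  ; scale = 12 ; offset = 9 ; gain = 21
  ; entries =
      ((9 , 2216723489) ∷ []) ∷
      ((6 , 3258479391) ∷ (18 , 12291) ∷ (18 , 1572888) ∷ (18 , 1074799114) ∷ (30 , 0) ∷ []) ∷
      ((0 , 4227792895) ∷ (1 , 3187605503) ∷ (3 , 268369919) ∷ (3 , 3722248191) ∷ (3 , 3820814335) ∷ (5 , 858980351) ∷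
       (5 , 2632120127) ∷ (5 , 4027514879) ∷ (6 , 16711679) ∷ (6 , 232587263) ∷ (6 , 2576941055) ∷ (8 , 53673983) ∷
       (8 , 268366079) ∷ (8 , 858927923) ∷ (8 , 3490512895) ∷ (8 , 3722230715) ∷ (8 , 4027510799) ∷ (9 , 978959) ∷
       (9 , 14483455) ∷ (9 , 161021951) ∷ (9 , 286274355) ∷ (10 , 805502975) ∷ (11 , 3342335) ∷ (11 , 53621555) ∷
       (11 , 232569787) ∷ (11 , 232583423) ∷ (11 , 2416508927) ∷ (11 , 3490508815) ∷ (11 , 4009295743) ∷ (12 , 847887) ∷
       (12 , 10027007) ∷ (12 , 14549247) ∷ (12 , 17838899) ∷ (12 , 429431193) ∷ (12 , 1364503210) ∷ (12 , 4294836224) ∷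
       (13 , 917759) ∷ (13 , 53670143) ∷ (13 , 231928063) ∷ (13 , 286300569) ∷ (13 , 357870250) ∷ (13 , 483179451) ∷
       (13 , 805450547) ∷ (13 , 805498895) ∷ (13 , 3490495419) ∷ (14 , 192527) ∷ (14 , 3289907) ∷ (14 , 14465979) ∷
       (14 , 36844307) ∷ (14 , 161018111) ∷ (14 , 250114295) ∷ (14 , 268448563) ∷ (14 , 2416504847) ∷ (14 , 2452123927) ∷
       (14 , 3224515343) ∷ (14 , 3436231563) ∷ (14 , 3490213903) ∷ (15 , 585743) ∷ (15 , 1061683) ∷ (15 , 10223863) ∷
       (15 , 26777993) ∷ (15 , 89434794) ∷ (15 , 268304384) ∷ (15 , 546836743) ∷ (15 , 1091873450) ∷ (15 , 3722182656) ∷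
       (16 , 786687) ∷ (16 , 17865113) ∷ (16 , 53620787) ∷ (16 , 232566971) ∷ (16 , 805449731) ∷ (16 , 3490492427) ∷
       (17 , 143363) ∷ (17 , 831499) ∷ (17 , 2228273) ∷ (17 , 16646159) ∷ (17 , 17838131) ∷ (17 , 213942328) ∷
       (17 , 268447747) ∷ (17 , 286304938) ∷ (17 , 339780138) ∷ (17 , 858914816) ∷ (17 , 1342483114) ∷ (17 , 2415951881) ∷
       (17 , 2576879889) ∷ (17 , 4027449344) ∷ (18 , 12291) ∷ (18 , 131327) ∷ (18 , 5548714) ∷ (18 , 9961727) ∷
       (18 , 10000793) ∷ (18 , 16646144) ∷ (18 , 232521728) ∷ (18 , 268474777) ∷ (18 , 2576875520) ∷ (19 , 524543) ∷
       (19 , 1087897) ∷ (20 , 917519) ∷ (20 , 917744) ∷ (20 , 14417935) ∷ (20 , 14418107) ∷ (20 , 17869482) ∷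
       (20 , 53608448) ∷ (20 , 89432234) ∷ (20 , 160960785) ∷ (20 , 160993433) ∷ (20 , 286265617) ∷ (20 , 286269986) ∷
       (20 , 286296200) ∷ (20 , 1342480394) ∷ (20 , 3490447360) ∷ (21 , 131123) ∷ (21 , 303114) ∷ (21 , 561161) ∷
       (21 , 786619) ∷ (21 , 917504) ∷ (21 , 1048627) ∷ (21 , 14417920) ∷ (21 , 17862809) ∷ (21 , 160956416) ∷
       (21 , 268472329) ∷ (21 , 286261248) ∷ (22 , 51) ∷ (22 , 36873) ∷ (22 , 3276815) ∷ (22 , 268479146) ∷
       (22 , 805437440) ∷ (22 , 2416447761) ∷ (23 , 786447) ∷ (23 , 786672) ∷ (23 , 1092266) ∷ (23 , 3276800) ∷
       (23 , 9961479) ∷ (23 , 9965825) ∷ (23 , 17830161) ∷ (23 , 17834530) ∷ (23 , 17860744) ∷ (23 , 36180081) ∷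
       (23 , 1146137130) ∷ (23 , 2416443392) ∷ (23 , 3222308875) ∷ (24 , 786432) ∷ (24 , 5505194) ∷ (24 , 9961472) ∷
       (24 , 17825792) ∷ (25 , 153) ∷ (25 , 131087) ∷ (25 , 131120) ∷ (25 , 262314) ∷ (25 , 268439825) ∷
       (25 , 268444194) ∷ (25 , 268468232) ∷ (26 , 40970) ∷ (26 , 131072) ∷ (26 , 524303) ∷ (26 , 524304) ∷
       (26 , 528385) ∷ (26 , 1048579) ∷ (26 , 1048584) ∷ (26 , 1052945) ∷ (26 , 1057282) ∷ (26 , 71311522) ∷
       (26 , 268435456) ∷ (27 , 524288) ∷ (27 , 1048576) ∷ (29 , 1) ∷ (29 , 32) ∷ (29 , 8194) ∷
       (29 , 32776) ∷ (30 , 0) ∷ []) ∷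
      [] }

cert-b₀-ok : Check.check cert-b₀ (Check.table-entries cert-b₀) ≡ true
cert-b₀-ok = refl

cert-𝟏 : Bound a0
cert-𝟏 = record
  { moves =
      ((𝟏 , 1 , 1) ∷ []) ∷
      ((𝟏 , 1 , 2) ∷ []) ∷
      ((𝟏 , 1 , 3) ∷ []) ∷
      ((𝟏 , 1 , 3) ∷ []) ∷
      []
  ; finals = λ i → (i ≡ᵇ 3)
  ; scale = 4 ; offset = 3 ; gain = 3
  ; entries =
      ((3 , 2216789024) ∷ []) ∷
      ((2 , 415373378) ∷ (6 , 8388608) ∷ []) ∷
      ((1 , 563884422) ∷ (5 , 528384) ∷ (5 , 1048578) ∷ (9 , 0) ∷ []) ∷
      ((0 , 65534) ∷ (0 , 3258544926) ∷ (1 , 30582) ∷ (1 , 65294) ∷ (2 , 13106) ∷ (2 , 30470) ∷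
       (2 , 61454) ∷ (3 , 14) ∷ (3 , 4368) ∷ (3 , 13058) ∷ (3 , 28678) ∷ (4 , 6) ∷
       (4 , 4352) ∷ (4 , 12290) ∷ (5 , 2) ∷ (5 , 4096) ∷ (6 , 0) ∷ []) ∷
      [] }

cert-𝟏-ok : Check.check cert-𝟏 (Check.table-entries cert-𝟏) ≡ true
cert-𝟏-ok = refl

-- The numbers in `moves` are prices rather than widths, four for each mark to be accounted for: 8
-- for a block that starts with 𝐪𝟏𝐪, charged to its first tile, and 1 for every 𝟏 outside the
-- blocks.
cert-𝐪𝟏𝐪 : Bound a0
cert-𝐪𝟏𝐪 = record
  { moves =
      ((𝐪 , 8 , 1) ∷ []) ∷
      ((𝟏 , 0 , 2) ∷ []) ∷
      ((𝐪 , 0 , 3) ∷ []) ∷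
      ((𝟏 , 1 , 3) ∷ (𝐪 , 8 , 4) ∷ []) ∷
      ((𝟏 , 0 , 5) ∷ []) ∷
      ((𝐪 , 0 , 6) ∷ []) ∷
      ((𝟏 , 0 , 7) ∷ []) ∷
      ((𝟏 , 0 , 8) ∷ []) ∷
      ((𝟏 , 0 , 9) ∷ []) ∷
      ((𝐪 , 8 , 4) ∷ []) ∷
      []
  ; finals = λ i → (i ≡ᵇ 3) ∨ (i ≡ᵇ 9)
  ; scale = 4 ; offset = 7 ; gain = 4
  ; entries =
      ((7 , 2216789024) ∷ []) ∷
      ((3 , 2293808) ∷ (3 , 2149729284) ∷ (3 , 2416017416) ∷ (3 , 2418018048) ∷ (7 , 65536) ∷ (7 , 2097152) ∷
       (7 , 2147483648) ∷ (11 , 0) ∷ []) ∷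
      ((3 , 13500530) ∷ (3 , 281839626) ∷ (3 , 817893122) ∷ (7 , 0) ∷ []) ∷
      ((4 , 14) ∷ (5 , 6) ∷ (6 , 2) ∷ (7 , 0) ∷ []) ∷
      ((0 , 4) ∷ (0 , 8) ∷ (2 , 0) ∷ []) ∷
      ((0 , 10) ∷ (2 , 2) ∷ (4 , 0) ∷ []) ∷
      ((4 , 0) ∷ []) ∷
      ((4 , 2) ∷ (8 , 0) ∷ []) ∷
      ((4 , 6) ∷ (8 , 0) ∷ []) ∷
      ((4 , 14) ∷ (8 , 0) ∷ []) ∷
      [] }

cert-𝐪𝟏𝐪-ok : Check.check cert-𝐪𝟏𝐪 (Check.table-entries cert-𝐪𝟏𝐪) ≡ true
cert-𝐪𝟏𝐪-ok = refl

-- A 𝐓 that opens 𝐓𝐐 after the first tile has price 4 and any other 𝐓 has price 1, because 𝐓𝐐 and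
-- 𝐓𝐓𝐓𝐓 should each take one mark.
cert-TQ-T : Bound b0
cert-TQ-T = record
  { moves =
      ((𝐓 , 1 , 1) ∷ []) ∷
      ((𝐓 , 4 , 2) ∷ []) ∷
      ((𝐐 , 0 , 3) ∷ []) ∷
      ((𝐓 , 4 , 2) ∷ (𝐓 , 1 , 4) ∷ []) ∷
      ((𝐓 , 1 , 4) ∷ []) ∷
      []
  ; finals = λ i → (i ≡ᵇ 3) ∨ (i ≡ᵇ 4)
  ; scale = 4 ; offset = 5 ; gain = 9
  ; entries =
      ((5 , 2216723489) ∷ []) ∷
      ((4 , 3258479391) ∷ (8 , 12291) ∷ (8 , 1572888) ∷ (8 , 1074799114) ∷ (12 , 0) ∷ []) ∷
      ((0 , 3820814335) ∷ (4 , 585743) ∷ (4 , 1061683) ∷ (4 , 10223863) ∷ (4 , 26777993) ∷ (4 , 160960785) ∷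
       (4 , 546836743) ∷ (4 , 1091873450) ∷ (8 , 12291) ∷ (8 , 40970) ∷ (8 , 524288) ∷ (8 , 1048576) ∷
       (12 , 0) ∷ []) ∷
      ((4 , 3342335) ∷ (4 , 590492467) ∷ (4 , 3453795259) ∷ (8 , 45067) ∷ (8 , 143363) ∷ (8 , 1087897) ∷
       (8 , 1092266) ∷ (8 , 1835195) ∷ (8 , 3276800) ∷ (8 , 17830161) ∷ (8 , 17834530) ∷ (8 , 17860744) ∷
       (8 , 3222308875) ∷ (12 , 0) ∷ []) ∷
      ((3 , 268369919) ∷ (4 , 16711679) ∷ (4 , 232587263) ∷ (5 , 978959) ∷ (5 , 14483455) ∷ (5 , 161021951) ∷
       (6 , 847887) ∷ (6 , 10027007) ∷ (6 , 17838899) ∷ (7 , 585743) ∷ (7 , 1061683) ∷ (7 , 10354943) ∷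
       (7 , 89434794) ∷ (7 , 160960785) ∷ (7 , 268304384) ∷ (7 , 3768088335) ∷ (8 , 12291) ∷ (8 , 5548714) ∷
       (8 , 10000793) ∷ (8 , 14418175) ∷ (8 , 16646144) ∷ (8 , 232521728) ∷ (9 , 303114) ∷ (9 , 561161) ∷
       (9 , 917504) ∷ (9 , 9961727) ∷ (9 , 14417920) ∷ (9 , 17869482) ∷ (9 , 160956416) ∷ (10 , 786432) ∷
       (10 , 1048627) ∷ (10 , 1092266) ∷ (10 , 9961472) ∷ (10 , 17825792) ∷ (11 , 40970) ∷ (11 , 524288) ∷
       (11 , 1048576) ∷ (12 , 0) ∷ []) ∷
      [] }

cert-TQ-T-ok : Check.check cert-TQ-T (Check.table-entries cert-TQ-T) ≡ true
cert-TQ-T-ok = refl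

cert-TQ : Bound b0
cert-TQ = record
  { moves =
      ((𝐓 , 4 , 1) ∷ []) ∷
      ((𝐐 , 0 , 2) ∷ []) ∷
      ((𝐓 , 4 , 1) ∷ []) ∷
      []
  ; finals = λ i → (i ≡ᵇ 2)
  ; scale = 4 ; offset = 4 ; gain = 8
  ; entries =
      ((4 , 2216723489) ∷ []) ∷
      ((0 , 3258479391) ∷ (4 , 12291) ∷ (4 , 1572888) ∷ (4 , 9961479) ∷ (4 , 9965825) ∷ (4 , 1074799114) ∷
       (8 , 0) ∷ []) ∷
      ((4 , 192527) ∷ (4 , 36844307) ∷ (4 , 3224515343) ∷ (4 , 3436231563) ∷ (8 , 36873) ∷ (8 , 40970) ∷
       (8 , 131072) ∷ (8 , 1048584) ∷ (8 , 1052945) ∷ (8 , 1057282) ∷ (12 , 0) ∷ []) ∷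
      [] }

cert-TQ-ok : Check.check cert-TQ (Check.table-entries cert-TQ) ≡ true
cert-TQ-ok = refl

cert-QQ-TQ-T : Bound b0
cert-QQ-TQ-T = record
  { moves =
      ((𝐓 , 1 , 1) ∷ []) ∷
      ((𝐐 , 0 , 2) ∷ []) ∷
      ((𝐐 , 0 , 3) ∷ []) ∷
      ((𝐓 , 4 , 4) ∷ (𝐓 , 1 , 5) ∷ []) ∷
      ((𝐐 , 0 , 3) ∷ []) ∷
      ((𝐓 , 1 , 5) ∷ []) ∷
      []
  ; finals = λ i → (i ≡ᵇ 5)
  ; scale = 4 ; offset = 1 ; gain = 8
  ; entries =
      ((1 , 2216723489) ∷ []) ∷
      ((0 , 3258479391) ∷ (4 , 12291) ∷ (4 , 1572888) ∷ (4 , 1074799114) ∷ (8 , 0) ∷ []) ∷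
      ((4 , 192527) ∷ (4 , 36844307) ∷ (4 , 3224515343) ∷ (4 , 3436231563) ∷ (8 , 36873) ∷ (8 , 40970) ∷
       (8 , 131072) ∷ (8 , 1048584) ∷ (8 , 1052945) ∷ (8 , 1057282) ∷ (12 , 0) ∷ []) ∷
      ((4 , 192527) ∷ (8 , 36873) ∷ (8 , 40970) ∷ (8 , 131072) ∷ (12 , 0) ∷ []) ∷
      ((4 , 12291) ∷ (8 , 0) ∷ []) ∷
      ((4 , 978959) ∷ (5 , 847887) ∷ (6 , 585743) ∷ (7 , 12291) ∷ (8 , 303114) ∷ (8 , 561161) ∷
       (8 , 917504) ∷ (9 , 786432) ∷ (10 , 40970) ∷ (10 , 524288) ∷ (11 , 0) ∷ []) ∷
      [] }

cert-QQ-TQ-T-ok : Check.check cert-QQ-TQ-T (Check.table-entries cert-QQ-TQ-T) ≡ true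
cert-QQ-TQ-T-ok = refl

-- The four blocks 𝐓𝐓𝐐 are read at no price, and `gain` stands for their marks altogether. After
-- that the unit is one mark for each 𝐓𝐐.
cert-TTQ-TQ : Bound b0
cert-TTQ-TQ = record
  { moves =
      ((𝐓 , 0 , 1) ∷ []) ∷
      ((𝐓 , 0 , 2) ∷ []) ∷
      ((𝐐 , 0 , 3) ∷ []) ∷
      ((𝐓 , 0 , 4) ∷ []) ∷
      ((𝐓 , 0 , 5) ∷ []) ∷
      ((𝐐 , 0 , 6) ∷ []) ∷
      ((𝐓 , 0 , 7) ∷ []) ∷
      ((𝐓 , 0 , 8) ∷ []) ∷
      ((𝐐 , 0 , 9) ∷ []) ∷
      ((𝐓 , 0 , 10) ∷ []) ∷
      ((𝐓 , 0 , 11) ∷ []) ∷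
      ((𝐐 , 0 , 12) ∷ []) ∷
      ((𝐓 , 1 , 13) ∷ []) ∷
      ((𝐐 , 0 , 12) ∷ []) ∷
      []
  ; finals = λ i → (i ≡ᵇ 12)
  ; scale = 1 ; offset = 0 ; gain = 7
  ; entries =
      ((0 , 2216723489) ∷ []) ∷
      ((0 , 3258479391) ∷ (1 , 12291) ∷ (1 , 1572888) ∷ (1 , 1074799114) ∷ (2 , 0) ∷ []) ∷
      ((0 , 3820814335) ∷ (1 , 585743) ∷ (1 , 1061683) ∷ (1 , 10223863) ∷ (1 , 26777993) ∷ (1 , 546836743) ∷
       (1 , 1091873450) ∷ (2 , 12291) ∷ (2 , 40970) ∷ (2 , 524288) ∷ (2 , 1048576) ∷ (3 , 0) ∷ []) ∷
      ((1 , 3342335) ∷ (1 , 590492467) ∷ (1 , 3453795259) ∷ (2 , 45067) ∷ (2 , 143363) ∷ (2 , 1087897) ∷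
       (2 , 1092266) ∷ (2 , 1835195) ∷ (2 , 3276800) ∷ (2 , 17830161) ∷ (2 , 17834530) ∷ (2 , 17860744) ∷
       (2 , 3222308875) ∷ (3 , 0) ∷ []) ∷
      ((1 , 4026466303) ∷ (2 , 585743) ∷ (2 , 1061683) ∷ (2 , 10354943) ∷ (2 , 160960785) ∷ (2 , 1163176618) ∷
       (2 , 3768088335) ∷ (3 , 12291) ∷ (3 , 40970) ∷ (3 , 524288) ∷ (3 , 1048576) ∷ (4 , 0) ∷ []) ∷
      ((2 , 847887) ∷ (2 , 10027007) ∷ (2 , 17838899) ∷ (3 , 12291) ∷ (3 , 303114) ∷ (3 , 561161) ∷
       (3 , 786432) ∷ (3 , 1048627) ∷ (3 , 1092266) ∷ (3 , 9961472) ∷ (3 , 17825792) ∷ (4 , 0) ∷ []) ∷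
      ((2 , 53673983) ∷ (3 , 143363) ∷ (3 , 831499) ∷ (3 , 1096635) ∷ (3 , 3277055) ∷ (3 , 17865113) ∷
       (3 , 17869482) ∷ (3 , 53608448) ∷ (4 , 4097) ∷ (4 , 8194) ∷ (4 , 32776) ∷ (4 , 131072) ∷
       (4 , 786432) ∷ (4 , 1048576) ∷ (5 , 0) ∷ []) ∷
      ((3 , 978959) ∷ (3 , 10027007) ∷ (3 , 17838899) ∷ (4 , 12291) ∷ (4 , 303114) ∷ (4 , 528385) ∷
       (4 , 917504) ∷ (4 , 1048627) ∷ (4 , 1092266) ∷ (4 , 9961472) ∷ (4 , 17825792) ∷ (5 , 0) ∷ []) ∷
      ((3 , 14483455) ∷ (3 , 161021951) ∷ (4 , 12291) ∷ (4 , 5548714) ∷ (4 , 9961727) ∷ (4 , 10000793) ∷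
       (4 , 14417920) ∷ (4 , 17869482) ∷ (4 , 160956416) ∷ (5 , 0) ∷ []) ∷
      ((4 , 192527) ∷ (4 , 3289907) ∷ (4 , 14465979) ∷ (4 , 17873851) ∷ (5 , 36873) ∷ (5 , 40970) ∷
       (5 , 131072) ∷ (5 , 1048763) ∷ (5 , 1052945) ∷ (5 , 1057314) ∷ (5 , 1083528) ∷ (5 , 14417920) ∷
       (5 , 17825792) ∷ (6 , 0) ∷ []) ∷
      ((4 , 16711679) ∷ (4 , 161021951) ∷ (5 , 12291) ∷ (5 , 5548714) ∷ (5 , 9961727) ∷ (5 , 9965841) ∷
       (5 , 16646144) ∷ (5 , 17869482) ∷ (5 , 160956416) ∷ (6 , 0) ∷ []) ∷
      ((4 , 232587263) ∷ (5 , 585743) ∷ (5 , 1061683) ∷ (5 , 14418175) ∷ (5 , 89434794) ∷ (5 , 160995737) ∷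
       (5 , 232521728) ∷ (6 , 12291) ∷ (6 , 40970) ∷ (6 , 524288) ∷ (6 , 1048576) ∷ (7 , 0) ∷ []) ∷
      ((5 , 3342335) ∷ (5 , 53621555) ∷ (5 , 232569787) ∷ (6 , 45067) ∷ (6 , 143363) ∷ (6 , 1087897) ∷
       (6 , 1092266) ∷ (6 , 3276800) ∷ (6 , 14418107) ∷ (6 , 17830161) ∷ (6 , 17834530) ∷ (6 , 17860744) ∷
       (6 , 232521728) ∷ (7 , 0) ∷ []) ∷
      ((4 , 268369919) ∷ (5 , 585743) ∷ (5 , 1061683) ∷ (5 , 16646399) ∷ (5 , 89434794) ∷ (5 , 160960785) ∷
       (5 , 268304384) ∷ (6 , 12291) ∷ (6 , 40970) ∷ (6 , 524288) ∷ (6 , 1048576) ∷ (7 , 0) ∷ []) ∷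
      [] }

cert-TTQ-TQ-ok : Check.check cert-TTQ-TQ (Check.table-entries cert-TTQ-TQ) ≡ true
cert-TTQ-TQ-ok = refl

-- Matchings with prescribed forcing number

Attains : List Col → ℕ → Set
Attains cs k = (∃[ w ] contents w ≡ cs × Forcing w × weight w ≡ k) ×
               (∀ w → contents w ≡ cs → Forcing w → k ≤ weight w)

record Attained (n k : ℕ) : Set where
  constructor attained
  field
    {home} : State
    tiles  : List (Tile home)
    wide   : span tiles ≡ n
    exact  : Attains (tiling tiles) k

Bounded : ∀ {s} → List (Tile s) → ℕ → Set
Bounded ts k = ∀ w → contents w ≡ tiling ts → Forcing w → k ≤ weight w

attain : ∀ {s} (ts : List (Tile s)) {n k} → span ts ≡ n → Forceable ts (_≤ k) → Bounded ts k → Attained n k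
attain ts eq (w , e , F , le) lo = attained ts eq ((w , e , F , ≤-antisym le (lo w e F)) , lo)

certified : ∀ {s} (B : Bound s) → let open Bound B in Check.check B (Check.table-entries B) ≡ true →
  ∀ {ts W j} → Run moves 0 ts W j → finals j ≡ true → 2 ≤ span ts →
  ∀ w → contents w ≡ tiling ts → Forcing w → W + gain ≤ offset + scale * weight w
certified B ok run fin two w e F =
  Soundness.bound B ok run fin w e F (≤-trans two (≤-reflexive (sym (cong length e))))

-- Nodes 0 to 2 count the columns read so far, and a 𝐪 leads to node 3 at once. The only accepting
-- node is thus reached after three columns at the latest, up to the end of a tile.
general-a0-run : ∀ i ts → i ≤ 3 → ∃[ j ] Run (Bound.moves cert-a₀) i ts (span ts) j × (3 ≤ i + span ts → j ≡ 3)
general-a0-run 0 []       _ = 0 , [] , λ ()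
general-a0-run 1 []       _ = 1 , [] , λ { (s≤s ()) }
general-a0-run 2 []       _ = 2 , [] , λ { (s≤s (s≤s ())) }
general-a0-run 3 []       _ = 3 , [] , λ _ → refl
general-a0-run 0 (𝟏 ∷ ts) _ with general-a0-run 1 ts (s≤s z≤n)
... | j , r , f = j , here refl ∷ r , f
general-a0-run 1 (𝟏 ∷ ts) _ with general-a0-run 2 ts (s≤s (s≤s z≤n))
... | j , r , f = j , here refl ∷ r , f
general-a0-run 2 (𝟏 ∷ ts) _ with general-a0-run 3 ts ≤-refl
... | j , r , f = j , here refl ∷ r , f
general-a0-run 3 (𝟏 ∷ ts) _ with general-a0-run 3 ts ≤-refl
... | j , r , f = j , here refl ∷ r , λ _ → f (m≤m+n 3 _)
general-a0-run 0 (𝐪 ∷ ts) _ with general-a0-run 3 ts ≤-refl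
... | j , r , f = j , there (here refl) ∷ r , λ _ → f (m≤m+n 3 _)
general-a0-run 1 (𝐪 ∷ ts) _ with general-a0-run 3 ts ≤-refl
... | j , r , f = j , there (here refl) ∷ r , λ _ → f (m≤m+n 3 _)
general-a0-run 2 (𝐪 ∷ ts) _ with general-a0-run 3 ts ≤-refl
... | j , r , f = j , there (here refl) ∷ r , λ _ → f (m≤m+n 3 _)
general-a0-run 3 (𝐪 ∷ ts) _ with general-a0-run 3 ts ≤-refl
... | j , r , f = j , there (here refl) ∷ r , λ _ → f (m≤m+n 3 _)
general-a0-run (suc (suc (suc (suc i)))) ts (s≤s (s≤s (s≤s ())))

lower-a0 : ∀ (ts : List (Tile a0)) → 34 ≤ span ts → ∀ w → contents w ≡ tiling ts → Forcing w →
           span ts + 2 ≤ 6 * weight w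
lower-a0 ts le w e F with general-a0-run 0 ts z≤n
... | j , r , f with refl ← f (≤-trans (≤ᵇ-sound refl) le) =
  farkas (span ts ∷ weight w ∷ []) 1 (var 0F ⊕ con 2) (6 ⊛ var 1F)
    ((1 , var 0F ⊕ con 5 , con 3 ⊕ 6 ⊛ var 1F) ∷ []) refl
    (certified cert-a₀ cert-a₀-ok r refl (≤-trans (≤ᵇ-sound refl) le) w e F ∷ [])

general-b0-run : ∀ ts → Run (Bound.moves cert-b₀) 2 ts (span ts) 2
general-b0-run []       = []
general-b0-run (𝐓 ∷ ts) = here refl ∷ general-b0-run ts
general-b0-run (𝐐 ∷ ts) = there (here refl) ∷ general-b0-run ts

lower-b0 : ∀ (ts : List (Tile b0)) → 34 ≤ span ts → ∀ w → contents w ≡ tiling ts → Forcing w →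
           span ts + 12 ≤ 12 * weight w
lower-b0 ts le w e F = farkas (span ts ∷ weight w ∷ []) 1 (var 0F ⊕ con 12) (12 ⊛ var 1F)
    ((1 , var 0F ⊕ con 21 , con 9 ⊕ 12 ⊛ var 1F) ∷ []) refl
    (certified cert-b₀ cert-b₀-ok (start ts le) refl (≤-trans (≤ᵇ-sound refl) le) w e F ∷ [])
  where
  start : ∀ ts → 34 ≤ span ts → Run (Bound.moves cert-b₀) 0 ts (span ts) 2
  start []           le = not-≤ refl le
  start (𝐓 ∷ [])     le = not-≤ refl le
  start (𝐐 ∷ [])     le = not-≤ refl le
  start (𝐓 ∷ 𝐓 ∷ ts) _  = here refl ∷ here refl ∷ general-b0-run ts
  start (𝐓 ∷ 𝐐 ∷ ts) _  = here refl ∷ there (here refl) ∷ general-b0-run ts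
  start (𝐐 ∷ 𝐓 ∷ ts) _  = there (here refl) ∷ here refl ∷ general-b0-run ts
  start (𝐐 ∷ 𝐐 ∷ ts) _  = there (here refl) ∷ there (here refl) ∷ general-b0-run ts

module _ {s : State} {P : Pattern s} where

  reweigh : ∀ {i ts V W j} → V ≡ W → Run P i ts V j → Run P i ts W j
  reweigh refl r = r

  infixr 5 _++ʳ_
  _++ʳ_ : ∀ {i j k xs ys V W} → Run P i xs V j → Run P j ys W k → Run P i (xs ++ ys) (V + W) k
  []                              ++ʳ r = r
  _++ʳ_ {W = W′} (_∷_ {w = w} {W = V} m q) r = reweigh (sym (+-assoc w V W′)) (m ∷ (q ++ʳ r))

  run-^^ : ∀ {i xs W} → Run P i xs W i → ∀ k → Run P i (xs ^^ k) (W * k) i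
  run-^^ {W = W} r zero    = reweigh (sym (*-zeroʳ W)) []
  run-^^ {W = W} r (suc k) = reweigh (sym (*-suc W k)) (r ++ʳ run-^^ r k)

record Piece {s} (X Y : Row) (ts : List (Tile s)) (n m : ℕ) : Set where
  constructor piece
  field
    wide : span ts ≡ n
    cov  : Covers X Y ts m

infixr 5 _++ᵖ_
_++ᵖ_ : ∀ {s X Y Z} {xs ys : List (Tile s)} {n n′ m m′} →
        Piece X Y xs n m → Piece Y Z ys n′ m′ → Piece X Z (xs ++ ys) (n + n′) (m + m′)
_++ᵖ_ {xs = xs} {ys} (piece w c) (piece w′ c′) = piece (trans (span-++ xs ys) (cong₂ _+_ w w′)) (c ++ᶜ c′)

piece-^^ : ∀ {s X} {ts : List (Tile s)} {n m} → Piece X X ts n m → ∀ k → Piece X X (ts ^^ k) (n * k) (m * k)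
piece-^^ {ts = ts} {n} {m} (piece w c) k = piece
  (trans (span-^^ ts k) (trans (cong (k *_) w) (*-comm k n)))
  (relabel refl (*-comm k m) (covers-^^ c k))

attain-pinned : ∀ {s O} {p w : List (Tile s)} {n n′ m m′} → (∀ q → q ≢ s → O ∋ q ≡ true) → O ∋ s ≡ false →
  Piece O ∅ p n m → Piece ∅ O w n′ m′ → Bounded (p ++ w) (m + m′) → Attained (n + n′) (m + m′)
attain-pinned {p = p} {w} others s∉O pp pw lo with pinned others s∉O (Piece.cov pp) (Piece.cov pw)
... | x , e , F , k = attain (p ++ w) (trans (span-++ p w) (cong₂ _+_ (Piece.wide pp) (Piece.wide pw)))
                        (x , e , F , ≤-reflexive k) lo

-- Families of matchings by 𝐓 and 𝐐

few-tri : ∀ r → r ≤ 3 → Piece ∅ ∁b0 ((𝐓 ∷ []) ^^ r) (3 * r) 0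
few-tri 0 _ = piece refl (weaken ∁b0 refl nil)
few-tri 1 _ = piece refl (cover _ 𝐓° refl refl refl)
few-tri 2 _ = piece refl (cover _ (𝐓° ++ 𝐓°) refl refl refl)
few-tri 3 _ = piece refl (cover _ (𝐓° ++ 𝐓° ++ 𝐓°) refl refl refl)
few-tri (suc (suc (suc (suc r)))) (s≤s (s≤s (s≤s ())))

TTTT QQT : List (Tile b0)
TTTT = 𝐓 ∷ TTT
QQT  = 𝐐 ∷ 𝐐 ∷ 𝐓 ∷ []

TTTT-piece : Piece ∅ ∅ TTTT 12 1
TTTT-piece = piece refl (cover TTTT (𝐓° ++ 𝐓° ++ 𝐓° ++ 𝐓-s) refl refl refl)

QQT-piece : Piece ∅ ∅ QQT 11 1
QQT-piece = piece refl (cover QQT (𝐐° ++ 𝐐° ++ 𝐓-s) refl refl refl)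

QQ-piece : Piece ∅ ∅ QQ 8 1
QQ-piece = piece refl QQ-left

tris : ∀ c r → r ≤ 3 → Piece ∅ ∁b0 (TTTT ^^ c ++ (𝐓 ∷ []) ^^ r) (12 * c + 3 * r) (1 * c + 0)
tris c r le = piece-^^ TTTT-piece c ++ᵖ few-tri r le

T-piece : Piece ∁b0 ∅ (𝐓 ∷ []) 3 2
T-piece = piece refl T-pin

TQ-piece : ∀ a → Piece ∅ ∅ (TQ ^^ a) (7 * a) (1 * a)
TQ-piece = piece-^^ (piece {ts = TQ} refl TQ-left)

-- Here `lower-b0` suffices: it gives 12 · weight ≥ 15 + 11e + 12c + 3r, which exceeds 12 (1 + e +
-- c) precisely when e ≤ 2 + 3r. So a limited number of blocks with eleven columns may stand in for
-- blocks with twelve.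
family-QQT : ∀ {n k} e c r → r ≤ 3 → e ≤ 2 + 3 * r → 34 ≤ n →
             n ≡ 3 + 11 * e + 12 * c + 3 * r → k ≡ 2 + e + c → Attained n k
family-QQT {n} {k} e c r r≤3 e≤ le refl refl = subst₂ Attained nn kk (attain-pinned others-b0 refl T-piece pw lo)
  where
  pw = piece-^^ QQT-piece e ++ᵖ tris c r r≤3
  nn : 3 + (11 * e + (12 * c + 3 * r)) ≡ n
  nn = linear-≡ (e ∷ c ∷ r ∷ []) (con 0) (con 0) (con 3 ⊕ (11 ⊛ var 0F ⊕ (12 ⊛ var 1F ⊕ 3 ⊛ var 2F)))
         (con 3 ⊕ 11 ⊛ var 0F ⊕ 12 ⊛ var 1F ⊕ 3 ⊛ var 2F) refl refl
  kk : 2 + (1 * e + (1 * c + 0)) ≡ k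
  kk = linear-≡ (e ∷ c ∷ []) (con 0) (con 0) (con 2 ⊕ (1 ⊛ var 0F ⊕ (1 ⊛ var 1F ⊕ con 0)))
         (con 2 ⊕ var 0F ⊕ var 1F) refl refl
  ts = 𝐓 ∷ QQT ^^ e ++ TTTT ^^ c ++ (𝐓 ∷ []) ^^ r
  wide : span ts ≡ n
  wide = trans (cong (3 +_) (Piece.wide pw)) nn
  lo : Bounded ts (2 + (1 * e + (1 * c + 0)))
  lo w ew F = farkas (weight w ∷ e ∷ c ∷ r ∷ []) 12 (con 2 ⊕ (1 ⊛ var 1F ⊕ (1 ⊛ var 2F ⊕ con 0))) (var 0F)
    ((1 , con 3 ⊕ 11 ⊛ var 1F ⊕ 12 ⊛ var 2F ⊕ 3 ⊛ var 3F ⊕ con 12 , 12 ⊛ var 0F) ∷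
     (1 , var 1F , con 2 ⊕ 3 ⊛ var 3F) ∷ []) refl
    (subst (λ x → x + 12 ≤ 12 * weight w) wide (lower-b0 ts (≤-trans le (≤-reflexive (sym wide))) w ew F) ∷ e≤ ∷ [])

run-tris : ∀ {P : Pattern b0} {i} → (𝐓 , 1 , i) ∈ˡ nth P i → ∀ c r →
           Run P i (TTTT ^^ c ++ (𝐓 ∷ []) ^^ r) (4 * c + 1 * r) i
run-tris m c r = run-^^ (m ∷ m ∷ m ∷ m ∷ []) c ++ʳ run-^^ (m ∷ []) r

family-TQ-T : ∀ {n k} a c r → r ≤ 3 → n ≡ 7 * suc a + (3 + 12 * c + 3 * r) → k ≡ 3 + a + c → Attained n k
family-TQ-T {n} {k} a c r r≤3 refl refl = subst₂ Attained nn kk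
    (attain-pinned others-b0 refl T-piece (TQ-piece (suc a) ++ᵖ tris c r r≤3) lo)
  where
  nn : 3 + (7 * suc a + (12 * c + 3 * r)) ≡ n
  nn = linear-≡ (a ∷ c ∷ r ∷ []) (con 0) (con 0) (con 3 ⊕ (7 ⊛ (con 1 ⊕ var 0F) ⊕ (12 ⊛ var 1F ⊕ 3 ⊛ var 2F)))
         (7 ⊛ (con 1 ⊕ var 0F) ⊕ (con 3 ⊕ 12 ⊛ var 1F ⊕ 3 ⊛ var 2F)) refl refl
  kk : 2 + (1 * suc a + (1 * c + 0)) ≡ k
  kk = linear-≡ (a ∷ c ∷ []) (con 0) (con 0) (con 2 ⊕ (1 ⊛ (con 1 ⊕ var 0F) ⊕ (1 ⊛ var 1F ⊕ con 0)))
         (con 3 ⊕ var 0F ⊕ var 1F) refl refl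
  ts = 𝐓 ∷ TQ ^^ suc a ++ TTTT ^^ c ++ (𝐓 ∷ []) ^^ r
  moves = Bound.moves cert-TQ-T
  -- Node 3 has two moves by 𝐓, since the automaton must guess whether another 𝐓𝐐 follows. The tail
  -- always takes the cheap one; if it is empty, the run ends at node 3 itself.
  tail : ∀ c r → ∃[ j ] Run moves 3 (TTTT ^^ c ++ (𝐓 ∷ []) ^^ r) (4 * c + 1 * r) j × Bound.finals cert-TQ-T j ≡ true
  tail zero    zero    = 3 , [] , refl
  tail zero    (suc r) = 4 , (there (here refl) ∷ run-^^ (here refl ∷ []) r) , refl
  tail (suc c) r       = 4 , subst (λ x → Run moves 3 (TTTT ^^ suc c ++ (𝐓 ∷ []) ^^ r) x 4) (cong (_+ 1 * r) (sym (*-suc 4 c)))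
    (there (here refl) ∷ here refl ∷ here refl ∷ here refl ∷ run-tris (here refl) c r) , refl
  lo : Bounded ts (2 + (1 * suc a + (1 * c + 0)))
  lo w ew F with tail c r
  ... | j , ρ , f = farkas (weight w ∷ a ∷ c ∷ r ∷ []) 4 (con 2 ⊕ (1 ⊛ (con 1 ⊕ var 1F) ⊕ (1 ⊛ var 2F ⊕ con 0))) (var 0F)
    ((1 , con 1 ⊕ (con 4 ⊕ (4 ⊛ var 1F ⊕ (4 ⊛ var 2F ⊕ 1 ⊛ var 3F))) ⊕ con 9 , con 5 ⊕ 4 ⊛ var 0F) ∷ []) refl
    (certified cert-TQ-T cert-TQ-T-ok {W = 1 + (4 + (4 * a + (4 * c + 1 * r)))}
       (here refl ∷ here refl ∷ here refl ∷ (run-^^ {W = 4} (here refl ∷ here refl ∷ []) a ++ʳ ρ)) f (≤ᵇ-sound refl) w ew F ∷ [])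

family-TQ : ∀ {n k} a → n ≡ 7 * suc a → k ≡ 2 + a → Attained n k
family-TQ a refl refl = attain ts wide (x , e , F , le′) lo
  where
  ts = TQ ^^ suc a
  wide : span ts ≡ 7 * suc a
  wide = Piece.wide (TQ-piece (suc a))
  -- After the pin 𝐓 the remaining tiles are grouped as 𝐐𝐓, a times with one mark each, and a last 𝐐
  -- that needs none.
  QTs : ∀ a → Piece ∅ ∁b0 (𝐐 ∷ TQ ^^ a) (4 + 7 * a) (1 * a)
  QTs zero    = piece refl (cover _ 𝐐° refl refl refl)
  QTs (suc a) = piece (cong (4 +_) (Piece.wide (TQ-piece (suc a)))) (QT-left ++ᶜ Piece.cov (QTs a))
  P = pinned others-b0 refl T-pin (Piece.cov (QTs a))
  x = proj₁ P
  e = proj₁ (proj₂ P)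
  F = proj₁ (proj₂ (proj₂ P))
  le′ : weight x ≤ 2 + a
  le′ = ≤-reflexive (trans (proj₂ (proj₂ (proj₂ P))) (cong (2 +_) (*-identityˡ a)))
  lo : Bounded ts (2 + a)
  lo w ew G = farkas (weight w ∷ a ∷ []) 4 (con 2 ⊕ var 1F) (var 0F)
    ((1 , con 4 ⊕ 4 ⊛ var 1F ⊕ con 8 , con 4 ⊕ 4 ⊛ var 0F) ∷ []) refl
    (certified cert-TQ cert-TQ-ok {W = 4 + 4 * a}
       (here refl ∷ here refl ∷ run-^^ {W = 4} (here refl ∷ here refl ∷ []) a) refl (≤ᵇ-sound refl) w ew G ∷ [])

family-QQ-TQ-T : ∀ {n k} a c → n ≡ 17 + 7 * a + 12 * c → k ≡ 3 + a + c → Attained n k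
family-QQ-TQ-T {n} {k} a c refl refl = subst₂ Attained nn kk
    (attain-pinned others-b0 refl T-piece (QQ-piece ++ᵖ TQ-piece a ++ᵖ tris c 2 (≤ᵇ-sound refl)) lo)
  where
  nn : 3 + (8 + (7 * a + (12 * c + 6))) ≡ n
  nn = linear-≡ (a ∷ c ∷ []) (con 0) (con 0) (con 3 ⊕ (con 8 ⊕ (7 ⊛ var 0F ⊕ (12 ⊛ var 1F ⊕ con 6))))
         (con 17 ⊕ 7 ⊛ var 0F ⊕ 12 ⊛ var 1F) refl refl
  kk : 2 + (1 + (1 * a + (1 * c + 0))) ≡ k
  kk = linear-≡ (a ∷ c ∷ []) (con 0) (con 0) (con 3 ⊕ (1 ⊛ var 0F ⊕ (1 ⊛ var 1F ⊕ con 0)))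
         (con 3 ⊕ var 0F ⊕ var 1F) refl refl
  ts = 𝐓 ∷ QQ ++ TQ ^^ a ++ TTTT ^^ c ++ (𝐓 ∷ []) ^^ 2
  moves = Bound.moves cert-QQ-TQ-T
  tail : ∀ c → Run moves 3 (TTTT ^^ c ++ (𝐓 ∷ []) ^^ 2) (4 * c + 2) 5
  tail zero    = there (here refl) ∷ here refl ∷ []
  tail (suc c) = subst (λ x → Run moves 3 (TTTT ^^ suc c ++ (𝐓 ∷ []) ^^ 2) x 5) (cong (_+ 2) (sym (*-suc 4 c)))
    (there (here refl) ∷ here refl ∷ here refl ∷ here refl ∷ run-tris (here refl) c 2)
  lo : Bounded ts (2 + (1 + (1 * a + (1 * c + 0))))
  lo w ew F = farkas (weight w ∷ a ∷ c ∷ []) 4 (con 3 ⊕ (1 ⊛ var 1F ⊕ (1 ⊛ var 2F ⊕ con 0))) (var 0F)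
    ((1 , con 1 ⊕ (4 ⊛ var 1F ⊕ (4 ⊛ var 2F ⊕ con 2)) ⊕ con 8 , con 1 ⊕ 4 ⊛ var 0F) ∷ []) refl
    (certified cert-QQ-TQ-T cert-QQ-TQ-T-ok {W = 1 + (4 * a + (4 * c + 2))}
       (here refl ∷ here refl ∷ here refl ∷ (run-^^ {W = 4} (here refl ∷ here refl ∷ []) a ++ʳ tail c)) refl (≤ᵇ-sound refl) w ew F ∷ [])

δ-5+7k : ∀ k → δ (5 + 7 * k) ≡ 0
δ-5+7k k = cong (λ r → if r ≡ᵇ 3 then 1 else 0)
  (trans (cong (λ x → (5 + x) % 7) (*-comm 7 k)) ([m+kn]%n≡m%n 5 k 7))

-- Here n is 7 (6 + a) - 2, and the general upper bound is already the desired value 7 + a; all that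
-- has to be supplied is the matching lower bound.
family-TTQ-TQ : ∀ {n k} a → n ≡ 40 + 7 * a → k ≡ 7 + a → Attained n k
family-TTQ-TQ {k = k} a refl refl = attain ts wide (proj₁ up , proj₁ (proj₂ up) , proj₁ (proj₂ (proj₂ up)) , le) lo
  where
  ts = TTQ ++ TTQ ++ TTQ ++ TTQ ++ TQ ^^ a
  wide : span ts ≡ 40 + 7 * a
  wide = cong (40 +_) (Piece.wide (TQ-piece a))
  up = upper-T (𝐓 ∷ 𝐐 ∷ TTQ ++ TTQ ++ TTQ ++ TQ ^^ a)
  le : weight (proj₁ up) ≤ 7 + a
  le = begin
    weight (proj₁ up)                            ≤⟨ proj₂ (proj₂ (proj₂ up)) ⟩
    ⌈ (span ts + 3) / 7 ⌉ + δ (span ts)        ≡⟨ cong (λ n → ⌈ (n + 3) / 7 ⌉ + δ n) wide ⟩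
    ⌈ (40 + 7 * a + 3) / 7 ⌉ + δ (40 + 7 * a)  ≤⟨ +-mono-≤ (ceiling-least {40 + 7 * a + 3} 6 {7 + a}
                                                    (farkas (a ∷ []) 1 (con 40 ⊕ 7 ⊛ var 0F ⊕ con 3) (7 ⊛ (con 7 ⊕ var 0F)) [] refl []))
                                                  (≤-reflexive (trans (cong δ (regroup a)) (δ-5+7k (5 + a)))) ⟩
    7 + a + 0                                  ≡⟨ +-identityʳ (7 + a) ⟩
    7 + a                                      ∎
    where
    open ≤-Reasoning
    regroup : ∀ a → 40 + 7 * a ≡ 5 + 7 * (5 + a)
    regroup a = linear-≡ (a ∷ []) (con 0) (con 0) (con 40 ⊕ 7 ⊛ var 0F) (con 5 ⊕ 7 ⊛ (con 5 ⊕ var 0F)) refl refl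
  lo : Bounded ts (7 + a)
  lo w ew F = farkas (weight w ∷ a ∷ []) 1 (con 7 ⊕ var 1F) (var 0F)
    ((1 , 1 ⊛ var 1F ⊕ con 7 , 1 ⊛ var 0F) ∷ []) refl
    (certified cert-TTQ-TQ cert-TTQ-TQ-ok {W = 1 * a}
      (here refl ∷ here refl ∷ here refl ∷ here refl ∷ here refl ∷ here refl ∷ here refl ∷ here refl ∷ here refl ∷
       here refl ∷ here refl ∷ here refl ∷ run-^^ {W = 1} (here refl ∷ here refl ∷ []) a) refl (≤ᵇ-sound refl) w ew F ∷ [])

-- Families of matchings by 𝟏 and 𝐪

-- The states one to three columns into a tile 𝐪.
in-quad : Row
in-quad = row false true true true false false false false

few-mono : ∀ r → r ≤ 3 → Piece ∅ in-quad ((𝟏 ∷ []) ^^ r) r 0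
few-mono 0 _ = piece refl (weaken in-quad refl nil)
few-mono 1 _ = piece refl (cover (𝟏 ∷ []) 𝟏° refl refl refl)
few-mono 2 _ = piece refl (cover (𝟏 ∷ 𝟏 ∷ []) (𝟏° ++ 𝟏°) refl refl refl)
few-mono 3 _ = piece refl (cover (𝟏 ∷ 𝟏 ∷ 𝟏 ∷ []) (𝟏° ++ 𝟏° ++ 𝟏°) refl refl refl)
few-mono (suc (suc (suc (suc r)))) (s≤s (s≤s (s≤s ())))

𝟏𝟏𝟏 𝟏𝟏𝟏𝟏 𝐪𝟏𝐪 𝐪𝐪 block : List (Tile a0)
𝟏𝟏𝟏   = 𝟏 ∷ 𝟏 ∷ 𝟏 ∷ []
𝟏𝟏𝟏𝟏  = 𝟏 ∷ 𝟏𝟏𝟏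
𝐪𝟏𝐪   = 𝐪 ∷ 𝟏 ∷ 𝐪 ∷ []
𝐪𝐪    = 𝐪 ∷ 𝐪 ∷ []
block = 𝐪𝟏𝐪 ++ 𝟏𝟏𝟏

𝟏𝟏𝟏𝟏-piece : Piece ∅ ∅ 𝟏𝟏𝟏𝟏 4 1
𝟏𝟏𝟏𝟏-piece = piece refl (cover 𝟏𝟏𝟏𝟏 (𝟏° ++ 𝟏° ++ 𝟏° ++ 𝟏-s) refl refl refl)

-- The two marks of 𝐪𝟏𝐪 determine it wherever it stands.
block-piece : Piece in-quad in-quad block 12 2
block-piece = piece refl (cover block (𝐪-v₃ ++ 𝟏° ++ 𝐪-v₁ ++ 𝟏° ++ 𝟏° ++ 𝟏°) refl refl refl)

blocks : ∀ r p → r ≤ 3 → Piece ∅ ∁a0 ((𝟏 ∷ []) ^^ r ++ block ^^ p) (r + 12 * p) (0 + 2 * p)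
blocks r p le = weakenᵖ (few-mono r le ++ᵖ piece-^^ block-piece p)
  where
  weakenᵖ : ∀ {ts : List (Tile a0)} {n m} → Piece ∅ in-quad ts n m → Piece ∅ ∁a0 ts n m
  weakenᵖ (piece w c) = piece w (weaken ∁a0 refl c)

𝐪𝟏𝐪𝟏𝟏𝟏𝟏-piece : Piece ∁a0 ∅ (𝐪𝟏𝐪 ++ 𝟏𝟏𝟏𝟏) 13 3
𝐪𝟏𝐪𝟏𝟏𝟏𝟏-piece = piece refl
  (cover (𝐪𝟏𝐪 ++ 𝟏𝟏𝟏𝟏) (𝐪-v₃ ++ 𝟏° ++ 𝐪-v₁ ++ 𝟏° ++ 𝟏° ++ 𝟏° ++ 𝟏-s) refl refl refl)

𝐪𝐪𝟏𝟏𝟏𝐪𝐪-piece : Piece ∁a0 ∅ (𝐪𝐪 ++ 𝟏𝟏𝟏 ++ 𝐪𝐪) 19 4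
𝐪𝐪𝟏𝟏𝟏𝐪𝐪-piece = piece refl
  (cover (𝐪𝐪 ++ 𝟏𝟏𝟏 ++ 𝐪𝐪) (𝐪-v₃ ++ 𝐪-u₁ ++ 𝟏° ++ 𝟏° ++ 𝟏° ++ 𝐪-u₂ ++ 𝐪-v₁) refl refl refl)

-- By `lower-a0`, six times the number of marks is at least n + 2 = 21 + m + 12p, which excludes 3 +
-- 2p marks.
family-𝐪𝐪 : ∀ {n k} m p → m ≤ 3 → 2 ≤ m → 34 ≤ n → n ≡ 19 + m + 12 * p → k ≡ 4 + 2 * p → Attained n k
family-𝐪𝐪 {n} m p m≤3 2≤m le refl refl = subst (λ n → Attained n (4 + 2 * p)) (sym (+-assoc 19 m (12 * p)))
  (attain-pinned others-a0 refl 𝐪𝐪𝟏𝟏𝟏𝐪𝐪-piece (blocks m p m≤3) lo)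
  where
  ts = 𝐪𝐪 ++ 𝟏𝟏𝟏 ++ 𝐪𝐪 ++ (𝟏 ∷ []) ^^ m ++ block ^^ p
  wide : span ts ≡ n
  wide = trans (cong (19 +_) (Piece.wide (blocks m p m≤3))) (sym (+-assoc 19 m (12 * p)))
  lo : Bounded ts (4 + 2 * p)
  lo w e F = farkas (weight w ∷ m ∷ p ∷ []) 6 (con 4 ⊕ 2 ⊛ var 2F) (var 0F)
    ((1 , con 19 ⊕ var 1F ⊕ 12 ⊛ var 2F ⊕ con 2 , 6 ⊛ var 0F) ∷ (1 , con 2 , var 1F) ∷ []) refl
    (subst (λ x → x + 2 ≤ 6 * weight w) wide (lower-a0 ts (≤-trans le (≤-reflexive (sym wide))) w e F) ∷ 2≤m ∷ [])

-- The 4c columns of additional tiles 𝟏 take a mark for every four of them, whereas `lower-a0`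
-- guarantees one only for every six; so a separate certificate is used.
family-𝐪𝟏𝐪 : ∀ {n k} c r p → r ≤ 3 → n ≡ 13 + 4 * c + r + 12 * p → k ≡ 3 + c + 2 * p → Attained n k
family-𝐪𝟏𝐪 {n} {k} c r p r≤3 refl refl = subst₂ Attained nn kk
  (attain-pinned others-a0 refl 𝐪𝟏𝐪𝟏𝟏𝟏𝟏-piece (piece-^^ 𝟏𝟏𝟏𝟏-piece c ++ᵖ blocks r p r≤3) lo)
  where
  nn : 13 + (4 * c + (r + 12 * p)) ≡ n
  nn = linear-≡ (c ∷ r ∷ p ∷ []) (con 0) (con 0) (con 13 ⊕ (4 ⊛ var 0F ⊕ (var 1F ⊕ 12 ⊛ var 2F)))
         (con 13 ⊕ 4 ⊛ var 0F ⊕ var 1F ⊕ 12 ⊛ var 2F) refl refl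
  kk : 3 + (1 * c + (0 + 2 * p)) ≡ k
  kk = linear-≡ (c ∷ p ∷ []) (con 0) (con 0) (con 3 ⊕ (1 ⊛ var 0F ⊕ (con 0 ⊕ 2 ⊛ var 1F)))
         (con 3 ⊕ var 0F ⊕ 2 ⊛ var 1F) refl refl
  moves = Bound.moves cert-𝐪𝟏𝐪
  ts = 𝐪𝟏𝐪 ++ 𝟏𝟏𝟏𝟏 ++ 𝟏𝟏𝟏𝟏 ^^ c ++ (𝟏 ∷ []) ^^ r ++ block ^^ p
  tail : ∀ p → ∃[ j ] Run moves 3 (block ^^ p) (8 * p) j × Bound.finals cert-𝐪𝟏𝐪 j ≡ true
  tail zero    = 3 , [] , refl
  tail (suc p) = 9 , reweigh (sym (*-suc 8 p)) (there (here refl) ∷ here refl ∷ here refl ∷ here refl ∷ here refl ∷ here refl ∷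
    run-^^ {W = 8} (here refl ∷ here refl ∷ here refl ∷ here refl ∷ here refl ∷ here refl ∷ []) p) , refl
  lo : Bounded ts (3 + (1 * c + (0 + 2 * p)))
  lo w e F with tail p
  ... | j , ρ , f = farkas (weight w ∷ c ∷ r ∷ p ∷ []) 4 (con 3 ⊕ (1 ⊛ var 1F ⊕ (con 0 ⊕ 2 ⊛ var 3F))) (var 0F)
    ((1 , con 12 ⊕ (4 ⊛ var 1F ⊕ (1 ⊛ var 2F ⊕ 8 ⊛ var 3F)) ⊕ con 4 , con 7 ⊕ 4 ⊛ var 0F) ∷ []) refl
    (certified cert-𝐪𝟏𝐪 cert-𝐪𝟏𝐪-ok {W = 12 + (4 * c + (1 * r + 8 * p))}
      (here refl ∷ here refl ∷ here refl ∷ here refl ∷ here refl ∷ here refl ∷ here refl ∷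
        (run-^^ {W = 4} (here refl ∷ here refl ∷ here refl ∷ here refl ∷ []) c ++ʳ
         (run-^^ {W = 1} (here refl ∷ []) r ++ʳ ρ))) f (≤ᵇ-sound refl) w e F ∷ [])

family-𝟏 : ∀ {n k} → 34 ≤ n → n ≤ 4 * k → 4 * k ≤ n + 3 → Attained n k
family-𝟏 {n} {k} le lo hi = attain ts wide (proj₁ up , proj₁ (proj₂ up) , proj₁ (proj₂ (proj₂ up)) , few) many
  where
  ts = (𝟏 ∷ []) ^^ n
  wide : span ts ≡ n
  wide = trans (span-^^ (𝟏 ∷ []) n) (*-identityʳ n)
  up = upper-a0 ts (≤-trans le (≤-reflexive (sym wide)))
  few : weight (proj₁ up) ≤ k
  few = farkas (weight (proj₁ up) ∷ n ∷ k ∷ []) 4 (var 0F) (var 2F)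
    ((1 , 4 ⊛ var 0F , var 1F ⊕ con 3) ∷ (1 , var 1F , 4 ⊛ var 2F) ∷ []) refl
    (≤-trans (proj₂ (proj₂ (proj₂ up))) (≤-reflexive (cong (_+ 3) wide)) ∷ lo ∷ [])
  monos : ∀ n → 34 ≤ n → Run (Bound.moves cert-𝟏) 0 ((𝟏 ∷ []) ^^ n) (1 * n) 3
  monos (suc (suc (suc n))) _ = reweigh (sym (*-identityˡ (3 + n)))
    (here refl ∷ here refl ∷ here refl ∷ reweigh (*-identityˡ n) (run-^^ {W = 1} (here refl ∷ []) n))
  monos 1 le = not-≤ refl le
  monos 2 le = not-≤ refl le
  many : Bounded ts k
  many w e F = farkas (weight w ∷ n ∷ k ∷ []) 4 (var 2F) (var 0F)
    ((1 , 1 ⊛ var 1F ⊕ con 3 , con 3 ⊕ 4 ⊛ var 0F) ∷ (1 , 4 ⊛ var 2F , var 1F ⊕ con 3) ∷ []) refl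
    (certified cert-𝟏 cert-𝟏-ok {W = 1 * n} (monos n le) refl (≤-trans (≤ᵇ-sound refl) (≤-trans le (≤-reflexive (sym wide)))) w e F ∷ hi ∷ [])

-- Every value of the two intervals

split-≤ : ∀ {m n} → m ≤ n → ∃[ d ] n ≡ m + d
split-≤ {m} {n} le = n ∸ m , sym (m+[n∸m]≡n le)

data Residue (m d : ℕ) : Set where
  residue : ∀ r q → r ≤ d → m ≡ r + suc d * q → Residue m d

residue-of : ∀ m d → Residue m d
residue-of m d = residue (m % suc d) (m / suc d) (m<1+n⇒m≤n (m%n<n m (suc d)))
  (trans (m≡m%n+[m/n]*n m (suc d)) (cong (m % suc d +_) (*-comm (m / suc d) (suc d))))

private
  -- Against ⌈n / 4⌉ one mark is saved by the head, which has thirteen columns and three marks, and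
  -- one by each of the p blocks. The x columns left over become tiles 𝟏.
  by-𝐪𝟏𝐪 : ∀ {n k} p x → n ≡ 13 + 12 * p + x → n ≤ 4 * (k + suc p) → 4 * (k + suc p) ≤ n + 3 → Attained n k
  by-𝐪𝟏𝐪 {n} {k} p x n≡ low high = from (residue-of x 3)
    where
    from : Residue x 3 → Attained n k
    from (residue r c r≤3 x≡) = family-𝐪𝟏𝐪 c r p r≤3
      (≤-antisym
        (farkas (n ∷ x ∷ c ∷ r ∷ p ∷ []) 1 (var 0F) (con 13 ⊕ 4 ⊛ var 2F ⊕ var 3F ⊕ 12 ⊛ var 4F)
          ((1 , var 0F , con 13 ⊕ 12 ⊛ var 4F ⊕ var 1F) ∷ (1 , var 1F , var 3F ⊕ 4 ⊛ var 2F) ∷ []) refl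
          (≤-reflexive n≡ ∷ ≤-reflexive x≡ ∷ []))
        (farkas (n ∷ x ∷ c ∷ r ∷ p ∷ []) 1 (con 13 ⊕ 4 ⊛ var 2F ⊕ var 3F ⊕ 12 ⊛ var 4F) (var 0F)
          ((1 , con 13 ⊕ 12 ⊛ var 4F ⊕ var 1F , var 0F) ∷ (1 , var 3F ⊕ 4 ⊛ var 2F , var 1F) ∷ []) refl
          (≤-reflexive (sym n≡) ∷ ≤-reflexive (sym x≡) ∷ [])))
      (≤-antisym
        (farkas (n ∷ x ∷ c ∷ r ∷ p ∷ k ∷ []) 4 (var 5F) (con 3 ⊕ var 2F ⊕ 2 ⊛ var 4F)
          ((1 , 4 ⊛ (var 5F ⊕ (con 1 ⊕ var 4F)) , var 0F ⊕ con 3) ∷ (1 , var 0F , con 13 ⊕ 12 ⊛ var 4F ⊕ var 1F) ∷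
           (1 , var 1F , var 3F ⊕ 4 ⊛ var 2F) ∷ (1 , var 3F , con 3) ∷ []) refl
          (high ∷ ≤-reflexive n≡ ∷ ≤-reflexive x≡ ∷ r≤3 ∷ []))
        (farkas (n ∷ x ∷ c ∷ r ∷ p ∷ k ∷ []) 4 (con 3 ⊕ var 2F ⊕ 2 ⊛ var 4F) (var 5F)
          ((1 , var 0F , 4 ⊛ (var 5F ⊕ (con 1 ⊕ var 4F))) ∷ (1 , con 13 ⊕ 12 ⊛ var 4F ⊕ var 1F , var 0F) ∷
           (1 , var 3F ⊕ 4 ⊛ var 2F , var 1F) ∷ []) refl
          (low ∷ ≤-reflexive (sym n≡) ∷ ≤-reflexive (sym x≡) ∷ [])))

  -- Now 2 + p marks are to be saved, but n is too small for `by-𝐪𝟏𝐪`. The bounds leave only k = 4 +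
  -- 2p with n = 21 + 12p or 22 + 12p, and there the head 𝐪𝐪𝟏𝟏𝟏𝐪𝐪 with two or three further 𝟏 saves
  -- two marks at once.
  by-𝐪𝐪 : ∀ {n k} p → 34 ≤ n → n + 2 ≤ 6 * k → 4 * (k + (2 + p)) ≤ n + 3 → n ≤ 24 + 12 * p → Attained n k
  by-𝐪𝐪 {n} {k} p le lo high short = from (split-≤ wide)
    where
    low : 4 + 2 * p ≤ k
    low = farkas (n ∷ k ∷ p ∷ []) 6 (con 4 ⊕ 2 ⊛ var 2F) (var 1F)
      ((3 , 4 ⊛ (var 1F ⊕ (con 2 ⊕ var 2F)) , var 0F ⊕ con 3) ∷ (3 , var 0F ⊕ con 2 , 6 ⊛ var 1F) ∷ []) refl (high ∷ lo ∷ [])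
    wide : 21 + 12 * p ≤ n
    wide = farkas (n ∷ k ∷ p ∷ []) 1 (con 21 ⊕ 12 ⊛ var 2F) (var 0F)
      ((1 , 4 ⊛ (var 1F ⊕ (con 2 ⊕ var 2F)) , var 0F ⊕ con 3) ∷ (4 , con 4 ⊕ 2 ⊛ var 2F , var 1F) ∷ []) refl (high ∷ low ∷ [])
    high′ : k ≤ 4 + 2 * p
    high′ = farkas (n ∷ k ∷ p ∷ []) 4 (var 1F) (con 4 ⊕ 2 ⊛ var 2F)
      ((1 , 4 ⊛ (var 1F ⊕ (con 2 ⊕ var 2F)) , var 0F ⊕ con 3) ∷ (1 , var 0F , con 24 ⊕ 12 ⊛ var 2F) ∷ []) refl (high ∷ short ∷ [])
    from : ∃[ e ] n ≡ 21 + 12 * p + e → Attained n k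
    from (e , n≡) = family-𝐪𝐪 (2 + e) p few (s≤s (s≤s z≤n)) le
      (trans n≡ (linear-≡ (p ∷ e ∷ []) (con 0) (con 0) (con 21 ⊕ 12 ⊛ var 0F ⊕ var 1F) (con 19 ⊕ (con 2 ⊕ var 1F) ⊕ 12 ⊛ var 0F) refl refl))
      (≤-antisym high′ low)
      where
      few : 2 + e ≤ 3
      few = farkas (n ∷ k ∷ p ∷ e ∷ []) 6 (con 2 ⊕ var 3F) (con 3)
        ((6 , con 21 ⊕ 12 ⊛ var 2F ⊕ var 3F , var 0F) ∷ (6 , var 0F ⊕ con 2 , 6 ⊛ var 1F) ∷ (36 , var 1F , con 4 ⊕ 2 ⊛ var 2F) ∷ []) refl
        (≤-reflexive (sym n≡) ∷ lo ∷ high′ ∷ [])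

-- Each of the p blocks 𝐪𝟏𝐪𝟏𝟏𝟏 saves one mark against ⌈ n / 4 ⌉ = k + p.
values-a0 : ∀ {n k} → 34 ≤ n → n + 2 ≤ 6 * k → k ≤ ⌈ n / 4 ⌉ → Attained n k
values-a0 {n} {k} le lo hi = from (split-≤ hi)
  where
  by : ∀ p → n ≤ 4 * (k + p) → 4 * (k + p) ≤ n + 3 → Attained n k
  by zero low high = family-𝟏 le (subst (λ x → n ≤ 4 * x) (+-identityʳ k) low) (subst (λ x → 4 * x ≤ n + 3) (+-identityʳ k) high)
  by (suc p) low high = compare (≤-<-connex (13 + 12 * p) n)
    where
    short : ∀ p → 4 * (k + suc p) ≤ n + 3 → n < 13 + 12 * p → Attained n k
    short zero    high lt = not-≤ refl (≤-trans le (m<1+n⇒m≤n lt))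
    short (suc p) high lt = by-𝐪𝐪 p le lo high (≤-trans (m<1+n⇒m≤n lt) (≤-reflexive (cong (12 +_) (*-suc 12 p))))
    compare : 13 + 12 * p ≤ n ⊎ n < 13 + 12 * p → Attained n k
    compare (inj₁ le′) = let x , eq = split-≤ le′ in by-𝐪𝟏𝐪 p x eq low high
    compare (inj₂ lt)  = short p high lt
  from : ∃[ p ] ⌈ n / 4 ⌉ ≡ k + p → Attained n k
  from (p , eq) = by p (subst (λ q → n ≤ 4 * q) eq (ceiling-lower n 3 ≤-refl))
                       (subst (λ q → 4 * q ≤ n + 3) eq (ceiling-upper n 3))

δ-residue : ∀ r q → δ (r + 7 * q) ≡ δ r
δ-residue r q = cong (λ r → if r ≡ᵇ 3 then 1 else 0)
  (trans (cong (λ x → (r + x) % 7) (*-comm 7 q)) ([m+kn]%n≡m%n r q 7))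

-- For n = 3 + 7q the ceiling is q + 1, that is (n + 4) / 7, and δ adds 1; this accounts for n + 11.
-- In all other cases n + 9 is the usual estimate of a ceiling.
top-bound : ∀ {n k} → k ≤ ⌈ (n + 3) / 7 ⌉ + δ n →
            7 * k ≤ n + 9 ⊎ (∃[ q ] n ≡ 3 + 7 * q × 7 * k ≤ n + 11)
top-bound {n} {k} hi = by (residue-of n 6)
  where
  c = ⌈ (n + 3) / 7 ⌉
  plain : δ n ≡ 0 → 7 * k ≤ n + 9
  plain eq = farkas (k ∷ c ∷ δ n ∷ n ∷ []) 1 (7 ⊛ var 0F) (var 3F ⊕ con 9)
    ((7 , var 0F , var 1F ⊕ var 2F) ∷ (7 , var 2F , con 0) ∷ (1 , 7 ⊛ var 1F , var 3F ⊕ con 3 ⊕ con 6) ∷ []) refl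
    (hi ∷ ≤-reflexive eq ∷ ceiling-upper (n + 3) 6 ∷ [])
  by : Residue n 6 → 7 * k ≤ n + 9 ⊎ (∃[ q ] n ≡ 3 + 7 * q × 7 * k ≤ n + 11)
  by (residue 0 q _ eq) = inj₁ (plain (trans (cong δ eq) (δ-residue 0 q)))
  by (residue 1 q _ eq) = inj₁ (plain (trans (cong δ eq) (δ-residue 1 q)))
  by (residue 2 q _ eq) = inj₁ (plain (trans (cong δ eq) (δ-residue 2 q)))
  by (residue 4 q _ eq) = inj₁ (plain (trans (cong δ eq) (δ-residue 4 q)))
  by (residue 5 q _ eq) = inj₁ (plain (trans (cong δ eq) (δ-residue 5 q)))
  by (residue 6 q _ eq) = inj₁ (plain (trans (cong δ eq) (δ-residue 6 q)))
  by (residue (suc (suc (suc (suc (suc (suc (suc _))))))) q (s≤s (s≤s (s≤s (s≤s (s≤s (s≤s ())))))) eq)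
  by (residue 3 q _ eq) = inj₂ (q , eq , farkas (k ∷ c ∷ δ n ∷ n ∷ q ∷ []) 1 (7 ⊛ var 0F) (var 3F ⊕ con 11)
    ((7 , var 0F , var 1F ⊕ var 2F) ∷ (7 , var 2F , con 1) ∷ (7 , var 1F , con 1 ⊕ var 4F) ∷ (1 , con 3 ⊕ 7 ⊛ var 4F , var 3F) ∷ []) refl
    (hi ∷ ≤-reflexive (trans (cong δ eq) (δ-residue 3 q)) ∷
     farkas (c ∷ n ∷ q ∷ []) 7 (var 0F) (con 1 ⊕ var 2F)
       ((1 , 7 ⊛ var 0F , var 1F ⊕ con 3 ⊕ con 6) ∷ (1 , var 1F , con 3 ⊕ 7 ⊛ var 2F) ∷ []) refl
       (ceiling-upper (n + 3) 6 ∷ ≤-reflexive eq ∷ []) ∷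
     ≤-reflexive (sym eq) ∷ []))

-- One mark serves seven columns of the form 𝐓𝐐 and twelve columns of any other
-- form, so with 12 (k - 1) - n = j + 5 a about a of the marks go to blocks 𝐓𝐐.
values-b0 : ∀ {n k} → 34 ≤ n → ⌈ n / 12 ⌉ + 1 ≤ k → k ≤ ⌈ (n + 3) / 7 ⌉ + δ n → Attained n k
values-b0 {n} {zero}  le lo hi = contradiction (≤-trans (m≤n+m 1 _) lo) λ ()
values-b0 {n} {suc k} le lo hi = start (split-≤ (ceiling-lower n 11 (m<1+n⇒m≤n (≤-trans (≤-reflexive (+-comm 1 _)) lo))))
  where
  weak : 7 * suc k ≤ n + 9 ⊎ (∃[ q ] n ≡ 3 + 7 * q × 7 * suc k ≤ n + 11) → 7 * suc k ≤ n + 11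
  weak (inj₁ h)           = ≤-trans h (+-monoʳ-≤ n (≤ᵇ-sound refl))
  weak (inj₂ (_ , _ , h)) = h
  top = top-bound {n} {suc k} hi

  -- Subtracting 7k ≤ n + 4, the weaker form of the upper end, leaves 5k ≥ 5a + j - 4, which forces
  -- a ≤ k.
  split : ∀ j a → 12 * k ≡ n + (j + 5 * a) → ∃[ b ] k ≡ a + b
  split j a eq = split-≤ (farkas (n ∷ k ∷ j ∷ a ∷ []) 5 (var 3F) (var 1F)
    ((1 , con 7 ⊕ 7 ⊛ var 1F , var 0F ⊕ con 11) ∷ (1 , var 0F ⊕ (var 2F ⊕ 5 ⊛ var 3F) , 12 ⊛ var 1F) ∷ []) refl
    (subst (_≤ n + 11) (*-suc 7 k) (weak top) ∷ ≤-reflexive (sym eq) ∷ []))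

  small : ∀ {x d} → (34 ≤ᵇ x) ≡ false → x ≡ n + d → Attained n (suc k)
  small {d = d} e eq = not-≤ e (≤-trans le (≤-trans (m≤m+n n d) (≤-reflexive (sym eq))))

  -- The hypothesis says n = 7a + 12b - j, and 1 + a + b marks are wanted. The pin with r unmarked 𝐓
  -- has 3 + 3r columns for two marks, which is 12 less 0, 3, 6 or 9. So j = 0 and j = 3 use r = 3
  -- and r = 2; j = 1 and j = 4 give up one 𝐓𝐐 and become 6 and 9; j = 2 uses r = 2 and one 𝐐𝐐, a
  -- column longer than 𝐓𝐐. If a = 0 rules this out, each block 𝐐𝐐𝐓 lowers n by one. The cases b = 0
  -- with j = 0, 2 or 3 are exceptional.
  by : ∀ j a b → j ≤ 4 → 12 * (a + b) ≡ n + (j + 5 * a) → k ≡ a + b → Attained n (suc k)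
  by 0 0 0 _ eq _ = small refl eq
  by 0 0 (suc c) _ eq k≡ = family-QQT 0 c 3 (≤ᵇ-sound refl) (≤ᵇ-sound refl) le
    (linear-≡ (n ∷ c ∷ []) (12 ⊛ (con 1 ⊕ var 1F)) (var 0F ⊕ con 0) (var 0F) (con 3 ⊕ con 0 ⊕ 12 ⊛ var 1F ⊕ con 9) refl eq) (cong suc k≡)
  by 0 (suc a) 0 _ eq k≡ = family-TQ a
    (linear-≡ (n ∷ a ∷ []) (12 ⊛ (con 1 ⊕ var 1F ⊕ con 0)) (var 0F ⊕ (con 0 ⊕ 5 ⊛ (con 1 ⊕ var 1F))) (var 0F) (7 ⊛ (con 1 ⊕ var 1F)) refl eq)
    (cong suc (trans k≡ (+-identityʳ (suc a))))
  by 0 (suc a) (suc c) _ eq k≡ = family-TQ-T a c 3 (≤ᵇ-sound refl)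
    (linear-≡ (n ∷ a ∷ c ∷ []) (12 ⊛ (con 1 ⊕ var 1F ⊕ (con 1 ⊕ var 2F))) (var 0F ⊕ (con 0 ⊕ 5 ⊛ (con 1 ⊕ var 1F)))
      (var 0F) (7 ⊛ (con 1 ⊕ var 1F) ⊕ (con 3 ⊕ 12 ⊛ var 2F ⊕ con 9)) refl eq)
    (cong suc (trans k≡ (cong suc (+-suc a c))))
  by 4 0 0 _ eq _ = small refl eq
  by 4 0 1 _ eq _ = small refl eq
  by 4 0 (suc (suc c)) _ eq k≡ = family-QQT 1 c 2 (≤ᵇ-sound refl) (≤ᵇ-sound refl) le
    (linear-≡ (n ∷ c ∷ []) (12 ⊛ (con 2 ⊕ var 1F)) (var 0F ⊕ con 4) (var 0F) (con 3 ⊕ con 11 ⊕ 12 ⊛ var 1F ⊕ con 6) refl eq) (cong suc k≡)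
  by 4 1 b _ eq k≡ = family-QQT 0 b 0 z≤n (≤ᵇ-sound refl) le
    (linear-≡ (n ∷ b ∷ []) (12 ⊛ (con 1 ⊕ var 1F)) (var 0F ⊕ con 9) (var 0F) (con 3 ⊕ con 0 ⊕ 12 ⊛ var 1F ⊕ con 0) refl eq) (cong suc k≡)
  by 4 (suc (suc a)) b _ eq k≡ = family-TQ-T a b 0 z≤n
    (linear-≡ (n ∷ a ∷ b ∷ []) (12 ⊛ (con 2 ⊕ var 1F ⊕ var 2F)) (var 0F ⊕ (con 4 ⊕ 5 ⊛ (con 2 ⊕ var 1F)))
      (var 0F) (7 ⊛ (con 1 ⊕ var 1F) ⊕ (con 3 ⊕ 12 ⊛ var 2F ⊕ con 0)) refl eq) (cong suc k≡)
  by 1 0 0 _ eq _ = small refl eq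
  by 1 0 1 _ eq _ = small refl eq
  by 1 0 (suc (suc c)) _ eq k≡ = family-QQT 1 c 3 (≤ᵇ-sound refl) (≤ᵇ-sound refl) le
    (linear-≡ (n ∷ c ∷ []) (12 ⊛ (con 2 ⊕ var 1F)) (var 0F ⊕ con 1) (var 0F) (con 3 ⊕ con 11 ⊕ 12 ⊛ var 1F ⊕ con 9) refl eq) (cong suc k≡)
  by 1 1 b _ eq k≡ = family-QQT 0 b 1 (≤ᵇ-sound refl) (≤ᵇ-sound refl) le
    (linear-≡ (n ∷ b ∷ []) (12 ⊛ (con 1 ⊕ var 1F)) (var 0F ⊕ con 6) (var 0F) (con 3 ⊕ con 0 ⊕ 12 ⊛ var 1F ⊕ con 3) refl eq) (cong suc k≡)
  by 1 (suc (suc a)) b _ eq k≡ = family-TQ-T a b 1 (≤ᵇ-sound refl)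
    (linear-≡ (n ∷ a ∷ b ∷ []) (12 ⊛ (con 2 ⊕ var 1F ⊕ var 2F)) (var 0F ⊕ (con 1 ⊕ 5 ⊛ (con 2 ⊕ var 1F)))
      (var 0F) (7 ⊛ (con 1 ⊕ var 1F) ⊕ (con 3 ⊕ 12 ⊛ var 2F ⊕ con 3)) refl eq) (cong suc k≡)
  by 3 0 0 _ eq _ = small refl eq
  by 3 0 (suc c) _ eq k≡ = family-QQT 0 c 2 (≤ᵇ-sound refl) (≤ᵇ-sound refl) le
    (linear-≡ (n ∷ c ∷ []) (12 ⊛ (con 1 ⊕ var 1F)) (var 0F ⊕ con 3) (var 0F) (con 3 ⊕ con 0 ⊕ 12 ⊛ var 1F ⊕ con 6) refl eq) (cong suc k≡)
  -- In this case n = 7 (a + 1) - 3 is 4 modulo 7, so δ vanishes and a + 2 marks exceed the upper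
  -- end.
  by 3 (suc a) 0 _ eq k≡ = ⊥-elim (high top)
    where
    n≡ : n + 3 ≡ 7 * suc a
    n≡ = linear-≡ (n ∷ a ∷ []) (12 ⊛ (con 1 ⊕ var 1F ⊕ con 0)) (var 0F ⊕ (con 3 ⊕ 5 ⊛ (con 1 ⊕ var 1F))) (var 0F ⊕ con 3) (7 ⊛ (con 1 ⊕ var 1F)) refl eq
    high : 7 * suc k ≤ n + 9 ⊎ (∃[ q ] n ≡ 3 + 7 * q × 7 * suc k ≤ n + 11) → ⊥
    high (inj₁ h) = not-≤ {1} {0} refl (farkas (n ∷ a ∷ k ∷ []) 1 (con 1) (con 0)
      ((1 , 7 ⊛ (con 1 ⊕ var 2F) , var 0F ⊕ con 9) ∷ (1 , var 0F ⊕ con 3 , 7 ⊛ (con 1 ⊕ var 1F)) ∷ (7 , con 1 ⊕ var 1F , var 2F) ∷ []) refl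
      (h ∷ ≤-reflexive n≡ ∷ ≤-reflexive (sym (trans k≡ (+-identityʳ (suc a)))) ∷ []))
    high (inj₂ (q , eq′ , _)) = apart (<-≤-connex a q)
      where
      apart : a < q ⊎ q ≤ a → ⊥
      apart (inj₁ a<q) = not-≤ {1} {0} refl (farkas (n ∷ a ∷ q ∷ []) 1 (con 1) (con 0)
        ((1 , var 0F ⊕ con 3 , 7 ⊛ (con 1 ⊕ var 1F)) ∷ (1 , con 3 ⊕ 7 ⊛ var 2F , var 0F) ∷ (7 , con 1 ⊕ var 1F , var 2F) ∷ []) refl
        (≤-reflexive n≡ ∷ ≤-reflexive (sym eq′) ∷ a<q ∷ []))
      apart (inj₂ q≤a) = not-≤ {1} {0} refl (farkas (n ∷ a ∷ q ∷ []) 1 (con 1) (con 0)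
        ((1 , 7 ⊛ (con 1 ⊕ var 1F) , var 0F ⊕ con 3) ∷ (1 , var 0F , con 3 ⊕ 7 ⊛ var 2F) ∷ (7 , var 2F , var 1F) ∷ []) refl
        (≤-reflexive (sym n≡) ∷ ≤-reflexive eq′ ∷ q≤a ∷ []))
  by 3 (suc a) (suc c) _ eq k≡ = family-TQ-T a c 2 (≤ᵇ-sound refl)
    (linear-≡ (n ∷ a ∷ c ∷ []) (12 ⊛ (con 1 ⊕ var 1F ⊕ (con 1 ⊕ var 2F))) (var 0F ⊕ (con 3 ⊕ 5 ⊛ (con 1 ⊕ var 1F)))
      (var 0F) (7 ⊛ (con 1 ⊕ var 1F) ⊕ (con 3 ⊕ 12 ⊛ var 2F ⊕ con 6)) refl eq)
    (cong suc (trans k≡ (cong suc (+-suc a c))))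
  by 2 0 0 _ eq _ = small refl eq
  by 2 0 1 _ eq _ = small refl eq
  by 2 0 2 _ eq _ = small refl eq
  by 2 0 (suc (suc (suc c))) _ eq k≡ = family-QQT 2 c 3 (≤ᵇ-sound refl) (≤ᵇ-sound refl) le
    (linear-≡ (n ∷ c ∷ []) (12 ⊛ (con 3 ⊕ var 1F)) (var 0F ⊕ con 2) (var 0F) (con 3 ⊕ con 22 ⊕ 12 ⊛ var 1F ⊕ con 9) refl eq) (cong suc k≡)
  -- Here n = 7 (a + 1) - 2, and the tiling with four blocks 𝐓𝐓𝐐 needs 40 columns. The next smaller
  -- number of this form is 33, so 34 ≤ n gives a ≥ 5.
  by 2 (suc a) 0 _ eq k≡ = from (split-≤ {5} {a} (farkas (n ∷ a ∷ []) 7 (con 5) (var 1F)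
      ((1 , con 34 , var 0F) ∷ (1 , var 0F ⊕ (con 2 ⊕ 5 ⊛ (con 1 ⊕ var 1F)) , 12 ⊛ (con 1 ⊕ var 1F ⊕ con 0)) ∷ []) refl
      (le ∷ ≤-reflexive (sym eq) ∷ [])))
    where
    from : ∃[ d ] a ≡ 5 + d → Attained n (suc k)
    from (d , a≡) = family-TTQ-TQ d
      (linear-≡ (n ∷ d ∷ []) (12 ⊛ (con 6 ⊕ var 1F ⊕ con 0)) (var 0F ⊕ (con 2 ⊕ 5 ⊛ (con 6 ⊕ var 1F))) (var 0F) (con 40 ⊕ 7 ⊛ var 1F) refl
        (subst (λ a → 12 * (suc a + 0) ≡ n + (2 + 5 * suc a)) a≡ eq))
      (cong suc (trans k≡ (trans (+-identityʳ (suc a)) (cong suc a≡))))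
  by 2 (suc a) (suc c) _ eq k≡ = family-QQ-TQ-T a c
    (linear-≡ (n ∷ a ∷ c ∷ []) (12 ⊛ (con 1 ⊕ var 1F ⊕ (con 1 ⊕ var 2F))) (var 0F ⊕ (con 2 ⊕ 5 ⊛ (con 1 ⊕ var 1F)))
      (var 0F) (con 17 ⊕ 7 ⊛ var 1F ⊕ 12 ⊛ var 2F) refl eq)
    (cong suc (trans k≡ (cong suc (+-suc a c))))
  by (suc (suc (suc (suc (suc _))))) _ _ (s≤s (s≤s (s≤s (s≤s ())))) _ _

  start : ∃[ D ] 12 * k ≡ n + D → Attained n (suc k)
  start (D , eq) = go (residue-of D 4)
    where
    go : Residue D 4 → Attained n (suc k)
    go (residue j a j≤4 D≡) = let eq′ = trans eq (cong (n +_) D≡) ; b , k≡ = split j a eq′ in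
      by j a b j≤4 (trans (cong (12 *_) (sym k≡)) eq′) k≡

-- Perfect matchings of P(n,2) as closed paths

edge : ∀ {n} → Fin 3 → Fin n → Fin (3 * n)
edge = combine {3}

bit-of : Fin 3 → Col → Bool
bit-of 0F = skip
bit-of 1F = spoke
bit-of 2F = next

edges : ∀ {n} → Vec Col n → Subset (3 * n)
edges cs = Vec.map skip cs Vec.++ (Vec.map spoke cs Vec.++ (Vec.map next cs Vec.++ []))

lookup-edges : ∀ {n} (cs : Vec Col n) f i → lookup (edges cs) (edge f i) ≡ bit-of f (lookup cs i)
lookup-edges cs 0F i = trans (VecP.lookup-++ˡ (Vec.map skip cs) _ i) (VecP.lookup-map i skip cs)
lookup-edges cs 1F i = trans (VecP.lookup-++ʳ (Vec.map skip cs) _ (combine {2} 0F i))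
  (trans (VecP.lookup-++ˡ (Vec.map spoke cs) _ i) (VecP.lookup-map i spoke cs))
lookup-edges cs 2F i = trans (VecP.lookup-++ʳ (Vec.map skip cs) _ (combine {2} 1F i))
  (trans (VecP.lookup-++ʳ (Vec.map spoke cs) _ (combine {1} 0F i))
  (trans (VecP.lookup-++ˡ (Vec.map next cs) _ i) (VecP.lookup-map i next cs)))

columns : ∀ n → Subset (3 * n) → Vec Col n
columns n M = tabulate λ i → ⟨ lookup M (edge 0F i) , lookup M (edge 1F i) , lookup M (edge 2F i) ⟩

lookup-ext : ∀ {A : Set} {n} {xs ys : Vec A n} → (∀ i → lookup xs i ≡ lookup ys i) → xs ≡ ys
lookup-ext {xs = xs} {ys} eq = trans (sym (VecP.tabulate∘lookup xs)) (trans (VecP.tabulate-cong eq) (VecP.tabulate∘lookup ys))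

data EdgeView (n : ℕ) : Fin (3 * n) → Set where
  edge-at : ∀ f (i : Fin n) → EdgeView n (edge f i)

edge-view : ∀ {n} (e : Fin (3 * n)) → EdgeView n e
edge-view {n} e = subst (EdgeView n) (combine-remQuot {3} n e) (edge-at (proj₁ (remQuot {3} n e)) (proj₂ (remQuot {3} n e)))

edges-columns : ∀ n (M : Subset (3 * n)) → edges (columns n M) ≡ M
edges-columns n M = lookup-ext λ e → at-edge (edge-view {n} e)
  where
  at-edge : ∀ {e} → EdgeView n e → lookup (edges (columns n M)) e ≡ lookup M e
  at-edge (edge-at f i) = trans (lookup-edges (columns n M) f i) (trans (cong (bit-of f) (VecP.lookup∘tabulate _ i)) (same f))
    where
    same : ∀ f → bit-of f ⟨ lookup M (edge 0F i) , lookup M (edge 1F i) , lookup M (edge 2F i) ⟩ ≡ lookup M (edge f i)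
    same 0F = refl
    same 1F = refl
    same 2F = refl

edges-injective : ∀ {n} (cs ds : Vec Col n) → edges cs ≡ edges ds → cs ≡ ds
edges-injective cs ds eq = lookup-ext λ i →
  cong₂ (λ x (s , y) → ⟨ x , s , y ⟩) (same 0F i) (cong₂ _,_ (same 1F i) (same 2F i))
  where
  same : ∀ f i → bit-of f (lookup cs i) ≡ bit-of f (lookup ds i)
  same f i = trans (sym (lookup-edges cs f i)) (trans (cong (λ M → lookup M (edge f i)) eq) (lookup-edges ds f i))

∣∷∣ : ∀ {n} b (p : Subset n) → ∣ b ∷ p ∣ ≡ bit b + ∣ p ∣
∣∷∣ false p = refl
∣∷∣ true  p = refl

∣++∣ : ∀ {m n} (p : Subset m) (q : Subset n) → ∣ p Vec.++ q ∣ ≡ ∣ p ∣ + ∣ q ∣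
∣++∣ []      q = refl
∣++∣ (b ∷ p) q = trans (∣∷∣ b (p Vec.++ q)) (trans (cong (bit b +_) (∣++∣ p q))
  (trans (sym (+-assoc (bit b) ∣ p ∣ ∣ q ∣)) (cong (_+ ∣ q ∣) (sym (∣∷∣ b p)))))

∣edges∣ : ∀ {n} (cs : Vec Col n) → ∣ edges cs ∣ ≡ weight* (toList cs)
∣edges∣ cs = trans (∣++∣ (Vec.map skip cs) _) (trans (cong (∣ Vec.map skip cs ∣ +_) (trans (∣++∣ (Vec.map spoke cs) _)
  (cong (∣ Vec.map spoke cs ∣ +_) (trans (∣++∣ (Vec.map next cs) []) (+-identityʳ _))))) (sums cs))
  where
  sums : ∀ {n} (cs : Vec Col n) → ∣ Vec.map skip cs ∣ + (∣ Vec.map spoke cs ∣ + ∣ Vec.map next cs ∣) ≡ weight* (toList cs)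
  sums []                   = refl
  sums (⟨ x , s , y ⟩ ∷ cs) = trans
    (cong₂ _+_ (∣∷∣ x (Vec.map skip cs)) (cong₂ _+_ (∣∷∣ s (Vec.map spoke cs)) (∣∷∣ y (Vec.map next cs))))
    (trans (regroup (bit x) (bit s) (bit y) _ _ _) (cong (count ⟨ x , s , y ⟩ +_) (sums cs)))
    where
    open +-*-Solver
    regroup : ∀ x s y a b c → (x + a) + ((s + b) + (y + c)) ≡ (x + (s + y)) + (a + (b + c))
    regroup = solve 6 (λ x s y a b c → (x :+ a) :+ ((s :+ b) :+ (y :+ c)) := (x :+ (s :+ y)) :+ (a :+ (b :+ c))) refl

⊑-fields : ∀ {m c} → (∀ f → bit-of f m ≡ true → bit-of f c ≡ true) → m ⊑ c
⊑-fields {⟨ x , s , y ⟩} {⟨ x′ , s′ , y′ ⟩} h = ∧-intro (⇒-intro (h 0F)) (∧-intro (⇒-intro (h 1F)) (⇒-intro (h 2F)))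
  where
  ⇒-intro : ∀ {a b} → (a ≡ true → b ≡ true) → a ⇒ b ≡ true
  ⇒-intro {false} _ = refl
  ⇒-intro {true}  h = h refl

fields-⊑ : ∀ {m c} → m ⊑ c → ∀ f → bit-of f m ≡ true → bit-of f c ≡ true
fields-⊑ {⟨ x , s , y ⟩} {⟨ x′ , s′ , y′ ⟩} l 0F = ⇒-elim (proj₁ (∧-elim {x ⇒ x′} l))
fields-⊑ {⟨ x , s , y ⟩} {⟨ x′ , s′ , y′ ⟩} l 1F = ⇒-elim (proj₁ (∧-elim {s ⇒ s′} (proj₂ (∧-elim {x ⇒ x′} l))))
fields-⊑ {⟨ x , s , y ⟩} {⟨ x′ , s′ , y′ ⟩} l 2F = ⇒-elim (proj₂ (∧-elim {s ⇒ s′} (proj₂ (∧-elim {x ⇒ x′} l))))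

⊑*-lookup : ∀ {n} (ms cs : Vec Col n) → toList ms ⊑* toList cs → ∀ i → lookup ms i ⊑ lookup cs i
⊑*-lookup (m ∷ ms) (c ∷ cs) (k ∷ l) zero    = k
⊑*-lookup (m ∷ ms) (c ∷ cs) (k ∷ l) (suc i) = ⊑*-lookup ms cs l i

lookup-⊑* : ∀ {n} (ms cs : Vec Col n) → (∀ i → lookup ms i ⊑ lookup cs i) → toList ms ⊑* toList cs
lookup-⊑* []       []       h = []
lookup-⊑* (m ∷ ms) (c ∷ cs) h = h zero ∷ lookup-⊑* ms cs (h ∘ suc)

⊑*⇒⊆ : ∀ {n} (ms cs : Vec Col n) → toList ms ⊑* toList cs → edges ms ⊆ edges cs
⊑*⇒⊆ {n} ms cs l {e} m = by (edge-view {n} e) m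
  where
  by : ∀ {e} → EdgeView n e → e ∈ edges ms → e ∈ edges cs
  by (edge-at f i) m = VecP.lookup⇒[]= _ (edges cs) (trans (lookup-edges cs f i)
    (fields-⊑ (⊑*-lookup ms cs l i) f (trans (sym (lookup-edges ms f i)) (VecP.[]=⇒lookup m))))

⊆⇒⊑* : ∀ {n} (ms cs : Vec Col n) → edges ms ⊆ edges cs → toList ms ⊑* toList cs
⊆⇒⊑* ms cs sub = lookup-⊑* ms cs λ i → ⊑-fields λ f t →
  trans (sym (lookup-edges cs f i)) (VecP.[]=⇒lookup
    (sub (VecP.lookup⇒[]= (edge f i) (edges ms) (trans (lookup-edges ms f i) t))))

-- Perfect matchings as closed paths

data One : Bool → Bool → Bool → Set where
  first  : One true false false
  second : One false true false
  third  : One false false true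

module _ {m} (M : Subset m) (P : Fin m → Set) {e₁ e₂ e₃ : Fin m} (p₁ : P e₁) (p₂ : P e₂) (p₃ : P e₃)
         (all : ∀ {e} → P e → e ≡ e₁ ⊎ e ≡ e₂ ⊎ e ≡ e₃)
         (e₁≢e₂ : e₁ ≢ e₂) (e₁≢e₃ : e₁ ≢ e₃) (e₂≢e₃ : e₂ ≢ e₃) where

  private
    member : ∀ {e} → lookup M e ≡ true → e ∈ M
    member = VecP.lookup⇒[]= _ M

  ∃!⇒One : (∃! _≡_ λ e → e ∈ M × P e) → One (lookup M e₁) (lookup M e₂) (lookup M e₃)
  ∃!⇒One (e , (e∈ , p) , uniq) = by (all p)
    where
    other : ∀ {e′} → P e′ → e ≢ e′ → lookup M e′ ≡ false
    other p′ ne = Bool.¬-not λ t → ne (uniq (member t , p′))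
    by : e ≡ e₁ ⊎ e ≡ e₂ ⊎ e ≡ e₃ → One (lookup M e₁) (lookup M e₂) (lookup M e₃)
    by (inj₁ refl) rewrite VecP.[]=⇒lookup e∈ | other p₂ e₁≢e₂ | other p₃ e₁≢e₃ = first
    by (inj₂ (inj₁ refl)) rewrite VecP.[]=⇒lookup e∈ | other p₁ (e₁≢e₂ ∘ sym) | other p₃ e₂≢e₃ = second
    by (inj₂ (inj₂ refl)) rewrite VecP.[]=⇒lookup e∈ | other p₁ (e₁≢e₃ ∘ sym) | other p₂ (e₂≢e₃ ∘ sym) = third

  One⇒∃! : One (lookup M e₁) (lookup M e₂) (lookup M e₃) → ∃! _≡_ λ e → e ∈ M × P e
  One⇒∃! one with lookup M e₁ in q₁ | lookup M e₂ in q₂ | lookup M e₃ in q₃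
  One⇒∃! first  | _ | _ | _ = e₁ , (member q₁ , p₁) , λ (m , p) → pick (all p) m
    where
    pick : ∀ {e} → e ≡ e₁ ⊎ e ≡ e₂ ⊎ e ≡ e₃ → e ∈ M → e₁ ≡ e
    pick (inj₁ refl) _ = refl
    pick (inj₂ (inj₁ refl)) m = contradiction (trans (sym (VecP.[]=⇒lookup m)) q₂) λ ()
    pick (inj₂ (inj₂ refl)) m = contradiction (trans (sym (VecP.[]=⇒lookup m)) q₃) λ ()
  One⇒∃! second | _ | _ | _ = e₂ , (member q₂ , p₂) , λ (m , p) → pick (all p) m
    where
    pick : ∀ {e} → e ≡ e₁ ⊎ e ≡ e₂ ⊎ e ≡ e₃ → e ∈ M → e₂ ≡ e
    pick (inj₁ refl) m = contradiction (trans (sym (VecP.[]=⇒lookup m)) q₁) λ ()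
    pick (inj₂ (inj₁ refl)) _ = refl
    pick (inj₂ (inj₂ refl)) m = contradiction (trans (sym (VecP.[]=⇒lookup m)) q₃) λ ()
  One⇒∃! third  | _ | _ | _ = e₃ , (member q₃ , p₃) , λ (m , p) → pick (all p) m
    where
    pick : ∀ {e} → e ≡ e₁ ⊎ e ≡ e₂ ⊎ e ≡ e₃ → e ∈ M → e₃ ≡ e
    pick (inj₁ refl) m = contradiction (trans (sym (VecP.[]=⇒lookup m)) q₁) λ ()
    pick (inj₂ (inj₁ refl)) m = contradiction (trans (sym (VecP.[]=⇒lookup m)) q₂) λ ()
    pick (inj₂ (inj₂ refl)) _ = refl

module _ (n : ℕ) (5≤n : 5 ≤ n) where

  private instance
    n≢0 : NonZero n
    n≢0 = >-nonZero (≤-trans (s≤s z≤n) 5≤n)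

  open SimpleGraph (P[ n ,2] 5≤n)

  toℕ-shift : ∀ k (i : Fin n) → toℕ (shift k i) ≡ (toℕ i + k) % n
  toℕ-shift k i = toℕ-fromℕ< (m%n<n (toℕ i + k) n)

  shift-mod : ∀ k m → shift k (m mod n) ≡ (m + k) mod n
  shift-mod k m = toℕ-injective (begin
    toℕ (shift k (m mod n))   ≡⟨ toℕ-shift k (m mod n) ⟩
    (toℕ (m mod n) + k) % n   ≡⟨ cong (λ x → (x + k) % n) (toℕ-fromℕ< (m%n<n m n)) ⟩
    (m % n + k) % n           ≡⟨ %-distribˡ-+ (m % n) k n ⟩
    (m % n % n + k % n) % n   ≡⟨ cong (λ x → (x + k % n) % n) (m%n%n≡m%n m n) ⟩
    (m % n + k % n) % n       ≡⟨ %-distribˡ-+ m k n ⟨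
    (m + k) % n               ≡⟨ toℕ-fromℕ< (m%n<n (m + k) n) ⟨
    toℕ ((m + k) mod n)       ∎)
    where open ≡-Reasoning

  mod-toℕ : ∀ (i : Fin n) → toℕ i mod n ≡ i
  mod-toℕ i = toℕ-injective (trans (toℕ-fromℕ< (m%n<n (toℕ i) n)) (m<n⇒m%n≡m (toℕ<n i)))

  mod-+ : ∀ k → (k + n) mod n ≡ k mod n
  mod-+ k = toℕ-injective (trans (toℕ-fromℕ< (m%n<n (k + n) n))
    (trans ([m+n]%n≡m%n k n) (sym (toℕ-fromℕ< (m%n<n k n)))))

  shift-inverse : ∀ a b → a + b ≡ n → ∀ (i : Fin n) → shift b (shift a i) ≡ i
  shift-inverse a b eq i = begin
    shift b (shift a i)        ≡⟨ shift-mod b (toℕ i + a) ⟩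
    (toℕ i + a + b) mod n      ≡⟨ cong (λ x → x mod n) (trans (+-assoc (toℕ i) a b) (cong (toℕ i +_) eq)) ⟩
    (toℕ i + n) mod n          ≡⟨ mod-+ (toℕ i) ⟩
    toℕ i mod n                ≡⟨ mod-toℕ i ⟩
    i                          ∎
    where open ≡-Reasoning

  shift-injective : ∀ k → k ≤ n → ∀ {i j : Fin n} → shift k i ≡ shift k j → i ≡ j
  shift-injective k k≤n {i} {j} eq = trans (sym (shift-inverse k (n ∸ k) (m+[n∸m]≡n k≤n) i))
    (trans (cong (shift (n ∸ k)) eq) (shift-inverse k (n ∸ k) (m+[n∸m]≡n k≤n) j))

  ends-edge : ∀ f i → ends (edge f i) ≡ petersenEnds (f , i)
  ends-edge f i = cong petersenEnds (remQuot-combine f i)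

  Meets : Vertex n → Fin 3 × Fin n → Set
  Meets x e = x ≡ proj₁ (petersenEnds e) ⊎ x ≡ proj₂ (petersenEnds e)

  meets : ∀ {x} f i → Incident x (edge f i) → Meets x (f , i)
  meets {x} f i = subst (λ (a , b) → x ≡ a ⊎ x ≡ b) (ends-edge f i)

  meets⁻ : ∀ {x} f i → Meets x (f , i) → Incident x (edge f i)
  meets⁻ {x} f i = subst (λ (a , b) → x ≡ a ⊎ x ≡ b) (sym (ends-edge f i))

  apart : ∀ (f g : Fin 3) (i j : Fin n) → (f , i) ≢ (g , j) → edge f i ≢ edge g j
  apart f g i j ne eq with combine-injective f i g j eq
  ... | refl , refl = ne refl

  around-u : ∀ (i : Fin n) {e} → Incident (u (shift 2 i)) e →
             e ≡ edge 0F i ⊎ e ≡ edge 1F (shift 2 i) ⊎ e ≡ edge 0F (shift 2 i)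
  around-u i {e} = by (edge-view {n} e)
    where
    u-inj : ∀ {i j : Fin n} → u i ≡ u j → i ≡ j
    u-inj refl = refl
    by : ∀ {e} → EdgeView n e → Incident (u (shift 2 i)) e →
         e ≡ edge 0F i ⊎ e ≡ edge 1F (shift 2 i) ⊎ e ≡ edge 0F (shift 2 i)
    by (edge-at f j) inc with f | meets f j inc
    ... | 0F | inj₁ eq = inj₂ (inj₂ (cong (edge 0F) (sym (u-inj eq))))
    ... | 0F | inj₂ eq = inj₁ (cong (edge 0F) (sym (shift-injective 2 (≤-trans (s≤s (s≤s z≤n)) 5≤n) (u-inj eq))))
    ... | 1F | inj₁ eq = inj₂ (inj₁ (cong (edge 1F) (sym (u-inj eq))))
    ... | 1F | inj₂ ()
    ... | 2F | inj₁ ()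
    ... | 2F | inj₂ ()

  around-v : ∀ (i : Fin n) {e} → Incident (v (shift 1 i)) e →
             e ≡ edge 2F i ⊎ e ≡ edge 1F (shift 1 i) ⊎ e ≡ edge 2F (shift 1 i)
  around-v i {e} = by (edge-view {n} e)
    where
    v-inj : ∀ {i j : Fin n} → v i ≡ v j → i ≡ j
    v-inj refl = refl
    by : ∀ {e} → EdgeView n e → Incident (v (shift 1 i)) e →
         e ≡ edge 2F i ⊎ e ≡ edge 1F (shift 1 i) ⊎ e ≡ edge 2F (shift 1 i)
    by (edge-at f j) inc with f | meets f j inc
    ... | 2F | inj₁ eq = inj₂ (inj₂ (cong (edge 2F) (sym (v-inj eq))))
    ... | 2F | inj₂ eq = inj₁ (cong (edge 2F) (sym (shift-injective 1 (≤-trans (s≤s z≤n) 5≤n) (v-inj eq))))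
    ... | 1F | inj₁ ()
    ... | 1F | inj₂ eq = inj₂ (inj₁ (cong (edge 1F) (sym (v-inj eq))))
    ... | 0F | inj₁ ()
    ... | 0F | inj₂ ()

  -- Index i stands for the vertices uᵢ₊₂ and vᵢ₊₁, so that no backward shift occurs. All vertices
  -- are reached because shifts are bijections.
  Local : Vec Col n → Set
  Local cs = ∀ (i : Fin n) →
    One (skip (lookup cs i)) (spoke (lookup cs (shift 2 i))) (skip (lookup cs (shift 2 i))) ×
    One (next (lookup cs i)) (spoke (lookup cs (shift 1 i))) (next (lookup cs (shift 1 i)))

  module _ (cs : Vec Col n) where

    private
      M = edges cs
      U-args : ∀ (i : Fin n) (R : Set) → ((p₁ : Incident (u (shift 2 i)) (edge 0F i)) (p₂ : Incident (u (shift 2 i)) (edge 1F (shift 2 i)))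
        (p₃ : Incident (u (shift 2 i)) (edge 0F (shift 2 i))) → edge 0F i ≢ edge 1F (shift 2 i) →
        edge 0F i ≢ edge 0F (shift 2 i) → edge 1F (shift 2 i) ≢ edge 0F (shift 2 i) → R) → R
      U-args i R k = k (meets⁻ 0F i (inj₂ refl)) (meets⁻ 1F (shift 2 i) (inj₁ refl)) (meets⁻ 0F (shift 2 i) (inj₁ refl))
        (apart 0F 1F i (shift 2 i) λ ()) (apart 0F 0F i (shift 2 i) λ eq → shift-≢ 2 (≤-trans (s≤s (s≤s (s≤s z≤n))) 5≤n) i (cong proj₂ eq)) (apart 1F 0F (shift 2 i) (shift 2 i) λ ())
      V-args : ∀ (i : Fin n) (R : Set) → ((p₁ : Incident (v (shift 1 i)) (edge 2F i)) (p₂ : Incident (v (shift 1 i)) (edge 1F (shift 1 i)))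
        (p₃ : Incident (v (shift 1 i)) (edge 2F (shift 1 i))) → edge 2F i ≢ edge 1F (shift 1 i) →
        edge 2F i ≢ edge 2F (shift 1 i) → edge 1F (shift 1 i) ≢ edge 2F (shift 1 i) → R) → R
      V-args i R k = k (meets⁻ 2F i (inj₂ refl)) (meets⁻ 1F (shift 1 i) (inj₂ refl)) (meets⁻ 2F (shift 1 i) (inj₁ refl))
        (apart 2F 1F i (shift 1 i) λ ()) (apart 2F 2F i (shift 1 i) λ eq → shift-≢ 1 (≤-trans (s≤s (s≤s z≤n)) 5≤n) i (cong proj₂ eq)) (apart 1F 2F (shift 1 i) (shift 1 i) λ ())

      One-edges : ∀ {f g h i j k} → One (lookup M (edge f i)) (lookup M (edge g j)) (lookup M (edge h k)) →
                  One (bit-of f (lookup cs i)) (bit-of g (lookup cs j)) (bit-of h (lookup cs k))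
      One-edges {f} {g} {h} {i} {j} {k} rewrite lookup-edges cs f i | lookup-edges cs g j | lookup-edges cs h k = λ o → o
      edges-One : ∀ {f g h i j k} → One (bit-of f (lookup cs i)) (bit-of g (lookup cs j)) (bit-of h (lookup cs k)) →
                  One (lookup M (edge f i)) (lookup M (edge g j)) (lookup M (edge h k))
      edges-One {f} {g} {h} {i} {j} {k} rewrite lookup-edges cs f i | lookup-edges cs g j | lookup-edges cs h k = λ o → o

    perfect⇒local : IsPerfectMatching (edges cs) → Local cs
    perfect⇒local pm i =
      One-edges {0F} {1F} {0F} (U-args i _ λ p₁ p₂ p₃ d₁ d₂ d₃ → ∃!⇒One M (Incident (u (shift 2 i))) p₁ p₂ p₃ (around-u i) d₁ d₂ d₃ (pm (u (shift 2 i)))) ,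
      One-edges {2F} {1F} {2F} (V-args i _ λ p₁ p₂ p₃ d₁ d₂ d₃ → ∃!⇒One M (Incident (v (shift 1 i))) p₁ p₂ p₃ (around-v i) d₁ d₂ d₃ (pm (v (shift 1 i))))

    local⇒perfect : Local cs → IsPerfectMatching (edges cs)
    local⇒perfect loc (u j) = subst (λ j → ∃! _≡_ λ e → e ∈ M × Incident (u j) e)
      (shift-inverse (n ∸ 2) 2 (m∸n+n≡m (≤-trans (s≤s (s≤s z≤n)) 5≤n)) j)
      (U-args i _ λ p₁ p₂ p₃ d₁ d₂ d₃ → One⇒∃! M (Incident (u (shift 2 i))) p₁ p₂ p₃ (around-u i) d₁ d₂ d₃
        (edges-One {0F} {1F} {0F} (proj₁ (loc i))))
      where i = shift (n ∸ 2) j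
    local⇒perfect loc (v j) = subst (λ j → ∃! _≡_ λ e → e ∈ M × Incident (v j) e)
      (shift-inverse (n ∸ 1) 1 (m∸n+n≡m (≤-trans (s≤s z≤n) 5≤n)) j)
      (V-args i _ λ p₁ p₂ p₃ d₁ d₂ d₃ → One⇒∃! M (Incident (v (shift 1 i))) p₁ p₂ p₃ (around-v i) d₁ d₂ d₃
        (edges-One {2F} {1F} {2F} (proj₂ (loc i))))
      where i = shift (n ∸ 1) j

u₀ u₁ v₀ : State → Bool
u₀ a0 = false
u₀ a1 = false
u₀ a2 = true
u₀ a3 = true
u₀ b0 = false
u₀ b1 = false
u₀ b2 = true
u₀ b3 = true
u₁ a0 = false
u₁ a1 = true
u₁ a2 = true
u₁ a3 = false
u₁ b0 = false
u₁ b1 = true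
u₁ b2 = true
u₁ b3 = false
v₀ a0 = false
v₀ a1 = true
v₀ a2 = false
v₀ a3 = true
v₀ b0 = true
v₀ b1 = false
v₀ b2 = true
v₀ b3 = false

state : Bool → Bool → Bool → State
state a b h = after ⟨ a , false , false ⟩ ⟨ b , false , h ⟩

edge-local : ∀ {p c q} → Edge p c q →
  One (u₀ p) (spoke c) (skip c) × One (v₀ p) (spoke c) (next c) × u₀ q ≡ u₁ p × u₁ q ≡ skip c × v₀ q ≡ next c
edge-local a0a0 = second , second , refl , refl , refl
edge-local a0a1 = third , third , refl , refl , refl
edge-local a1a2 = third , first , refl , refl , refl
edge-local a2a3 = first , third , refl , refl , refl
edge-local a3a0 = first , first , refl , refl , refl
edge-local b0b1 = third , first , refl , refl , refl
edge-local b1b3 = second , second , refl , refl , refl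
edge-local b1b2 = third , third , refl , refl , refl
edge-local b2b3 = first , first , refl , refl , refl
edge-local b3b0 = first , third , refl , refl , refl

local-edge : ∀ {a s x h y} b → One a s x → One h s y → Edge (state a b h) ⟨ x , s , y ⟩ (state b x y)
local-edge false first  first  = a3a0
local-edge false first  third  = b3b0
local-edge false second second = a0a0
local-edge false third  first  = b0b1
local-edge false third  third  = a0a1
local-edge true  first  first  = b2b3
local-edge true  first  third  = a2a3
local-edge true  second second = b1b3
local-edge true  third  first  = a1a2
local-edge true  third  third  = b1b2

module _ (n : ℕ) (5≤n : 5 ≤ n) (cs : Vec Col n) where

  private instance
    n≢0 : NonZero n
    n≢0 = >-nonZero (≤-trans (s≤s z≤n) 5≤n)

  private
    col : ℕ → Col
    col k = lookup cs (k mod n)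

    col-+n : ∀ k → col (k + n) ≡ col k
    col-+n k = cong (lookup cs) (mod-+ n 5≤n k)

    from : ℕ → ℕ → List Col
    from k zero    = []
    from k (suc l) = col k ∷ from (suc k) l

    from-periodic : ∀ k l → from (k + n) l ≡ from k l
    from-periodic k zero    = refl
    from-periodic k (suc l) = cong₂ _∷_ (col-+n k) (from-periodic (suc k) l)

    from-++ : ∀ k a b → from k (a + b) ≡ from k a ++ from (k + a) b
    from-++ k zero    b = cong (λ k → from k b) (sym (+-identityʳ k))
    from-++ k (suc a) b = cong (col k ∷_) (trans (from-++ (suc k) a b) (cong (λ m → from (suc k) a ++ from m b) (sym (+-suc k a))))

    from-toList : ∀ {m} k (ds : Vec Col m) → (∀ i → col (k + toℕ i) ≡ lookup ds i) → from k m ≡ toList ds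
    from-toList k []       h = refl
    from-toList k (d ∷ ds) h = cong₂ _∷_ (trans (cong col (sym (+-identityʳ k))) (h zero))
      (from-toList (suc k) ds λ i → trans (cong col (sym (+-suc k (toℕ i)))) (h (suc i)))

    all-columns : from 0 n ≡ toList cs
    all-columns = from-toList 0 cs λ i → cong (lookup cs) (mod-toℕ n 5≤n i)

    LocalAt : ℕ → Set
    LocalAt k = One (skip (col k)) (spoke (col (2 + k))) (skip (col (2 + k))) ×
                One (next (col (1 + k))) (spoke (col (2 + k))) (next (col (2 + k)))

    local-at : Local n 5≤n cs → ∀ k → LocalAt k
    local-at loc k =
      subst (λ i → One (skip (col k)) (spoke (lookup cs i)) (skip (lookup cs i)))
        (trans (shift-mod n 5≤n 2 k) (cong (λ x → x mod n) (+-comm k 2))) (proj₁ (loc (k mod n))) ,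
      subst (λ i → One (next (col (1 + k))) (spoke (lookup cs i)) (next (lookup cs i)))
        (trans (shift-mod n 5≤n 1 (1 + k)) (cong (λ x → x mod n) (+-comm (1 + k) 1))) (proj₂ (loc ((1 + k) mod n)))

    -- A state looks back two columns, so this is the state before column k + 2.
    before : ℕ → State
    before k = state (skip (col k)) (skip (col (1 + k))) (next (col (1 + k)))

    path-from : Local n 5≤n cs → ∀ k l → Path (before k) (from (2 + k) l) (before (k + l))
    path-from loc k zero    = subst (λ m → Path (before k) [] (before m)) (sym (+-identityʳ k)) []
    path-from loc k (suc l) = subst (λ m → Path (before k) (from (2 + k) (suc l)) (before m)) (sym (+-suc k l))
      (local-edge (skip (col (1 + k))) (proj₁ (local-at loc k)) (proj₂ (local-at loc k)) ∷ path-from loc (suc k) l)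

    before-periodic : ∀ k → before (k + n) ≡ before k
    before-periodic k = cong₂ (λ c d → state (skip c) (skip d) (next d)) (col-+n k) (col-+n (1 + k))

  local⇒closed : Local n 5≤n cs → ∃[ q ] Path q (toList cs) q
  local⇒closed loc = before k , subst₂ (Path (before k)) columns≡ (before-periodic k) (path-from loc k n)
    where
    -- With this start the first column read is column n, which is column 0 again.
    k = n ∸ 2
    columns≡ : from (2 + k) n ≡ toList cs
    columns≡ = trans (cong (λ m → from m n) (m+[n∸m]≡n (≤-trans (s≤s (s≤s z≤n)) 5≤n)))
      (trans (from-periodic 0 n) all-columns)

  private
    local-along : ∀ {q r} j k l → Path q (from j l) r → 3 + k ≤ l → LocalAt (j + k)
    local-along j zero (suc (suc (suc l))) (e₁ ∷ e₂ ∷ e₃ ∷ π) _ =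
      subst LocalAt (sym (+-identityʳ j)) (subst (λ b → One b _ _) first-bit (proj₁ (edge-local e₃)) ,
        subst (λ b → One b _ _) next-bit (proj₁ (proj₂ (edge-local e₃))))
      where
      first-bit = trans (proj₁ (proj₂ (proj₂ (edge-local e₂)))) (proj₁ (proj₂ (proj₂ (proj₂ (edge-local e₁)))))
      next-bit = proj₂ (proj₂ (proj₂ (proj₂ (edge-local e₂))))
    local-along j (suc k) (suc l) (e ∷ π) (s≤s le) = subst LocalAt (sym (+-suc j k)) (local-along (suc j) k l π le)
    local-along j zero (suc zero) π (s≤s ())
    local-along j zero (suc (suc zero)) π (s≤s (s≤s ()))

  closed⇒local : ∀ {q} → Path q (toList cs) q → Local n 5≤n cs
  closed⇒local {q} π i = at-u , at-v
    where
    -- In three consecutive copies every window of three columns, also one across the seam, is an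
    -- ordinary stretch of the path. The condition at v is read one column earlier, at i + (n - 1),
    -- and its window can reach into the third copy.
    thrice : Path q (from 0 (n + (n + n))) q
    thrice = subst (λ xs → Path q xs q) (sym (begin
      from 0 (n + (n + n))                                ≡⟨ from-++ 0 n (n + n) ⟩
      from 0 n ++ from n (n + n)                     ≡⟨ cong (from 0 n ++_) (from-periodic 0 (n + n)) ⟩
      from 0 n ++ from 0 (n + n)                     ≡⟨ cong (from 0 n ++_) (from-++ 0 n n) ⟩
      from 0 n ++ from 0 n ++ from n n          ≡⟨ cong (λ xs → from 0 n ++ from 0 n ++ xs) (from-periodic 0 n) ⟩
      from 0 n ++ from 0 n ++ from 0 n          ≡⟨ cong (λ xs → xs ++ xs ++ xs) all-columns ⟩
      toList cs ++ toList cs ++ toList cs       ∎)) (π ++ᴾ (π ++ᴾ π))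
      where open ≡-Reasoning
    2≤n : 2 ≤ n
    2≤n = ≤-trans (s≤s (s≤s z≤n)) 5≤n
    here′ : ∀ k → 3 + k ≤ n + (n + n) → LocalAt k
    here′ k le = local-along 0 k (n + (n + n)) thrice le
    i≡ : toℕ i mod n ≡ i
    i≡ = mod-toℕ n 5≤n i
    at-u : One (skip (lookup cs i)) (spoke (lookup cs (shift 2 i))) (skip (lookup cs (shift 2 i)))
    at-u = subst₂ (λ i j → One (skip (lookup cs i)) (spoke (lookup cs j)) (skip (lookup cs j))) i≡
      (cong (λ x → x mod n) (+-comm 2 (toℕ i)))
      (proj₁ (here′ (toℕ i) (≤-trans (+-monoʳ-≤ 3 (<⇒≤ (toℕ<n i))) (≤-trans (+-monoˡ-≤ n (≤-trans (s≤s (s≤s (s≤s z≤n))) 5≤n)) (+-monoʳ-≤ n (m≤m+n n n))))))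
    at-v : One (next (lookup cs i)) (spoke (lookup cs (shift 1 i))) (next (lookup cs (shift 1 i)))
    at-v = subst₂ (λ i j → One (next (lookup cs i)) (spoke (lookup cs j)) (next (lookup cs j)))
      (trans (cong (λ x → x mod n) 1+k) (trans (mod-+ n 5≤n (toℕ i)) i≡))
      (trans (cong (λ x → x mod n) 2+k) (mod-+ n 5≤n (toℕ i + 1)))
      (proj₂ (here′ k (≤-trans (≤-reflexive (cong (2 +_) 1+k)) (≤-trans (≤-reflexive (sym (+-assoc 2 (toℕ i) n)))
        (≤-trans (+-monoˡ-≤ n (+-mono-≤ 2≤n (<⇒≤ (toℕ<n i)))) (≤-reflexive (+-assoc n n n)))))))
      where
      k = toℕ i + (n ∸ 1)
      1+k : 1 + k ≡ toℕ i + n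
      1+k = trans (sym (+-suc (toℕ i) (n ∸ 1))) (cong (toℕ i +_) (m+[n∸m]≡n (≤-trans (s≤s z≤n) 2≤n)))
      2+k : 2 + k ≡ toℕ i + 1 + n
      2+k = trans (cong suc 1+k) (cong (_+ n) (+-comm 1 (toℕ i)))

module _ (n : ℕ) (5≤n : 5 ≤ n) where

  open SimpleGraph (P[ n ,2] 5≤n)

  perfect⇔closed : ∀ cs → IsPerfectMatching (edges cs) ⇔ (∃[ q ] Path q (toList cs) q)
  perfect⇔closed cs = mk⇔ (λ pm → local⇒closed n 5≤n cs (perfect⇒local n 5≤n cs pm))
                          (λ (q , π) → local⇒perfect n 5≤n cs (closed⇒local n 5≤n cs π))

-- Forcing numbers in the graph and for closed paths

vector : ∀ {A : Set} {n} (xs : List A) → length xs ≡ n → ∃[ ys ] toList {n = n} ys ≡ xs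
vector xs refl = fromList xs , VecP.toList∘fromList xs

toList-inj : ∀ {A : Set} {n} (xs ys : Vec A n) → toList xs ≡ toList ys → xs ≡ ys
toList-inj []       []       _  = refl
toList-inj (x ∷ xs) (y ∷ ys) eq = cong₂ _∷_ (List.∷-injectiveˡ eq) (toList-inj xs ys (List.∷-injectiveʳ eq))

zip-word : ∀ ms cs → length ms ≡ length cs → ∃[ w ] marks w ≡ ms × contents w ≡ cs
zip-word []       []       _  = [] , refl , refl
zip-word (m ∷ ms) (c ∷ cs) eq with zip-word ms cs (suc-injective eq)
... | w , refl , refl = (m , c) ∷ w , refl , refl

module _ (n : ℕ) (5≤n : 5 ≤ n) where

  open SimpleGraph (P[ n ,2] 5≤n)
  private module PM cs = Equivalence (perfect⇔closed n 5≤n cs)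

  forcing⇒ : ∀ (ms cs : Vec Col n) → IsForcingSet (edges cs) (edges ms) → Forces (toList ms) (toList cs)
  forcing⇒ ms cs (sub , uniq) = ⊆⇒⊑* ms cs sub , unique
    where
    unique : ∀ {q ds} → Path q ds q → toList ms ⊑* ds → ds ≡ toList cs
    unique {q} {ds} π l with vector ds (trans (sym (Pointwise-length l)) (VecP.length-toList ms))
    ... | ds , refl with List.≡-dec _≟ᶜ_ (toList ds) (toList cs)
    ... | yes eq = eq
    ... | no  ne = contradiction (λ {e} → ⊑*⇒⊆ ms ds l {e})
      (uniq (edges ds) (PM.from ds (q , π)) (ne ∘ cong toList ∘ edges-injective ds cs))

  ⇒forcing : ∀ (ms cs : Vec Col n) → Forces (toList ms) (toList cs) → IsForcingSet (edges cs) (edges ms)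
  ⇒forcing ms cs (l , uniq) = ⊑*⇒⊆ ms cs l , λ M′ pm ne sub →
    ne (subst (λ M′ → IsPerfectMatching M′ → edges ms ⊆ M′ → M′ ≡ edges cs) (edges-columns n M′) (same (columns n M′)) pm sub)
    where
    same : ∀ ds → IsPerfectMatching (edges ds) → edges ms ⊆ edges ds → edges ds ≡ edges cs
    same ds pm sub = cong edges (toList-inj ds cs (uniq (proj₂ (PM.to ds pm)) (⊆⇒⊑* ms ds sub)))

  attains⇒ : ∀ (cs : Vec Col n) {k} → IsForcingNumber (edges cs) k → Attains (toList cs) k
  attains⇒ cs {k} ((S , fs , card) , least) = some (edges-columns n S) , every
    where
    some : edges (columns n S) ≡ S → ∃[ w ] contents w ≡ toList cs × Forcing w × weight w ≡ k
    some eq with zip-word (toList (columns n S)) (toList cs) (trans (VecP.length-toList (columns n S)) (sym (VecP.length-toList cs)))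
    ... | w , em , ec = w , ec ,
      subst₂ Forces (sym em) (sym ec) (forcing⇒ (columns n S) cs (subst (IsForcingSet (edges cs)) (sym eq) fs)) ,
      trans (cong weight* em) (trans (sym (∣edges∣ (columns n S))) (trans (cong ∣_∣ eq) card))
    every : ∀ w → contents w ≡ toList cs → Forcing w → k ≤ weight w
    every w ec F with vector (marks w) (trans (marks-contents-length w) (trans (cong length ec) (VecP.length-toList cs)))
    ... | ms , em = ≤-trans (least (edges ms) (⇒forcing ms cs (subst₂ Forces (sym em) ec F)))
                      (≤-reflexive (trans (∣edges∣ ms) (cong weight* em)))

  ⇒attains : ∀ (cs : Vec Col n) {k} → Attains (toList cs) k → IsForcingNumber (edges cs) k
  ⇒attains cs {k} ((w , ec , F , sz) , least) = some , every
    where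
    some : ∃[ S ] IsForcingSet (edges cs) S × ∣ S ∣ ≡ k
    some with vector (marks w) (trans (marks-contents-length w) (trans (cong length ec) (VecP.length-toList cs)))
    ... | ms , em = edges ms , ⇒forcing ms cs (subst₂ Forces (sym em) ec F) ,
                    trans (∣edges∣ ms) (trans (cong weight* em) sz)
    every : ∀ S → IsForcingSet (edges cs) S → k ≤ ∣ S ∣
    every S fs = subst (λ S → IsForcingSet (edges cs) S → k ≤ ∣ S ∣) (edges-columns n S) (bound (columns n S)) fs
      where
      bound : ∀ (ms : Vec Col n) → IsForcingSet (edges cs) (edges ms) → k ≤ ∣ edges ms ∣
      bound ms fs with zip-word (toList ms) (toList cs) (trans (VecP.length-toList ms) (sym (VecP.length-toList cs)))
      ... | w , em , ec = ≤-trans (least w ec (subst₂ Forces (sym em) (sym ec) (forcing⇒ ms cs fs)))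
                            (≤-reflexive (trans (cong weight* em) (sym (∣edges∣ ms))))

  spectrum⇒ : ∀ {k} → forcingSpectrum (P[ n ,2] 5≤n) k →
              ∃[ cs ] length cs ≡ n × (∃[ q ] Path q cs q) × Attains cs k
  spectrum⇒ {k} (M , pm , num) = toList cs , VecP.length-toList cs ,
    PM.to cs (subst IsPerfectMatching (sym (edges-columns n M)) pm) ,
    attains⇒ cs (subst (λ M → IsForcingNumber M k) (sym (edges-columns n M)) num)
    where cs = columns n M

  ⇒spectrum : ∀ {k q} cs → length cs ≡ n → Path q cs q → Attains cs k → forcingSpectrum (P[ n ,2] 5≤n) k
  ⇒spectrum cs len π num with vector cs len
  ... | ds , refl = edges ds , PM.from ds (_ , π) , ⇒attains ds num

-- From closed paths to tilings

attains-rotate : ∀ xs ys {k} → Attains (xs ++ ys) k → Attains (ys ++ xs) k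
attains-rotate xs ys ((w , e , F , sz) , least) = turn , bound
  where
  turn : ∃[ w ] contents w ≡ ys ++ xs × Forcing w × weight w ≡ _
  turn with contents-split xs w e
  ... | x , y , refl , refl , refl = y ++ x , List.map-++ proj₂ y x , Forcing-rotate x y F ,
    trans (weight-++ y x) (trans (+-comm (weight y) (weight x)) (trans (sym (weight-++ x y)) sz))
  bound : ∀ w′ → contents w′ ≡ ys ++ xs → Forcing w′ → _ ≤ weight w′
  bound w′ e′ F′ with contents-split ys w′ e′
  ... | y , x , refl , refl , refl = ≤-trans (least (x ++ y) (List.map-++ proj₂ x y) (Forcing-rotate y x F′))
    (≤-reflexive (trans (weight-++ x y) (trans (+-comm (weight x) (weight y)) (sym (weight-++ y x)))))

tiles-a0 : ∀ {cs} → Path a0 cs a0 → ∃[ ts ] tiling {a0} ts ≡ cs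
tiles-a0 [] = [] , refl
tiles-a0 (a0a0 ∷ π) with tiles-a0 π
... | ts , refl = 𝟏 ∷ ts , refl
tiles-a0 (a0a1 ∷ a1a2 ∷ a2a3 ∷ a3a0 ∷ π) with tiles-a0 π
... | ts , refl = 𝐪 ∷ ts , refl

tiles-b0 : ∀ {cs} → Path b0 cs b0 → ∃[ ts ] tiling {b0} ts ≡ cs
tiles-b0 [] = [] , refl
tiles-b0 (b0b1 ∷ b1b3 ∷ b3b0 ∷ π) with tiles-b0 π
... | ts , refl = 𝐓 ∷ ts , refl
tiles-b0 (b0b1 ∷ b1b2 ∷ b2b3 ∷ b3b0 ∷ π) with tiles-b0 π
... | ts , refl = 𝐐 ∷ ts , refl

data Cut (q : State) (cs : List Col) (r : State) : Set where
  cut : ∀ {s} xs ys → s ≡ a0 ⊎ s ≡ b0 → xs ++ ys ≡ cs → Path q xs s → Path s ys r → Cut q cs r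

-- Within three columns every path meets `a0` or `b0`. A closed path reopened there starts and ends
-- at a home state and is a sequence of tiles.
find-cut : ∀ {q cs r} → 3 ≤ length cs → Path q cs r → Cut q cs r
find-cut {a0} _ π = cut [] _ (inj₁ refl) refl [] π
find-cut {b0} _ π = cut [] _ (inj₂ refl) refl [] π
find-cut _ (a1a2 ∷ a2a3 ∷ a3a0 ∷ π) = cut (_ ∷ _ ∷ _ ∷ []) _ (inj₁ refl) refl (a1a2 ∷ a2a3 ∷ a3a0 ∷ []) π
find-cut _ (a2a3 ∷ a3a0 ∷ π) = cut (_ ∷ _ ∷ []) _ (inj₁ refl) refl (a2a3 ∷ a3a0 ∷ []) π
find-cut _ (a3a0 ∷ π) = cut (_ ∷ []) _ (inj₁ refl) refl (a3a0 ∷ []) π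
find-cut _ (b1b3 ∷ b3b0 ∷ π) = cut (_ ∷ _ ∷ []) _ (inj₂ refl) refl (b1b3 ∷ b3b0 ∷ []) π
find-cut _ (b1b2 ∷ b2b3 ∷ b3b0 ∷ π) = cut (_ ∷ _ ∷ _ ∷ []) _ (inj₂ refl) refl (b1b2 ∷ b2b3 ∷ b3b0 ∷ []) π
find-cut _ (b2b3 ∷ b3b0 ∷ π) = cut (_ ∷ _ ∷ []) _ (inj₂ refl) refl (b2b3 ∷ b3b0 ∷ []) π
find-cut _ (b3b0 ∷ π) = cut (_ ∷ []) _ (inj₂ refl) refl (b3b0 ∷ []) π
find-cut {a1} () []
find-cut {a1} (s≤s ()) (a1a2 ∷ [])
find-cut {a1} (s≤s (s≤s ())) (a1a2 ∷ a2a3 ∷ [])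
find-cut {a2} () []
find-cut {a2} (s≤s ()) (a2a3 ∷ [])
find-cut {a3} () []
find-cut {b1} () []
find-cut {b1} (s≤s ()) (b1b3 ∷ [])
find-cut {b1} (s≤s ()) (b1b2 ∷ [])
find-cut {b1} (s≤s (s≤s ())) (b1b2 ∷ b2b3 ∷ [])
find-cut {b2} () []
find-cut {b2} (s≤s ()) (b2b3 ∷ [])
find-cut {b3} () []

-- The two inclusions

range-a0 : ∀ (ts : List (Tile a0)) {n k} → span ts ≡ n → 34 ≤ n → Attains (tiling ts) k → [ ⌈ (n + 2) / 6 ⌉ , ⌈ n / 4 ⌉ ] k
range-a0 ts refl le ((w , e , F , refl) , least) = let w′ , e′ , F′ , up = upper-a0 ts le in
  ceiling-least {span ts + 2} 5 (lower-a0 ts le w e F) ,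
  ≤-trans (least w′ e′ F′) (ceiling-greatest (span ts) 3 up)

range-b0 : ∀ (ts : List (Tile b0)) {n k} → span ts ≡ n → 34 ≤ n → Attains (tiling ts) k →
           [ ⌈ n / 12 ⌉ + 1 , ⌈ (n + 3) / 7 ⌉ + δ n ] k
range-b0 ts refl le ((w , e , F , refl) , least) = let w′ , e′ , F′ , up = upper-b0 ts le in
  low (weight w) (lower-b0 ts le w e F) , ≤-trans (least w′ e′ F′) up
  where
  low : ∀ k → span ts + 12 ≤ 12 * k → ⌈ span ts / 12 ⌉ + 1 ≤ k
  low zero    h = contradiction (≤-trans (m≤n+m 12 (span ts)) h) λ ()
  low (suc k) h = ≤-trans (≤-reflexive (+-comm ⌈ span ts / 12 ⌉ 1)) (s≤s (ceiling-least {span ts} 11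
    (+-cancelʳ-≤ 12 (span ts) (12 * k) (≤-trans h (≤-reflexive (trans (*-suc 12 k) (+-comm 12 (12 * k))))))))

mainTheorem1 : (n : ℕ) (34≤n : 34 ≤ n) →
    forcingSpectrum (P[ n ,2] (≤-trans (m≤m+n 5 29) 34≤n))
    ≐ ([ ⌈ n / 12 ⌉ + 1 , ⌈ (n + 3) / 7 ⌉ + δ n ] ∪ [ ⌈ (n + 2) / 6 ⌉ , ⌈ n / 4 ⌉ ])
mainTheorem1 n 34≤n = in-range , attained-by
  where
  5≤n = ≤-trans (m≤m+n 5 29) 34≤n

  Range : ℕ → Set
  Range = [ ⌈ n / 12 ⌉ + 1 , ⌈ (n + 3) / 7 ⌉ + δ n ] ∪ [ ⌈ (n + 2) / 6 ⌉ , ⌈ n / 4 ⌉ ]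

  tiled : ∀ {s cs k} → s ≡ a0 ⊎ s ≡ b0 → length cs ≡ n → Path s cs s → Attains cs k → Range k
  tiled {k = k} (inj₁ refl) wide π num = let ts , eq = tiles-a0 π in
    inj₂ (range-a0 ts (trans (cong length eq) wide) 34≤n (subst (λ cs → Attains cs k) (sym eq) num))
  tiled {k = k} (inj₂ refl) wide π num = let ts , eq = tiles-b0 π in
    inj₁ (range-b0 ts (trans (cong length eq) wide) 34≤n (subst (λ cs → Attains cs k) (sym eq) num))

  closed : ∀ {q cs k} → length cs ≡ n → Cut q cs q → Attains cs k → Range k
  closed len (cut xs ys home refl π₁ π₂) num = tiled home
    (trans (List.length-++ ys) (trans (+-comm (length ys) (length xs)) (trans (sym (List.length-++ xs)) len)))
    (π₂ ++ᴾ π₁) (attains-rotate xs ys num)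

  in-range : ∀ {k} → forcingSpectrum (P[ n ,2] 5≤n) k → Range k
  in-range sp = let cs , len , (q , π) , num = spectrum⇒ n 5≤n sp in
    closed len (find-cut (≤-trans (m≤m+n 3 31) (≤-trans 34≤n (≤-reflexive (sym len)))) π) num

  realise : ∀ {k} → Attained n k → forcingSpectrum (P[ n ,2] 5≤n) k
  realise (attained ts wide num) = ⇒spectrum n 5≤n (tiling ts) wide (tiling-path ts) num

  attained-by : ∀ {k} → Range k → forcingSpectrum (P[ n ,2] 5≤n) k
  attained-by (inj₁ (lo , hi)) = realise (values-b0 34≤n lo hi)
  attained-by (inj₂ (lo , hi)) = realise (values-a0 34≤n (ceiling-lower (n + 2) 5 lo) hi)
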